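{- Let $n,k$ be integers with $1\le k\le n-1$, and let $\mathcal{T}^{(n,k)}$ be the class of all trees with boundary having $n$ vertices in total, of which exactly $k$ are interior. A tree $G\in\mathcal{T}^{(n,k)}$ has the Faber-Krahn property in $\mathcal{T}^{(n,k)}$ if and only if $G$ is a comet, i.e. $G$ consists of a path $v_1v_2\cdots v_k$ of interior vertices, where $v_1$ is adjacent to exactly one boundary vertex (if $k\ge 2$), and $v_k$ is adjacent to all remaining boundary vertices (for $k=1$, $G$ is the star with $n-1$ leaves). Such a $G$ is uniquely determined up to isomorphism.
   Context: A tree with boundary is a finite tree $G=(V,E)$ whose vertex set is partitioned into the set $\partial V$ of boundary vertices, which are exactly the vertices of degree $1$, and the set $V_0$ of interior vertices, which are exactly the vertices of degree at least $2$; both sets are assumed nonempty. The discrete Dirichlet operator is $\Delta_0=D_0-A_0$, the $|V_0|\times|V_0|$ matrix obtained from the graph Laplacian $D-A$ of $G$ (with $D$ the diagonal matrix of vertex degrees in $G$ and $A$ the adjacency matrix) by deleting the rows and columns of boundary vertices. The first Dirichlet eigenvalue $\lambda(G)$ is the smallest eigenvalue of $\Delta_0$. A graph $G$ in a class $\mathcal{C}$ has the Faber-Krahn property in $\mathcal{C}$ if $\lambda(G)\le\lambda(H)$ for all $H\in\mathcal{C}$. -}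

module Defs where

open import Algebra.Bundles using (CommutativeMonoid; CommutativeSemigroup)
open import Algebra.Properties.CommutativeSemigroup using (interchange)
open import Data.Bool.Base using (Bool; false; T; if_then_else_)
open import Data.Bool.Properties using (T?)
open import Data.Fin.Base using (Fin; zero; suc; inject₁; fromℕ)
open import Data.Fin.Properties using () renaming (_≟_ to _≟ᶠ_)
open import Data.Fin.Permutation using (Permutation′; _⟨$⟩ʳ_)
open import Data.Integer.Base as ℤ using (ℤ; +_)
open import Data.List.Base using (List; length; filter; lookup; allFin)
open import Data.Nat.Base as ℕ using (ℕ; zero; suc; _⊔_)
import Data.Nat.Properties as ℕₚ
open import Data.Product using (Σ; ∃; ∃-syntax; _×_; _,_; proj₁; proj₂)
open import Data.Rational.Base as ℚ using (ℚ; 0ℚ; 1ℚ; ½; ∣_∣; 1/_; Positive; positive)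
import Data.Rational.Properties as ℚₚ
open import Data.Sum using (_⊎_)
open import Data.Vec.Functional using (Vector; foldr)
open import Function.Definitions using (Injective)
open import Level using (0ℓ)
open import Relation.Binary.PropositionalEquality using (_≡_; _≢_; sym; trans; cong; cong₂; subst; module ≡-Reasoning)
open import Relation.Nullary using (¬_; ⌊_⌋)
open import Relation.Unary using (Pred)

------------------------------------------------------------------------
-- Real numbers: Cauchy sequences of rationals, with _≈_ as equality

IsCauchy : (ℕ → ℚ) → Set
IsCauchy s = ∀ ε → 0ℚ ℚ.< ε →
  ∃[ N ] (∀ m n → N ℕ.≤ m → N ℕ.≤ n → ∣ s m ℚ.- s n ∣ ℚ.< ε)

record ℝ : Set where
  constructor mkℝ
  field
    seq    : ℕ → ℚ
    cauchy : IsCauchy seq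

open ℝ public

infix 4 _≈_ _≤_

_≈_ : ℝ → ℝ → Set
x ≈ y = ∀ ε → 0ℚ ℚ.< ε → ∃[ N ] (∀ n → N ℕ.≤ n → ∣ seq x n ℚ.- seq y n ∣ ℚ.< ε)

_≤_ : ℝ → ℝ → Set
x ≤ y = ∀ ε → 0ℚ ℚ.< ε → ∃[ N ] (∀ n → N ℕ.≤ n → seq x n ℚ.< seq y n ℚ.+ ε)

fromℚ : ℚ → ℝ
fromℚ q = mkℝ (λ _ → q) λ ε 0<ε → 0 , λ _ _ _ _ →
  subst (ℚ._< ε) (sym (cong ∣_∣ (ℚₚ.+-inverseʳ q))) 0<ε

fromℤ : ℤ → ℝ
fromℤ z = fromℚ (z ℚ./ 1)

0ℝ : ℝ
0ℝ = fromℚ 0ℚ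

half+half : ∀ ε → ½ ℚ.* ε ℚ.+ ½ ℚ.* ε ≡ ε
half+half ε = trans (sym (ℚₚ.*-distribʳ-+ ε ½ ½)) (ℚₚ.*-identityˡ ε)

0<half : ∀ {ε} → 0ℚ ℚ.< ε → 0ℚ ℚ.< ½ ℚ.* ε
0<half = ℚₚ.*-monoʳ-<-pos ½

ℚ-+-commutativeSemigroup : CommutativeSemigroup 0ℓ 0ℓ
ℚ-+-commutativeSemigroup = CommutativeMonoid.commutativeSemigroup ℚₚ.+-0-commutativeMonoid

telescope : ∀ a b c → a ℚ.- c ≡ (a ℚ.- b) ℚ.+ (b ℚ.- c)
telescope a b c = sym (begin
  (a ℚ.- b) ℚ.+ (b ℚ.- c)       ≡⟨ ℚₚ.+-assoc a (ℚ.- b) (b ℚ.- c) ⟩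
  a ℚ.+ (ℚ.- b ℚ.+ (b ℚ.- c))   ≡⟨ cong (a ℚ.+_) (ℚₚ.+-assoc (ℚ.- b) b (ℚ.- c)) ⟨
  a ℚ.+ ((ℚ.- b ℚ.+ b) ℚ.- c)   ≡⟨ cong (λ z → a ℚ.+ (z ℚ.- c)) (ℚₚ.+-inverseˡ b) ⟩
  a ℚ.+ (0ℚ ℚ.- c)              ≡⟨ cong (a ℚ.+_) (ℚₚ.+-identityˡ (ℚ.- c)) ⟩
  a ℚ.- c                       ∎)
  where open ≡-Reasoning

+-cauchy : ∀ {s t} → IsCauchy s → IsCauchy t → IsCauchy (λ n → s n ℚ.+ t n)
+-cauchy {s} {t} cs ct ε 0<ε = N ⊔ M , close
  where
  N = proj₁ (cs (½ ℚ.* ε) (0<half 0<ε))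
  M = proj₁ (ct (½ ℚ.* ε) (0<half 0<ε))
  close : ∀ m n → N ⊔ M ℕ.≤ m → N ⊔ M ℕ.≤ n →
          ∣ (s m ℚ.+ t m) ℚ.- (s n ℚ.+ t n) ∣ ℚ.< ε
  close m n hm hn = begin-strict
    ∣ (s m ℚ.+ t m) ℚ.- (s n ℚ.+ t n) ∣   ≡⟨ cong ∣_∣ (regroup (s m) (t m) (s n) (t n)) ⟩
    ∣ (s m ℚ.- s n) ℚ.+ (t m ℚ.- t n) ∣   ≤⟨ ℚₚ.∣p+q∣≤∣p∣+∣q∣ (s m ℚ.- s n) (t m ℚ.- t n) ⟩
    ∣ s m ℚ.- s n ∣ ℚ.+ ∣ t m ℚ.- t n ∣   <⟨ ℚₚ.+-mono-<
        (proj₂ (cs _ (0<half 0<ε)) m n (ℕₚ.m⊔n≤o⇒m≤o N M hm) (ℕₚ.m⊔n≤o⇒m≤o N M hn))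
        (proj₂ (ct _ (0<half 0<ε)) m n (ℕₚ.m⊔n≤o⇒n≤o N M hm) (ℕₚ.m⊔n≤o⇒n≤o N M hn)) ⟩
    ½ ℚ.* ε ℚ.+ ½ ℚ.* ε                   ≡⟨ half+half ε ⟩
    ε                                     ∎
    where
    open ℚₚ.≤-Reasoning
    regroup : ∀ a b c d → (a ℚ.+ b) ℚ.- (c ℚ.+ d) ≡ (a ℚ.- c) ℚ.+ (b ℚ.- d)
    regroup a b c d = trans
      (cong ((a ℚ.+ b) ℚ.+_) (ℚₚ.neg-distrib-+ c d))
      (interchange ℚ-+-commutativeSemigroup a b (ℚ.- c) (ℚ.- d))

eventually-bounded : ∀ {s} → IsCauchy s →
  ∃[ B ] (0ℚ ℚ.< B × ∃[ N ] (∀ n → N ℕ.≤ n → ∣ s n ∣ ℚ.≤ B))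
eventually-bounded {s} cs = B , 0<B , N , bound
  where
  open ℚₚ.≤-Reasoning
  0<1 : 0ℚ ℚ.< 1ℚ
  0<1 = ℚₚ.positive⁻¹ 1ℚ
  N = proj₁ (cs 1ℚ 0<1)
  B = 1ℚ ℚ.+ ∣ s N ∣
  0<B : 0ℚ ℚ.< B
  0<B = ℚₚ.positive⁻¹ B {{ℚₚ.pos+nonNeg⇒pos 1ℚ ∣ s N ∣ {{ℚₚ.∣-∣-nonNeg (s N)}}}}
  bound : ∀ n → N ℕ.≤ n → ∣ s n ∣ ℚ.≤ B
  bound n hn = begin
    ∣ s n ∣                        ≡⟨ cong ∣_∣ (split (s n) (s N)) ⟩
    ∣ (s n ℚ.- s N) ℚ.+ s N ∣      ≤⟨ ℚₚ.∣p+q∣≤∣p∣+∣q∣ (s n ℚ.- s N) (s N) ⟩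
    ∣ s n ℚ.- s N ∣ ℚ.+ ∣ s N ∣    ≤⟨ ℚₚ.+-monoˡ-≤ ∣ s N ∣ (ℚₚ.<⇒≤ (proj₂ (cs 1ℚ 0<1) n N hn ℕₚ.≤-refl)) ⟩
    1ℚ ℚ.+ ∣ s N ∣                 ∎
    where
    split : ∀ a b → a ≡ (a ℚ.- b) ℚ.+ b
    split a b = sym (trans (ℚₚ.+-assoc a (ℚ.- b) b)
      (trans (cong (a ℚ.+_) (ℚₚ.+-inverseˡ b)) (ℚₚ.+-identityʳ a)))

bounded-*-small : ∀ {B} → 0ℚ ℚ.< B → ∀ {ε} → 0ℚ ℚ.< ε →
  ∃[ δ ] (0ℚ ℚ.< δ × (∀ p q → ∣ p ∣ ℚ.≤ B → ∣ q ∣ ℚ.< δ → ∣ p ℚ.* q ∣ ℚ.< ε))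
bounded-*-small {B} 0<B {ε} 0<ε = δ , 0<δ , small
  where
  open ℚₚ.≤-Reasoning
  instance
    B⁺ : Positive B
    B⁺ = positive 0<B
    B≢0 : ℚ.NonZero B
    B≢0 = ℚₚ.pos⇒nonZero B
    ε⁺ : Positive ε
    ε⁺ = positive 0<ε
  δ = (1/ B) ℚ.* ε
  0<δ : 0ℚ ℚ.< δ
  0<δ = ℚₚ.positive⁻¹ δ {{ℚₚ.pos*pos⇒pos (1/ B) {{ℚₚ.1/pos⇒pos B}} ε}}
  small : ∀ p q → ∣ p ∣ ℚ.≤ B → ∣ q ∣ ℚ.< δ → ∣ p ℚ.* q ∣ ℚ.< ε
  small p q hp hq = begin-strict
    ∣ p ℚ.* q ∣            ≡⟨ ℚₚ.∣p*q∣≡∣p∣*∣q∣ p q ⟩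
    ∣ p ∣ ℚ.* ∣ q ∣        ≤⟨ ℚₚ.*-monoʳ-≤-nonNeg ∣ q ∣ {{ℚₚ.∣-∣-nonNeg q}} hp ⟩
    B ℚ.* ∣ q ∣            <⟨ ℚₚ.*-monoʳ-<-pos B hq ⟩
    B ℚ.* ((1/ B) ℚ.* ε)   ≡⟨ sym (ℚₚ.*-assoc B (1/ B) ε) ⟩
    (B ℚ.* (1/ B)) ℚ.* ε   ≡⟨ cong (ℚ._* ε) (ℚₚ.*-inverseʳ B) ⟩
    1ℚ ℚ.* ε               ≡⟨ ℚₚ.*-identityˡ ε ⟩
    ε                      ∎

*-cauchy : ∀ {s t} → IsCauchy s → IsCauchy t → IsCauchy (λ n → s n ℚ.* t n)
*-cauchy {s} {t} cs ct ε 0<ε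
  with eventually-bounded cs | eventually-bounded ct
... | B , 0<B , N₁ , sB | C , 0<C , N₂ , tC
  with bounded-*-small 0<B (0<half 0<ε) | bounded-*-small 0<C (0<half 0<ε)
... | δ , 0<δ , smallB | η , 0<η , smallC
  with ct δ 0<δ | cs η 0<η
... | N₃ , tδ | N₄ , sη = N , close
  where
  N = (N₁ ⊔ N₂) ⊔ (N₃ ⊔ N₄)
  N₁₂ : ∀ {m} → N ℕ.≤ m → N₁ ⊔ N₂ ℕ.≤ m
  N₁₂ = ℕₚ.m⊔n≤o⇒m≤o (N₁ ⊔ N₂) (N₃ ⊔ N₄)
  N₃₄ : ∀ {m} → N ℕ.≤ m → N₃ ⊔ N₄ ℕ.≤ m
  N₃₄ = ℕₚ.m⊔n≤o⇒n≤o (N₁ ⊔ N₂) (N₃ ⊔ N₄)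
  close : ∀ m n → N ℕ.≤ m → N ℕ.≤ n → ∣ s m ℚ.* t m ℚ.- s n ℚ.* t n ∣ ℚ.< ε
  close m n hm hn = begin-strict
    ∣ s m ℚ.* t m ℚ.- s n ℚ.* t n ∣
      ≡⟨ cong ∣_∣ (regroup (s m) (t m) (s n) (t n)) ⟩
    ∣ s m ℚ.* (t m ℚ.- t n) ℚ.+ t n ℚ.* (s m ℚ.- s n) ∣
      ≤⟨ ℚₚ.∣p+q∣≤∣p∣+∣q∣ (s m ℚ.* (t m ℚ.- t n)) (t n ℚ.* (s m ℚ.- s n)) ⟩
    ∣ s m ℚ.* (t m ℚ.- t n) ∣ ℚ.+ ∣ t n ℚ.* (s m ℚ.- s n) ∣
      <⟨ ℚₚ.+-mono-<
           (smallB (s m) (t m ℚ.- t n)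
             (sB m (ℕₚ.m⊔n≤o⇒m≤o N₁ N₂ (N₁₂ hm)))
             (tδ m n (ℕₚ.m⊔n≤o⇒m≤o N₃ N₄ (N₃₄ hm)) (ℕₚ.m⊔n≤o⇒m≤o N₃ N₄ (N₃₄ hn))))
           (smallC (t n) (s m ℚ.- s n)
             (tC n (ℕₚ.m⊔n≤o⇒n≤o N₁ N₂ (N₁₂ hn)))
             (sη m n (ℕₚ.m⊔n≤o⇒n≤o N₃ N₄ (N₃₄ hm)) (ℕₚ.m⊔n≤o⇒n≤o N₃ N₄ (N₃₄ hn)))) ⟩
    ½ ℚ.* ε ℚ.+ ½ ℚ.* ε
      ≡⟨ half+half ε ⟩
    ε ∎
    where
    open ℚₚ.≤-Reasoning
    factor : ∀ a b d → a ℚ.* b ℚ.- a ℚ.* d ≡ a ℚ.* (b ℚ.- d)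
    factor a b d = trans (cong (a ℚ.* b ℚ.+_) (ℚₚ.neg-distribʳ-* a d))
      (sym (ℚₚ.*-distribˡ-+ a b (ℚ.- d)))
    regroup : ∀ a b c d → a ℚ.* b ℚ.- c ℚ.* d ≡ a ℚ.* (b ℚ.- d) ℚ.+ d ℚ.* (a ℚ.- c)
    regroup a b c d = trans (telescope (a ℚ.* b) (a ℚ.* d) (c ℚ.* d))
      (cong₂ ℚ._+_ (factor a b d)
        (trans (cong₂ ℚ._-_ (ℚₚ.*-comm a d) (ℚₚ.*-comm c d)) (factor d a c)))

infixl 6 _+_
infixl 7 _*_

_+_ : ℝ → ℝ → ℝ
x + y = mkℝ (λ n → seq x n ℚ.+ seq y n) (+-cauchy {seq x} {seq y} (cauchy x) (cauchy y))

_*_ : ℝ → ℝ → ℝ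
x * y = mkℝ (λ n → seq x n ℚ.* seq y n) (*-cauchy {seq x} {seq y} (cauchy x) (cauchy y))

------------------------------------------------------------------------
-- Matrices and eigenvalues

Matrix : Set → ℕ → Set
Matrix A m = Fin m → Fin m → A

Σℝ : ∀ {m} → Vector ℝ m → ℝ
Σℝ = foldr _+_ 0ℝ

_·_ : ∀ {m} → Matrix ℝ m → Vector ℝ m → Vector ℝ m
(M · x) i = Σℝ (λ j → M i j * x j)

IsEigenvalue : ∀ {m} → Matrix ℝ m → ℝ → Set
IsEigenvalue M ev = ∃[ x ] (¬ (∀ i → x i ≈ 0ℝ)) × (∀ i → (M · x) i ≈ ev * x i)

IsSmallestEigenvalue : ∀ {m} → Matrix ℝ m → ℝ → Set
IsSmallestEigenvalue M ev = IsEigenvalue M ev × (∀ ev′ → IsEigenvalue M ev′ → ev ≤ ev′)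

------------------------------------------------------------------------
-- Finite simple graphs on n vertices

record Graph (n : ℕ) : Set where
  field
    adj    : Fin n → Fin n → Bool
    symm   : ∀ u v → adj u v ≡ adj v u
    irrefl : ∀ v → adj v v ≡ false

  Adj : Fin n → Fin n → Set
  Adj u v = T (adj u v)

  degree : Fin n → ℕ
  degree v = length (filter (λ w → T? (adj v w)) (allFin n))

  data Walk (u : Fin n) : Fin n → Set where
    here : Walk u u
    step : ∀ {v w} → Walk u v → Adj v w → Walk u w

  Connected : Set
  Connected = ∀ u v → Walk u v

  record Cycle : Set where
    field
      {extra}  : ℕ
      vertex   : Fin (3 ℕ.+ extra) → Fin n
      distinct : Injective _≡_ _≡_ vertex
      edges    : ∀ (i : Fin (2 ℕ.+ extra)) → Adj (vertex (inject₁ i)) (vertex (suc i))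
      closing  : Adj (vertex (fromℕ (2 ℕ.+ extra))) (vertex zero)

  Acyclic : Set
  Acyclic = ¬ Cycle

  degreeMatrix : Matrix ℤ n
  degreeMatrix u v = if ⌊ u ≟ᶠ v ⌋ then + degree u else + 0

  adjacencyMatrix : Matrix ℤ n
  adjacencyMatrix u v = if adj u v then + 1 else + 0

  laplacian : Matrix ℤ n
  laplacian u v = degreeMatrix u v ℤ.- adjacencyMatrix u v

_≅_ : ∀ {n} → Graph n → Graph n → Set
_≅_ {n} G H = Σ (Permutation′ n) λ π →
  ∀ u v → Graph.adj G u v ≡ Graph.adj H (π ⟨$⟩ʳ u) (π ⟨$⟩ʳ v)

------------------------------------------------------------------------
-- Trees with boundary

record TreeWithBoundary (n : ℕ) : Set where
  field
    graph : Graph n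

  open Graph graph public

  IsBoundary : Fin n → Set
  IsBoundary v = degree v ≡ 1

  IsInterior : Fin n → Set
  IsInterior v = 2 ℕ.≤ degree v

  field
    connected    : Connected
    acyclic      : Acyclic
    partition    : ∀ v → IsBoundary v ⊎ IsInterior v
    someBoundary : ∃ IsBoundary
    someInterior : ∃ IsInterior

  interior : List (Fin n)
  interior = filter (λ v → 2 ℕₚ.≤? degree v) (allFin n)

  ∣V₀∣ : ℕ
  ∣V₀∣ = length interior

  dirichlet : Matrix ℤ ∣V₀∣
  dirichlet i j = laplacian (lookup interior i) (lookup interior j)

  IsFirstDirichletEigenvalue : ℝ → Set
  IsFirstDirichletEigenvalue = IsSmallestEigenvalue (λ i j → fromℤ (dirichlet i j))

open TreeWithBoundary using (graph; ∣V₀∣; IsFirstDirichletEigenvalue)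

𝒯 : ∀ n → ℕ → Pred (TreeWithBoundary n) 0ℓ
𝒯 n k G = ∣V₀∣ G ≡ k

-- The first Dirichlet eigenvalue is a definite description (unique up to _≈_),
-- so the inequality between the two values quantifies over what it describes.
_λ≤λ_ : ∀ {m n} → TreeWithBoundary m → TreeWithBoundary n → Set
G λ≤λ H = ∀ {evG evH} → IsFirstDirichletEigenvalue G evG → IsFirstDirichletEigenvalue H evH →
  evG ≤ evH

HasFaberKrahn : ∀ {n} → Pred (TreeWithBoundary n) 0ℓ → Pred (TreeWithBoundary n) 0ℓ
HasFaberKrahn 𝒞 G = 𝒞 G × (∀ H → 𝒞 H → G λ≤λ H)

module _ {n : ℕ} (G : TreeWithBoundary n) where
  open TreeWithBoundary G hiding (graph; ∣V₀∣; IsFirstDirichletEigenvalue)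

  -- How the boundary vertices attach to the path v zero, …, v (fromℕ m).
  CometEnds : ∀ m → (Fin (suc m) → Fin n) → Set
  CometEnds zero      v = ∀ b → IsBoundary b → Adj (v zero) b
  CometEnds m@(suc _) v = ∃[ b ]
    ( IsBoundary b × Adj (v zero) b
    × (∀ c → IsBoundary c → Adj (v zero) c → c ≡ b)
    × (∀ c → IsBoundary c → c ≢ b → Adj (v (fromℕ m)) c))

  -- The path exhausts the interior, so its number suc m of vertices is ∣V₀∣.
  -- Other edges need not be excluded, since G is a tree.
  record IsComet : Set where
    field
      {m}          : ℕ
      path         : Fin (suc m) → Fin n
      distinct     : Injective _≡_ _≡_ path
      edges        : ∀ (i : Fin m) → Adj (path (inject₁ i)) (path (suc i))
      pathInterior : ∀ i → IsInterior (path i)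
      exhaustive   : ∀ u → IsInterior u → ∃[ i ] path i ≡ u
      ends         : CometEnds m path

{-# OPTIONS --safe #-}

-- Let f be the positive first eigenfunction of a tree, extended by 0 to the
-- leaves, and let z and m be interior vertices where f is least and (apart
-- from z) greatest.  Take a path of the tree from some leaf b through m to z.
-- An interior vertex c off this path satisfies f z ≤ f c ≤ f m, so c fits
-- between two consecutive vertices of the stretch from m to z, and since
-- (x - c)² + (c - y)² ≤ (x - y)² for x ≥ c ≥ y, inserting it there does not
-- increase the sum of the squared differences.  Each leaf other than b
-- contributes at least (f z)² to the energy of f.  Hence the energy of f is at
-- least that of its rearrangement on the comet that starts at b and has its
-- other leaves at z; the rearrangement has the same norm, so Rayleigh's
-- principle on the comet gives the inequality of the eigenvalues.  In the case
-- of equality the rearrangement is an eigenfunction of the comet, the dropped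
-- edges join vertices of equal value, and comparing the two eigenvalue
-- equations vertex by vertex shows that the tree was that comet.
--
-- Rayleigh's principle is Picone's identity for a positive eigenfunction.  The
-- latter is constructed as a limit: for M = c - Δ₀ some power P of M has only
-- positive entries, and the ratio of two rows of Pⁿ is trapped between rational
-- bounds whose distance decreases geometrically in n.
--
-- The real numbers enter the comparison only through an ordered ring whose
-- order is stable and total up to double negation.  This suffices because the
-- inequality of real numbers is stable and being a comet is decidable.

module Submission where

open import Defs as D using (Graph; TreeWithBoundary)

open import Algebra.Bundles using (CommutativeMonoid; CommutativeRing; RawRing)
import Algebra.Properties.CommutativeSemigroup
import Algebra.Properties.Ring
import Algebra.Properties.Semiring.Mult
import Algebra.Solver.Ring
open import Algebra.Solver.Ring.AlmostCommutativeRing using (AlmostCommutativeRing; fromCommutativeRing; _-Raw-AlmostCommutative⟶_)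
open import Data.Bool.Base using (Bool; true; false; if_then_else_; T)
open import Data.Bool.Properties using (T?)
open import Data.Empty using (⊥-elim)
open import Data.Fin.Base using (Fin; zero; suc; toℕ; inject₁; inject≤; fromℕ; fromℕ<; cast)
open import Data.Fin.Permutation using (Permutation′; _⟨$⟩ʳ_; _⟨$⟩ˡ_; permutation; inverseˡ; inverseʳ)
import Data.Fin.Properties as Finₚ
open import Data.Fin.Properties using () renaming (_≟_ to _≟ᶠ_)
open import Data.Fin.Relation.Unary.Top using (view; ‵fromℕ; ‵inject₁)
open import Data.Integer.Base as ℤ using (ℤ)
import Data.Integer.Properties as ℤₚ
open import Data.List.Base using (List; []; _∷_; _++_; _∷ʳ_; [_]; map; concatMap; length; filter; lookup; allFin; tabulate)
open import Data.List.Properties using (++-assoc; ++-identityʳ; filter-none; length-++; length-filter; length-map; length-tabulate; map-++; map-id; map-∘; map-tabulate; tabulate-cong; tabulate-lookup; ∷-injective; ∷ʳ-injective)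
import Data.List.Membership.DecPropositional as DecMembership
open import Data.List.Membership.Propositional using (_∈_; _∉_)
open import Data.List.Membership.Propositional.Properties using (∈-∃++; ∈-++⁺ˡ; ∈-++⁺ʳ; ∈-++⁻; ∈-allFin; ∈-filter⁺; ∈-filter⁻; ∈-lookup; ∈-map⁺; ∈-map⁻; ∈-tabulate⁺; ∈-tabulate⁻)
open import Data.List.Relation.Binary.Permutation.Propositional as ↭ using (_↭_; prep; swap; ↭-refl; ↭-trans; ↭-sym; ↭-reflexive; module PermutationReasoning)
open import Data.List.Relation.Binary.Permutation.Propositional.Properties using (All-resp-↭; shift; shifts; ∈-resp-↭; ↭-length) renaming (++⁺ˡ to ↭-++⁺ˡ; ++⁺ʳ to ↭-++⁺ʳ)
open import Data.List.Relation.Unary.All as All using (All; []; _∷_)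
import Data.List.Relation.Unary.All.Properties as Allₚ
open import Data.List.Relation.Unary.AllPairs using ([]; _∷_)
open import Data.List.Relation.Unary.Any using (here; there; index)
import Data.List.Relation.Unary.Any.Properties as Anyₚ
import Data.List.Relation.Unary.Unique.DecPropositional as DecUnique
open import Data.List.Relation.Unary.Unique.Propositional using (Unique)
import Data.List.Relation.Unary.Unique.Propositional.Properties as Uniqueₚ
open import Data.Maybe.Base using (just; nothing)
open import Data.Nat.Base as ℕ using (ℕ; zero; suc; _⊔_)
import Data.Nat.Coprimality as Coprime
open import Data.Nat.Induction using (<-rec)
import Data.Nat.Properties as ℕₚ
open import Data.Product as Product using (Σ; ∃; ∃-syntax; _×_; _,_; proj₁; proj₂)
open import Data.Rational.Base as ℚ using (ℚ; mkℚ; 0ℚ; 1ℚ; ½)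
import Data.Rational.Properties as ℚₚ
import Data.Rational.Unnormalised.Base as ℚᵘ
import Data.Rational.Unnormalised.Properties as ℚᵘₚ
open import Data.Sum as Sum using (_⊎_; inj₁; inj₂)
open import Data.Vec.Base as Vec using (Vec)
import Data.Vec.Properties as Vecₚ
open import Function.Base using (_∘_; id)
open import Function.Bundles using (_⇔_; mk⇔)
open import Level using (0ℓ)
import Relation.Binary.Construct.Closure.ReflexiveTransitive as Star
open import Relation.Binary.Definitions using (WeaklyDecidable; tri<; tri≈; tri>)
open import Relation.Binary.PropositionalEquality as ≡ using (_≡_; _≢_; ≢-sym)
open import Relation.Nullary using (¬_; Dec; yes; no; ⌊_⌋)
open import Relation.Nullary.Decidable using (¬?; _×-dec_; _⊎-dec_; _→-dec_; map′; toWitness; fromWitness)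
open import Relation.Unary using (Decidable)

-- `λ≤λ` speaks only of numbers already known to be first eigenvalues, so the Faber-Krahn property
-- yields nothing until such numbers are exhibited, both for the tree and for some comet with the
-- same parameters. Hence a positive eigenfunction has to be constructed with an explicit rate of
-- convergence, and a comparison comet has to be written down.
--
-- On the stretch from b to m nothing is inserted and every edge is kept, so it costs the same in
-- both graphs. Trees with equally many vertices and interior vertices have equally many leaves, so
-- apart from b the leaves of the tree and of the comet correspond one to one. All that is dropped
-- are edges between interior vertices, which can only add energy.

record OrderedRing : Set₁ where
  field
    commutativeRing : CommutativeRing 0ℓ 0ℓ

  open CommutativeRing commutativeRing public
    hiding (zero; _-_)

  infix 4 _≤_

  field
    _≤_         : Carrier → Carrier → Set
    ≤-reflexive : ∀ {x y} → x ≈ y → x ≤ y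
    ≤-trans     : ∀ {x y z} → x ≤ y → y ≤ z → x ≤ z
    ≤-antisym   : ∀ {x y} → x ≤ y → y ≤ x → x ≈ y
    +-mono-≤    : ∀ {x y u v} → x ≤ y → u ≤ v → x + u ≤ y + v
    *-nonNeg    : ∀ {x y} → 0# ≤ x → 0# ≤ y → 0# ≤ x * y
    ≤-stable    : ∀ {x y} → ¬ ¬ (x ≤ y) → x ≤ y
    ≤-total     : ∀ x y → ¬ ¬ (x ≤ y ⊎ y ≤ x)
    -- Through this field a vanishing energy term becomes an equation between values.
    square≤0    : ∀ {x} → x * x ≤ 0# → x ≈ 0#
    1≰0         : ¬ (1# ≤ 0#)

-- Arithmetic, order and finite sums in an ordered ring

module OrderedRingProperties (R : OrderedRing) where

  open OrderedRing R

  open import Relation.Binary.Reasoning.Setoid setoid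
  open Algebra.Properties.Ring ring
    using (-‿distribˡ-*; -‿distribʳ-*; -‿+-comm; -‿involutive; -0#≈0#)
  open Algebra.Properties.Semiring.Mult semiring using (×1-homo-*; ×-homo-+) renaming (_×_ to _×′_)
  open Algebra.Properties.CommutativeSemigroup (CommutativeMonoid.commutativeSemigroup +-commutativeMonoid) using (interchange)

  -- Integer coefficients for the ring solver, as differences of naturals.
  private
    reduce : ℕ → ℕ → ℕ × ℕ
    reduce (suc a) (suc b) = reduce a b
    reduce a       b       = a , b

    differences : RawRing 0ℓ 0ℓ
    differences = record
      { Carrier = ℕ × ℕ
      ; _≈_ = λ (a , b) (c , d) → a ℕ.+ d ≡ c ℕ.+ b
      ; _+_ = λ (a , b) (c , d) → reduce (a ℕ.+ c) (b ℕ.+ d)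
      ; _*_ = λ (a , b) (c , d) → reduce (a ℕ.* c ℕ.+ b ℕ.* d) (a ℕ.* d ℕ.+ b ℕ.* c)
      ; -_ = λ (a , b) → b , a
      ; 0# = 0 , 0
      ; 1# = 1 , 0
      }

    ℕ⟦_⟧ : ℕ → Carrier
    ℕ⟦ n ⟧ = n ×′ 1#

    ⟦_⟧ : ℕ × ℕ → Carrier
    ⟦ a , b ⟧ = ℕ⟦ a ⟧ + - ℕ⟦ b ⟧

    +-homo : ∀ a b c d → ⟦ a ℕ.+ c , b ℕ.+ d ⟧ ≈ ⟦ a , b ⟧ + ⟦ c , d ⟧
    +-homo a b c d = begin
      ℕ⟦ a ℕ.+ c ⟧ + - ℕ⟦ b ℕ.+ d ⟧                   ≈⟨ +-cong (×-homo-+ 1# a c) (-‿cong (×-homo-+ 1# b d)) ⟩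
      (ℕ⟦ a ⟧ + ℕ⟦ c ⟧) + - (ℕ⟦ b ⟧ + ℕ⟦ d ⟧)         ≈⟨ +-congˡ (sym (-‿+-comm ℕ⟦ b ⟧ ℕ⟦ d ⟧)) ⟩
      (ℕ⟦ a ⟧ + ℕ⟦ c ⟧) + (- ℕ⟦ b ⟧ + - ℕ⟦ d ⟧)       ≈⟨ interchange _ _ _ _ ⟩
      ⟦ a , b ⟧ + ⟦ c , d ⟧                           ∎

    *-homo : ∀ a b c d → ⟦ a ℕ.* c ℕ.+ b ℕ.* d , a ℕ.* d ℕ.+ b ℕ.* c ⟧ ≈ ⟦ a , b ⟧ * ⟦ c , d ⟧
    *-homo a b c d = begin
      ⟦ a ℕ.* c ℕ.+ b ℕ.* d , a ℕ.* d ℕ.+ b ℕ.* c ⟧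
        ≈⟨ +-cong (×-homo-+ 1# (a ℕ.* c) (b ℕ.* d)) (-‿cong (×-homo-+ 1# (a ℕ.* d) (b ℕ.* c))) ⟩
      (ℕ⟦ a ℕ.* c ⟧ + ℕ⟦ b ℕ.* d ⟧) + - (ℕ⟦ a ℕ.* d ⟧ + ℕ⟦ b ℕ.* c ⟧)
        ≈⟨ +-cong (+-cong (×1-homo-* a c) (×1-homo-* b d)) (-‿cong (+-cong (×1-homo-* a d) (×1-homo-* b c))) ⟩
      (A * C + B * D) + - (A * D + B * C)
        ≈⟨ +-congˡ (sym (-‿+-comm _ _)) ⟩
      (A * C + B * D) + (- (A * D) + - (B * C))
        ≈⟨ interchange _ _ _ _ ⟩
      (A * C + - (A * D)) + (B * D + - (B * C))
        ≈⟨ +-cong (+-congˡ (-‿distribʳ-* A D)) (+-comm _ _) ⟩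
      (A * C + A * - D) + (- (B * C) + B * D)
        ≈⟨ +-cong (sym (distribˡ A C (- D))) (+-cong (-‿distribˡ-* B C) (trans (sym (-‿involutive _)) (trans (-‿cong (-‿distribˡ-* B D)) (-‿distribʳ-* (- B) D)))) ⟩
      A * (C + - D) + (- B * C + - B * - D)
        ≈⟨ +-congˡ (sym (distribˡ (- B) C (- D))) ⟩
      A * (C + - D) + - B * (C + - D)
        ≈⟨ sym (distribʳ (C + - D) A (- B)) ⟩
      ⟦ a , b ⟧ * ⟦ c , d ⟧ ∎
      where
      A = ℕ⟦ a ⟧
      B = ℕ⟦ b ⟧
      C = ℕ⟦ c ⟧
      D = ℕ⟦ d ⟧

    cancel : ∀ a b c d → a ℕ.+ d ≡ c ℕ.+ b → ⟦ a , b ⟧ ≈ ⟦ c , d ⟧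
    cancel a b c d eq = begin
      A + - B                  ≈⟨ +-congʳ (sym (+-identityʳ A)) ⟩
      (A + 0#) + - B           ≈⟨ +-congʳ (+-congˡ (sym (-‿inverseʳ D))) ⟩
      (A + (D + - D)) + - B    ≈⟨ +-congʳ (sym (+-assoc A D (- D))) ⟩
      ((A + D) + - D) + - B    ≈⟨ +-congʳ (+-congʳ (trans (sym (×-homo-+ 1# a d)) (trans (reflexive (≡.cong ℕ⟦_⟧ eq)) (×-homo-+ 1# c b)))) ⟩
      ((C + B) + - D) + - B    ≈⟨ +-congʳ (trans (+-assoc C B (- D)) (trans (+-congˡ (+-comm B (- D))) (sym (+-assoc C (- D) B)))) ⟩
      ((C + - D) + B) + - B    ≈⟨ +-assoc _ B (- B) ⟩
      (C + - D) + (B + - B)    ≈⟨ +-congˡ (-‿inverseʳ B) ⟩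
      (C + - D) + 0#           ≈⟨ +-identityʳ _ ⟩
      C + - D                  ∎
      where
      A = ℕ⟦ a ⟧
      B = ℕ⟦ b ⟧
      C = ℕ⟦ c ⟧
      D = ℕ⟦ d ⟧

    reduce-homo : ∀ a b → ⟦ reduce a b ⟧ ≈ ⟦ a , b ⟧
    reduce-homo zero    b       = refl
    reduce-homo (suc a) zero    = refl
    reduce-homo (suc a) (suc b) = trans (reduce-homo a b) (cancel a b (suc a) (suc b) (ℕₚ.+-suc a b))

    almostCommutativeRing : AlmostCommutativeRing 0ℓ 0ℓ
    almostCommutativeRing = fromCommutativeRing commutativeRing

    morphism : differences -Raw-AlmostCommutative⟶ almostCommutativeRing
    morphism = record
      { ⟦_⟧ = ⟦_⟧
      ; +-homo = λ (a , b) (c , d) → trans (reduce-homo (a ℕ.+ c) _) (+-homo a b c d)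
      ; *-homo = λ (a , b) (c , d) → trans (reduce-homo (a ℕ.* c ℕ.+ b ℕ.* d) _) (*-homo a b c d)
      ; -‿homo = λ (a , b) → trans (+-comm _ _) (trans (+-congˡ (sym (-‿involutive _))) (-‿+-comm _ _))
      ; 0-homo = trans (+-congˡ -0#≈0#) (+-identityˡ 0#)
      ; 1-homo = trans (+-cong (+-identityʳ 1#) -0#≈0#) (+-identityʳ 1#)
      }

    weaklyDecide : WeaklyDecidable (λ x y → ⟦ x ⟧ ≈ ⟦ y ⟧)
    weaklyDecide (a , b) (c , d) with a ℕ.+ d ℕₚ.≟ c ℕ.+ b
    ... | yes eq = just (cancel a b c d eq)
    ... | no _   = nothing

  open Algebra.Solver.Ring differences almostCommutativeRing morphism weaklyDecide public
    using (solve; _:=_; _:+_; _:*_; _:-_; :-_)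

  infixl 6 _-_
  _-_ : Carrier → Carrier → Carrier
  x - y = x + - y

  sq : Carrier → Carrier
  sq x = x * x

  sq-cong : ∀ {x y} → x ≈ y → sq x ≈ sq y
  sq-cong e = *-cong e e

  ≤-refl : ∀ {x} → x ≤ x
  ≤-refl = ≤-reflexive refl

  ≤-respˡ : ∀ {x y z} → x ≈ y → x ≤ z → y ≤ z
  ≤-respˡ e = ≤-trans (≤-reflexive (sym e))

  ≤-respʳ : ∀ {x y z} → y ≈ z → x ≤ y → x ≤ z
  ≤-respʳ e p = ≤-trans p (≤-reflexive e)

  ≤-resp : ∀ {x y u v} → x ≈ u → y ≈ v → x ≤ y → u ≤ v
  ≤-resp e e′ p = ≤-respˡ e (≤-respʳ e′ p)

  diff-nonNeg : ∀ {x y} → x ≤ y → 0# ≤ y - x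
  diff-nonNeg {x} {y} p = ≤-respˡ (-‿inverseʳ x) (+-mono-≤ p (≤-refl { - x}))

  diff-nonNeg⁻¹ : ∀ {x y} → 0# ≤ y - x → x ≤ y
  diff-nonNeg⁻¹ {x} {y} p = ≤-resp (+-identityˡ x) (solve 2 (λ x y → (y :- x) :+ x := y) refl x y) (+-mono-≤ p (≤-refl {x}))

  ≤-by : ∀ {x y d} → y - x ≈ d → 0# ≤ d → x ≤ y
  ≤-by e p = diff-nonNeg⁻¹ (≤-respʳ (sym e) p)

  +-nonNeg : ∀ {x y} → 0# ≤ x → 0# ≤ y → 0# ≤ x + y
  +-nonNeg p q = ≤-respˡ (+-identityˡ 0#) (+-mono-≤ p q)

  *-monoˡ-≤ : ∀ {x y z} → 0# ≤ z → x ≤ y → z * x ≤ z * y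
  *-monoˡ-≤ {x} {y} {z} 0≤z p = ≤-by (solve 3 (λ x y z → z :* y :- z :* x := z :* (y :- x)) refl x y z) (*-nonNeg 0≤z (diff-nonNeg p))

  *-monoʳ-≤ : ∀ {x y z} → 0# ≤ z → x ≤ y → x * z ≤ y * z
  *-monoʳ-≤ 0≤z p = ≤-resp (*-comm _ _) (*-comm _ _) (*-monoˡ-≤ 0≤z p)

  neg-nonNeg : ∀ {x} → x ≤ 0# → 0# ≤ - x
  neg-nonNeg p = ≤-respʳ (+-identityˡ _) (diff-nonNeg p)

  -- Stability of the order permits a split on the sign of `x`, although totality holds only up to
  -- double negation.
  sq-nonNeg : ∀ x → 0# ≤ sq x
  sq-nonNeg x = ≤-stable λ k → ≤-total x 0# λ
    { (inj₁ p) → k (≤-respʳ (solve 1 (λ x → (:- x) :* (:- x) := x :* x) refl x) (*-nonNeg (neg-nonNeg p) (neg-nonNeg p)))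
    ; (inj₂ p) → k (*-nonNeg p p) }

  0≤1 : 0# ≤ 1#
  0≤1 = ≤-respʳ (*-identityˡ 1#) (sq-nonNeg 1#)

  +-nonPosˡ : ∀ {x y} → 0# ≤ y → x + y ≤ 0# → x ≤ 0#
  +-nonPosˡ {x} {y} p q = ≤-trans (≤-respˡ (+-identityʳ x) (+-mono-≤ (≤-refl {x}) p)) q

  -- Positivity is nonnegativity together with an inverse, so that it is
  -- available without deciding the order.
  Positive : Carrier → Set
  Positive x = 0# ≤ x × ∃[ y ] x * y ≈ 1#

  -- The inverse `y` equals `x * sq y`, a product of nonnegative factors.
  inverse-nonNeg : ∀ {x} ((p , y , e) : Positive x) → 0# ≤ y
  inverse-nonNeg {x} (p , y , e) = ≤-respʳ
    (trans (*-congˡ (*-comm y y)) (trans (solve 2 (λ x y → x :* (y :* y) := (x :* y) :* y) refl x y) (trans (*-congʳ e) (*-identityˡ y))))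
    (*-nonNeg p (sq-nonNeg y))

  *-cancelʳ-≤0 : ∀ {x y} → Positive y → x * y ≤ 0# → x ≤ 0#
  *-cancelʳ-≤0 {x} {y} P@(p , w , e) q = ≤-resp
    (trans (*-assoc x y w) (trans (*-congˡ e) (*-identityʳ x)))
    (zeroˡ w)
    (*-monoʳ-≤ (inverse-nonNeg P) q)

  positive≰0 : ∀ {x} → Positive x → ¬ (x ≤ 0#)
  positive≰0 {x} P q = 1≰0 (*-cancelʳ-≤0 P (≤-respˡ (sym (*-identityˡ x)) q))

  positive-* : ∀ {x y} → Positive x → Positive y → Positive (x * y)
  positive-* {x} {y} (p , x′ , e) (q , y′ , e′) = *-nonNeg p q , x′ * y′ ,
    trans (solve 4 (λ x y u v → (x :* y) :* (u :* v) := (x :* u) :* (y :* v)) refl x y x′ y′) (trans (*-cong e e′) (*-identityˡ 1#))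

  x-y≈0⇒x≈y : ∀ {x y} → x - y ≈ 0# → x ≈ y
  x-y≈0⇒x≈y {x} {y} e = trans (solve 2 (λ x y → x := (x :- y) :+ y) refl x y) (trans (+-congʳ e) (+-identityˡ y))

  minus-zero : ∀ {x y} → y ≈ 0# → x - y ≈ x
  minus-zero {x} {y} e = trans (sym (+-identityʳ _)) (trans (+-congˡ (sym e)) (solve 2 (λ x y → (x :- y) :+ y := x) refl x y))

  +-cancelʳ-≤ : ∀ {x y} z → x + z ≤ y + z → x ≤ y
  +-cancelʳ-≤ {x} {y} z p = ≤-resp (cancelled x) (cancelled y) (+-mono-≤ p (≤-refl { - z}))
    where
    cancelled : ∀ w → (w + z) + - z ≈ w
    cancelled w = solve 2 (λ w z → (w :+ z) :- z := w) refl w z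

  +-cancelˡ-≤ : ∀ {x y} z → z + x ≤ z + y → x ≤ y
  +-cancelˡ-≤ z p = +-cancelʳ-≤ z (≤-resp (+-comm _ _) (+-comm _ _) p)

  private variable A B : Set

  ∑ : (A → Carrier) → List A → Carrier
  ∑ f []       = 0#
  ∑ f (x ∷ xs) = f x + ∑ f xs

  ∑-cong : ∀ {f g : A → Carrier} xs → (∀ {x} → x ∈ xs → f x ≈ g x) → ∑ f xs ≈ ∑ g xs
  ∑-cong []       e = refl
  ∑-cong (x ∷ xs) e = +-cong (e (here ≡.refl)) (∑-cong xs (e ∘ there))

  ∑-mono-≤ : ∀ {f g : A → Carrier} xs → (∀ {x} → x ∈ xs → f x ≤ g x) → ∑ f xs ≤ ∑ g xs
  ∑-mono-≤ []       p = ≤-refl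
  ∑-mono-≤ (x ∷ xs) p = +-mono-≤ (p (here ≡.refl)) (∑-mono-≤ xs (p ∘ there))

  -- Equality case of termwise comparison: no other term can make up for a strict inequality in one
  -- of them, so cancelling the others isolates each term.
  ∑-tight : ∀ {f g : A → Carrier} xs → (∀ {x} → x ∈ xs → f x ≤ g x) → ∑ g xs ≤ ∑ f xs → ∀ {x} → x ∈ xs → g x ≤ f x
  ∑-tight (x ∷ xs) p q (here ≡.refl) = +-cancelʳ-≤ _ (≤-trans (+-mono-≤ ≤-refl (∑-mono-≤ xs (p ∘ there))) q)
  ∑-tight (x ∷ xs) p q (there y∈)    = ∑-tight xs (p ∘ there) (+-cancelˡ-≤ _ (≤-trans (+-mono-≤ (p (here ≡.refl)) ≤-refl) q)) y∈

  ∑-zero : (xs : List A) → ∑ (λ _ → 0#) xs ≈ 0#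
  ∑-zero []       = refl
  ∑-zero (x ∷ xs) = trans (+-identityˡ _) (∑-zero xs)

  ∑-nonNeg : ∀ {f : A → Carrier} xs → (∀ {x} → x ∈ xs → 0# ≤ f x) → 0# ≤ ∑ f xs
  ∑-nonNeg xs p = ≤-respˡ (∑-zero xs) (∑-mono-≤ xs p)

  ∑-nonPos : ∀ {f : A → Carrier} xs → (∀ {x} → x ∈ xs → f x ≤ 0#) → ∑ f xs ≤ 0#
  ∑-nonPos xs p = ≤-respʳ (∑-zero xs) (∑-mono-≤ xs p)

  ∑-++ : ∀ (f : A → Carrier) xs ys → ∑ f (xs ++ ys) ≈ ∑ f xs + ∑ f ys
  ∑-++ f []       ys = sym (+-identityˡ _)
  ∑-++ f (x ∷ xs) ys = trans (+-congˡ (∑-++ f xs ys)) (sym (+-assoc _ _ _))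

  ∑-map : ∀ (f : B → Carrier) (h : A → B) xs → ∑ f (map h xs) ≡ ∑ (f ∘ h) xs
  ∑-map f h []       = ≡.refl
  ∑-map f h (x ∷ xs) = ≡.cong (f (h x) +_) (∑-map f h xs)

  ∑-concatMap : ∀ (f : B → Carrier) (h : A → List B) xs → ∑ f (concatMap h xs) ≈ ∑ (λ x → ∑ f (h x)) xs
  ∑-concatMap f h []       = refl
  ∑-concatMap f h (x ∷ xs) = trans (∑-++ f (h x) (concatMap h xs)) (+-congˡ (∑-concatMap f h xs))

  ∑-distrib-+ : ∀ (f g : A → Carrier) xs → ∑ (λ x → f x + g x) xs ≈ ∑ f xs + ∑ g xs
  ∑-distrib-+ f g []       = sym (+-identityˡ _)
  ∑-distrib-+ f g (x ∷ xs) = trans (+-congˡ (∑-distrib-+ f g xs))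
    (solve 4 (λ a b c d → (a :+ b) :+ (c :+ d) := (a :+ c) :+ (b :+ d)) refl (f x) (g x) (∑ f xs) (∑ g xs))

  *-distribˡ-∑ : ∀ c (f : A → Carrier) xs → c * ∑ f xs ≈ ∑ (λ x → c * f x) xs
  *-distribˡ-∑ c f []       = zeroʳ c
  *-distribˡ-∑ c f (x ∷ xs) = trans (distribˡ c _ _) (+-congˡ (*-distribˡ-∑ c f xs))

  ∑-↭ : ∀ (f : A → Carrier) {xs ys} → xs ↭ ys → ∑ f xs ≈ ∑ f ys
  ∑-↭ f ↭.refl         = refl
  ∑-↭ f (prep x p)     = +-congˡ (∑-↭ f p)
  ∑-↭ f (swap x y p)   = trans (+-congˡ (+-congˡ (∑-↭ f p)))
    (solve 3 (λ a b c → a :+ (b :+ c) := b :+ (a :+ c)) refl (f x) (f y) _)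
  ∑-↭ f (↭.trans p q) = trans (∑-↭ f p) (∑-↭ f q)

  *-distribʳ-∑ : ∀ (f : A → Carrier) c xs → ∑ f xs * c ≈ ∑ (λ x → f x * c) xs
  *-distribʳ-∑ f c xs = trans (*-comm _ _) (trans (*-distribˡ-∑ c f xs) (∑-cong xs λ _ → *-comm _ _))

  ∑-neg : ∀ (f : A → Carrier) xs → ∑ (λ x → - f x) xs ≈ - ∑ f xs
  ∑-neg f []       = sym -0#≈0#
  ∑-neg f (x ∷ xs) = trans (+-congˡ (∑-neg f xs)) (-‿+-comm _ _)

  ∑-swap : ∀ (f : A → B → Carrier) xs ys → ∑ (λ x → ∑ (f x) ys) xs ≈ ∑ (λ y → ∑ (λ x → f x y) xs) ys
  ∑-swap f []       ys = sym (∑-zero ys)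
  ∑-swap f (x ∷ xs) ys = trans (+-congˡ (∑-swap f xs ys)) (sym (∑-distrib-+ (f x) _ ys))

-- Paths in graphs and trees

module PathsInTrees where

  open ≡ using (refl; sym; trans; cong; cong₂; subst)
  open import Data.Nat.Base using (_≤_; _<_; z≤n; s≤s)
  open Star using (Star; ε; _◅_; _◅◅_)

  private variable A B : Set

  -- An inclusion of sets becomes a splitting up to permutation, the form in which lengths and sums
  -- can be compared.
  ⊆-complement : ∀ {xs ys : List A} → Unique xs → (∀ {x} → x ∈ xs → x ∈ ys) →
    ∃[ zs ] ys ↭ xs ++ zs
  ⊆-complement {xs = []}     {ys} []       sub = ys , ↭-refl
  ⊆-complement {xs = x ∷ xs} {ys} (x∉ ∷ u) sub with ∈-∃++ (sub (here refl))
  ... | as , bs , refl with ⊆-complement {xs = xs} {as ++ bs} u sub′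
    where
    sub′ : ∀ {y} → y ∈ xs → y ∈ as ++ bs
    sub′ y∈ with ∈-resp-↭ (shift x as bs) (sub (there y∈))
    ... | here refl = ⊥-elim (All.lookup x∉ y∈ refl)
    ... | there p   = p
  ... | zs , p = zs , ↭-trans (shift x as bs) (prep x p)

  ⊆⇒length≤ : ∀ {xs ys : List A} → Unique xs → (∀ {x} → x ∈ xs → x ∈ ys) → length xs ≤ length ys
  ⊆⇒length≤ {xs = xs} u sub with ⊆-complement u sub
  ... | zs , p = subst (length xs ≤_) (sym (trans (↭-length p) (length-++ xs))) (ℕₚ.m≤m+n _ _)

  unique-⊆⊇⇒↭ : ∀ {xs ys : List A} → Unique xs → Unique ys →
    (∀ {x} → x ∈ xs → x ∈ ys) → (∀ {x} → x ∈ ys → x ∈ xs) → ys ↭ xs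
  unique-⊆⊇⇒↭ {xs = xs} u v sub sup with ⊆-complement u sub
  ... | [] , p = ↭-trans p (↭-reflexive (++-identityʳ xs))
  ... | z ∷ zs , p = ⊥-elim (ℕₚ.<⇒≱ (subst (length xs <_) (sym (trans (↭-length p) (length-++ xs))) (ℕₚ.m<m+n _ (s≤s z≤n))) (⊆⇒length≤ v sup))

  ∉⇒All≢ : ∀ {x : A} {xs} → x ∉ xs → All (x ≢_) xs
  ∉⇒All≢ x∉ = All.tabulate λ { y∈ refl → x∉ y∈ }

  unique-head : ∀ {x : A} {xs} → Unique (x ∷ xs) → x ∉ xs
  unique-head (x∉ ∷ _) x∈ = All.lookup x∉ x∈ refl

  ∈-∷ʳ⁻ : ∀ {x z : A} ys → x ∈ ys ∷ʳ z → x ∈ ys ⊎ x ≡ z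
  ∈-∷ʳ⁻ ys x∈ with ∈-++⁻ ys x∈
  ... | inj₁ p           = inj₁ p
  ... | inj₂ (here refl) = inj₂ refl

  last∈ : ∀ (ys : List A) {z} → z ∈ ys ∷ʳ z
  last∈ ys = ∈-++⁺ʳ ys (here refl)

  unique-resp-↭ : ∀ {xs ys : List A} → xs ↭ ys → Unique xs → Unique ys
  unique-resp-↭ ↭.refl          u                   = u
  unique-resp-↭ (prep x p)      (x∉ ∷ u)            = All-resp-↭ p x∉ ∷ unique-resp-↭ p u
  unique-resp-↭ (↭.swap x y p) ((x≢y ∷ x∉) ∷ y∉ ∷ u) = (≢-sym x≢y ∷ All-resp-↭ p y∉) ∷ All-resp-↭ p x∉ ∷ unique-resp-↭ p u
  unique-resp-↭ (↭.trans p q)   u                   = unique-resp-↭ q (unique-resp-↭ p u)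

  pairs : A → List A → A → List (A × A)
  pairs x []       z = (x , z) ∷ []
  pairs x (y ∷ ys) z = (x , y) ∷ pairs y ys z

  pairs-++ : ∀ (x : A) ys w ws z → pairs x (ys ++ w ∷ ws) z ≡ pairs x ys w ++ pairs w ws z
  pairs-++ x []       w ws z = refl
  pairs-++ x (y ∷ ys) w ws z = cong ((x , y) ∷_) (pairs-++ y ys w ws z)

  pairs-map : ∀ (π : A → B) x ys z → map (Product.map π π) (pairs x ys z) ≡ pairs (π x) (map π ys) (π z)
  pairs-map π x []       z = refl
  pairs-map π x (y ∷ ys) z = cong (_ ∷_) (pairs-map π y ys z)

  pairs-proj₁ : ∀ (x : A) ys z → map proj₁ (pairs x ys z) ≡ x ∷ ys
  pairs-proj₁ x []       z = refl
  pairs-proj₁ x (y ∷ ys) z = cong (x ∷_) (pairs-proj₁ y ys z)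

  pairs-proj₂ : ∀ (x : A) ys z → map proj₂ (pairs x ys z) ≡ ys ∷ʳ z
  pairs-proj₂ x []       z = refl
  pairs-proj₂ x (y ∷ ys) z = cong (y ∷_) (pairs-proj₂ y ys z)

  ∈-pairs₁ : ∀ {x z u v : A} ys → (u , v) ∈ pairs x ys z → u ∈ x ∷ ys
  ∈-pairs₁ ys e = subst (_ ∈_) (pairs-proj₁ _ ys _) (∈-map⁺ proj₁ e)

  ∈-pairs₂ : ∀ {x z u v : A} ys → (u , v) ∈ pairs x ys z → v ∈ ys ∷ʳ z
  ∈-pairs₂ ys e = subst (_ ∈_) (pairs-proj₂ _ ys _) (∈-map⁺ proj₂ e)

  pairs-asym : ∀ {x z u v : A} ys → Unique (x ∷ ys ∷ʳ z) → (u , v) ∈ pairs x ys z → (v , u) ∉ pairs x ys z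
  pairs-asym []       un (here refl) (here refl) = unique-head un (here refl)
  pairs-asym (y ∷ ys) un (here refl) (here refl) = unique-head un (here refl)
  pairs-asym (y ∷ ys) un (here refl) (there q)   = unique-head un (there (∈-pairs₂ ys q))
  pairs-asym (y ∷ ys) un (there p)   (here refl) = unique-head un (there (∈-pairs₂ ys p))
  pairs-asym (y ∷ ys) (_ ∷ un) (there p) (there q) = pairs-asym ys un p q

  -- The index type is chosen so that, for a nonempty `ys`, it is definitionally the index type of
  -- the vertices of a `Cycle`.
  vertexAt : A → (ys : List A) → A → Fin (2 ℕ.+ length ys) → A
  vertexAt x ys       z zero       = x
  vertexAt x []       z (suc zero) = z
  vertexAt x (y ∷ ys) z (suc i)    = vertexAt y ys z i

  vertexAt-∈ : ∀ (x : A) ys z i → vertexAt x ys z i ∈ x ∷ ys ∷ʳ z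
  vertexAt-∈ x ys       z zero       = here refl
  vertexAt-∈ x []       z (suc zero) = there (here refl)
  vertexAt-∈ x (y ∷ ys) z (suc i)    = there (vertexAt-∈ y ys z i)

  vertexAt-injective : ∀ (x : A) ys z → Unique (x ∷ ys ∷ʳ z) → ∀ {i j} → vertexAt x ys z i ≡ vertexAt x ys z j → i ≡ j
  vertexAt-injective x ys       z un {zero} {zero} e = refl
  vertexAt-injective x []       z un {zero} {suc zero} e = ⊥-elim (unique-head un (here e))
  vertexAt-injective x []       z un {suc zero} {zero} e = ⊥-elim (unique-head un (here (sym e)))
  vertexAt-injective x []       z un {suc zero} {suc zero} e = refl
  vertexAt-injective x (y ∷ ys) z un {zero} {suc j} e = ⊥-elim (unique-head un (subst (_∈ y ∷ ys ∷ʳ z) (sym e) (vertexAt-∈ y ys z j)))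
  vertexAt-injective x (y ∷ ys) z un {suc i} {zero} e = ⊥-elim (unique-head un (subst (_∈ y ∷ ys ∷ʳ z) e (vertexAt-∈ y ys z i)))
  vertexAt-injective x (y ∷ ys) z (_ ∷ un) {suc i} {suc j} e = cong suc (vertexAt-injective y ys z un e)

  vertexAt-last : ∀ (x : A) ys z → vertexAt x ys z (fromℕ (suc (length ys))) ≡ z
  vertexAt-last x []       z = refl
  vertexAt-last x (y ∷ ys) z = vertexAt-last y ys z

  vertexAt-pairs : ∀ (x : A) ys z i → (vertexAt x ys z (inject₁ i) , vertexAt x ys z (suc i)) ∈ pairs x ys z
  vertexAt-pairs x []           z zero    = here refl
  vertexAt-pairs x (_ ∷ [])     z zero    = here refl
  vertexAt-pairs x (_ ∷ _ ∷ _)  z zero    = here refl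
  vertexAt-pairs x (y ∷ [])     z (suc i) = there (vertexAt-pairs y [] z i)
  vertexAt-pairs x (y ∷ w ∷ ys) z (suc i) = there (vertexAt-pairs y (w ∷ ys) z i)

  vertexAt-surjective : ∀ (x : A) ys z {w} → w ∈ ys ∷ʳ z → ∃[ i ] vertexAt x ys z (suc i) ≡ w
  vertexAt-surjective x []       z (here refl) = zero , refl
  vertexAt-surjective x (y ∷ ys) z (here refl) = zero , refl
  vertexAt-surjective x (y ∷ ys) z (there w∈)  = Product.map suc (λ e → e) (vertexAt-surjective y ys z w∈)

  vertexAt-∈-tail : ∀ (x : A) ys z i → vertexAt x ys z (suc i) ∈ ys ∷ʳ z
  vertexAt-∈-tail x []       z zero = here refl
  vertexAt-∈-tail x (y ∷ ys) z i    = vertexAt-∈ y ys z i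

  symmetrise : List (A × A) → List (A × A)
  symmetrise es = es ++ map Product.swap es

  ∈-symmetrise⁻ : ∀ {u v : A} es → (u , v) ∈ symmetrise es → (u , v) ∈ es ⊎ (v , u) ∈ es
  ∈-symmetrise⁻ es p with ∈-++⁻ es p
  ... | inj₁ q = inj₁ q
  ... | inj₂ q with ∈-map⁻ Product.swap q
  ...   | (_ , _) , r , refl = inj₂ r

  ∈-symmetrise⁺ : ∀ {u v : A} es → (u , v) ∈ es ⊎ (v , u) ∈ es → (u , v) ∈ symmetrise es
  ∈-symmetrise⁺ es (inj₁ p) = ∈-++⁺ˡ p
  ∈-symmetrise⁺ es (inj₂ p) = ∈-++⁺ʳ es (∈-map⁺ Product.swap p)

  unique-map⁻ : ∀ (f : A → B) {xs} → Unique (map f xs) → Unique xs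
  unique-map⁻ f {[]}     u       = []
  unique-map⁻ f {x ∷ xs} (p ∷ u) = All.map (λ n → n ∘ cong f) (Allₚ.map⁻ p) ∷ unique-map⁻ f u

  -- Asymmetry makes the list disjoint from its reversal; distinct second components make it free of
  -- repetitions.
  symmetrise-unique : ∀ {es : List (A × A)} → Unique (map proj₂ es) →
    (∀ {u v} → (u , v) ∈ es → (v , u) ∉ es) → Unique (symmetrise es)
  symmetrise-unique {es = es} un asym = Uniqueₚ.++⁺ u (Uniqueₚ.map⁺ (cong Product.swap) u)
    λ { {u , v} (p , q) → disjoint p q }
    where
    u = unique-map⁻ proj₂ un
    disjoint : ∀ {u v} → (u , v) ∈ es → (u , v) ∉ map Product.swap es
    disjoint p q with ∈-map⁻ Product.swap q
    ... | _ , r , refl = asym p r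

  -- A path with at least one edge, split as first vertex, inner vertices
  -- and last vertex.
  data Path {V : Set} (R : V → V → Set) : V → List V → V → Set where
    edge : ∀ {x z} → R x z → x ≢ z → Path R x [] z
    link : ∀ {x y ys z} → R x y → x ∉ y ∷ ys ∷ʳ z → Path R y ys z → Path R x (y ∷ ys) z

  module _ {V : Set} {R : V → V → Set} where

    path-unique : ∀ {x ys z} → Path R x ys z → Unique (x ∷ ys ∷ʳ z)
    path-unique (edge r x≢z)  = (x≢z ∷ []) ∷ [] ∷ []
    path-unique (link r x∉ p) = ∉⇒All≢ x∉ ∷ path-unique p

    path-pairs : ∀ {x ys z u v} → Path R x ys z → (u , v) ∈ pairs x ys z → R u v
    path-pairs (edge r _)   (here refl) = r
    path-pairs (link r _ p) (here refl) = r
    path-pairs (link r _ p) (there q)   = path-pairs p q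

    path-suffix : ∀ {x ys z w} → Path R x ys z → w ∈ x ∷ ys ∷ʳ z → w ≡ z ⊎ ∃[ ys′ ] Path R w ys′ z
    path-suffix p            (here refl)         = inj₂ (_ , p)
    path-suffix (edge r _)   (there (here refl)) = inj₁ refl
    path-suffix (link r _ p) (there w∈)          = path-suffix p w∈

    -- The inclusion of the inner vertices is carried along because it allows a further vertex to be
    -- put in front of the prefix.
    path-prefix : ∀ {x ys z w} → Path R x ys z → w ∈ ys ∷ʳ z →
      ∃[ ys′ ] (Path R x ys′ w × (∀ {v} → v ∈ ys′ → v ∈ ys))
    path-prefix p@(edge r x≢)  (here refl) = [] , p , λ ()
    path-prefix (link r x∉ p)  (here refl) = [] , edge r (λ { refl → x∉ (here refl) }) , λ ()
    path-prefix {w = w} (link {x} {y} {ys} {z} r x∉ p) (there w∈) with path-prefix p w∈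
    ... | ys′ , q , sub = y ∷ ys′ , link r x∉′ q , λ { (here refl) → here refl ; (there v∈) → there (sub v∈) }
      where
      x∉′ : x ∉ y ∷ ys′ ∷ʳ w
      x∉′ (here refl) = x∉ (here refl)
      x∉′ (there x∈) with ∈-∷ʳ⁻ ys′ x∈
      ... | inj₁ m    = x∉ (there (∈-++⁺ˡ (sub m)))
      ... | inj₂ refl = x∉ (there w∈)

  module _ {n : ℕ} where

    open DecMembership (_≟ᶠ_ {n}) using (_∈?_)

    unique-length≤ : ∀ {xs : List (Fin n)} → Unique xs → length xs ≤ n
    unique-length≤ {xs} u = subst (length xs ≤_) (length-tabulate {n = n} (λ i → i)) (⊆⇒length≤ u (λ {x} _ → ∈-allFin x))

    -- Loop erasure: if `u` reappears on the path found from its successor, the detour is cut off by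
    -- passing to the suffix that starts at `u`.
    star⇒path : ∀ {R : Fin n → Fin n → Set} {u v} → Star R u v → u ≡ v ⊎ ∃[ ys ] Path R u ys v
    star⇒path ε = inj₁ refl
    star⇒path {u = u} {v} (_◅_ {j = w} r s) with u ≟ᶠ v
    ... | yes e = inj₁ e
    ... | no u≢v with star⇒path s
    ...   | inj₁ refl = inj₂ ([] , edge r u≢v)
    ...   | inj₂ (ys , p) with u ∈? w ∷ ys ∷ʳ v
    ...     | no u∉  = inj₂ (w ∷ ys , link r u∉ p)
    ...     | yes u∈ = path-suffix p u∈

    module GraphPaths (G : Graph n) where

      open Graph G

      neighbours : Fin n → List (Fin n)
      neighbours v = filter (λ w → T? (adj v w)) (allFin n)

      ∈-neighbours⁺ : ∀ {u v} → Adj u v → v ∈ neighbours u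
      ∈-neighbours⁺ {u} {v} a = ∈-filter⁺ (λ w → T? (adj u w)) (∈-allFin v) a

      ∈-neighbours⁻ : ∀ {u v} → v ∈ neighbours u → Adj u v
      ∈-neighbours⁻ {u} v∈ = proj₂ (∈-filter⁻ (λ w → T? (adj u w)) {xs = allFin n} v∈)

      neighbours-unique : ∀ u → Unique (neighbours u)
      neighbours-unique u = Uniqueₚ.filter⁺ (λ w → T? (adj u w)) (Uniqueₚ.allFin⁺ n)

      adj-sym : ∀ {u v} → Adj u v → Adj v u
      adj-sym {u} {v} = subst T (symm u v)

      adj-irrefl : ∀ {u v} → Adj u v → u ≢ v
      adj-irrefl {u} a refl = subst T (irrefl u) a

      walk⇒star : ∀ {u v} → Walk u v → Star Adj u v
      walk⇒star Walk.here       = ε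
      walk⇒star (Walk.step w a) = walk⇒star w ◅◅ (a ◅ ε)

      degree≡1⇒unique : ∀ {u v w} → degree u ≡ 1 → Adj u v → Adj u w → v ≡ w
      degree≡1⇒unique {u} d a b with neighbours u | ∈-neighbours⁺ a | ∈-neighbours⁺ b
      degree≡1⇒unique d a b | _ ∷ [] | here refl | here refl = refl

      two-neighbours⇒2≤degree : ∀ {u v w} → Adj u v → Adj u w → v ≢ w → 2 ≤ degree u
      two-neighbours⇒2≤degree a b v≢w = ⊆⇒length≤ ((v≢w ∷ []) ∷ [] ∷ [])
        λ { (here refl) → ∈-neighbours⁺ a ; (there (here refl)) → ∈-neighbours⁺ b }

      unique⇒degree≡1 : ∀ {u v} → Adj u v → (∀ {w} → Adj u w → w ≡ v) → degree u ≡ 1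
      unique⇒degree≡1 {u} {v} a only = ℕₚ.≤-antisym
        (⊆⇒length≤ {ys = v ∷ []} (neighbours-unique u) (λ w∈ → here (only (∈-neighbours⁻ w∈))))
        (⊆⇒length≤ ([] ∷ []) λ { (here refl) → ∈-neighbours⁺ a })

      1≤degree⇒neighbour : ∀ {u} → 1 ≤ degree u → ∃[ v ] Adj u v
      1≤degree⇒neighbour {u} d = from (neighbours u) refl d
        where
        from : ∀ l → neighbours u ≡ l → 1 ≤ length l → ∃[ v ] Adj u v
        from (x ∷ _) e _ = x , ∈-neighbours⁻ (subst (x ∈_) (sym e) (here refl))

      2≤degree⇒another : ∀ {u} → 2 ≤ degree u → ∀ v → ∃[ w ] (Adj u w × w ≢ v)
      2≤degree⇒another {u} d v = from (neighbours u) refl d (neighbours-unique u)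
        where
        from : ∀ l → neighbours u ≡ l → 2 ≤ length l → Unique l → ∃[ w ] (Adj u w × w ≢ v)
        from (x ∷ y ∷ _) e _ ((x≢y ∷ _) ∷ _) with x ≟ᶠ v
        ... | no x≢v   = x , ∈-neighbours⁻ (subst (x ∈_) (sym e) (here refl)) , x≢v
        ... | yes refl = y , ∈-neighbours⁻ (subst (y ∈_) (sym e) (there (here refl))) , ≢-sym x≢y
        from (_ ∷ []) _ (s≤s ()) _

      closed-path⇒cycle : ∀ {x y ys z} → Path Adj x (y ∷ ys) z → Adj z x → Cycle
      closed-path⇒cycle {x} {y} {ys} {z} p a = record
        { vertex   = vertexAt x (y ∷ ys) z
        ; distinct = vertexAt-injective x (y ∷ ys) z (path-unique p)
        ; edges    = λ i → path-pairs p (vertexAt-pairs x (y ∷ ys) z i)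
        ; closing  = subst (λ v → Adj v x) (sym (vertexAt-last x (y ∷ ys) z)) a
        }

      path-map : ∀ {R : Fin n → Fin n → Set} → (∀ {u v} → R u v → Adj u v) → ∀ {x ys z} → Path R x ys z → Path Adj x ys z
      path-map h (edge r x≢)   = edge (h r) x≢
      path-map h (link r x∉ p) = link (h r) x∉ (path-map h p)

      -- One more edge would close a cycle.
      spanning-subrelation : Acyclic → ∀ {R : Fin n → Fin n → Set} → (∀ {u v} → R u v → Adj u v) →
        (∀ u v → Star R u v) → ∀ {u v} → Adj u v → R u v
      spanning-subrelation ac h conn {u} {v} a with star⇒path (conn u v)
      ... | inj₁ e                = ⊥-elim (adj-irrefl a e)
      ... | inj₂ ([] , edge r _)  = r
      ... | inj₂ (_ ∷ _ , p)      = ⊥-elim (ac (closed-path⇒cycle (path-map h p) (adj-sym a)))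

  module TreePaths {n : ℕ} (T : TreeWithBoundary n) where

    open TreeWithBoundary T
    open GraphPaths graph public
    open DecMembership (_≟ᶠ_ {n}) using (_∈?_)

    interior-not-boundary : ∀ {v} → IsInterior v → ¬ IsBoundary v
    interior-not-boundary 2≤d d≡1 = ℕₚ.<⇒≱ (s≤s (s≤s z≤n)) (subst (2 ≤_) d≡1 2≤d)

    not-interior⇒boundary : ∀ {v} → ¬ IsInterior v → IsBoundary v
    not-interior⇒boundary {v} k with partition v
    ... | inj₁ b = b
    ... | inj₂ i = ⊥-elim (k i)

    interior? : ∀ v → Dec (IsInterior v)
    interior? v = 2 ℕₚ.≤? degree v

    neighbour : ∀ v → ∃[ u ] Adj v u
    neighbour v = 1≤degree⇒neighbour (1≤degree (partition v))
      where
      1≤degree : IsBoundary v ⊎ IsInterior v → 1 ≤ degree v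
      1≤degree (inj₁ b) = ℕₚ.≤-reflexive (sym b)
      1≤degree (inj₂ i) = ℕₚ.<⇒≤ i

    -- Two adjacent leaves would form a whole component, which contains no interior vertex.
    boundary-neighbour-interior : ∀ {b u} → IsBoundary b → Adj b u → IsInterior u
    boundary-neighbour-interior {b} {u} bd a with partition u
    ... | inj₂ i   = i
    ... | inj₁ ubd with someInterior
    ...   | w , wi with stays (connected b w)
      where
      stays : ∀ {w} → Walk b w → w ≡ b ⊎ w ≡ u
      stays Walk.here = inj₁ refl
      stays (Walk.step p e) with stays p
      ... | inj₁ refl = inj₂ (degree≡1⇒unique bd e a)
      ... | inj₂ refl = inj₁ (degree≡1⇒unique ubd e (adj-sym a))
    ...     | inj₁ refl = ⊥-elim (interior-not-boundary wi bd)
    ...     | inj₂ refl = ⊥-elim (interior-not-boundary wi ubd)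

    -- A second edge from `x` into the path would close a cycle with the prefix of the path up to
    -- `w`.
    chord : ∀ {x y ys z w} → Path Adj x (y ∷ ys) z → Adj x w → w ≢ y → w ∉ y ∷ ys ∷ʳ z
    chord p a w≢y (here refl) = w≢y refl
    chord (link r x∉ p) a w≢y (there w∈) with path-prefix p w∈
    ... | ys′ , q , sub = acyclic (closed-path⇒cycle (link r x∉′ q) (adj-sym a))
      where
      x∉′ : _ ∉ _ ∷ ys′ ∷ʳ _
      x∉′ (here refl) = x∉ (here refl)
      x∉′ (there x∈) with ∈-∷ʳ⁻ ys′ x∈
      ... | inj₁ m    = x∉ (there (∈-++⁺ˡ (sub m)))
      ... | inj₂ refl = x∉ (there w∈)

    extend-step : ∀ {x ys z} → Path Adj x ys z → IsInterior x → ∃[ w ] Path Adj w (x ∷ ys) z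
    extend-step {x} {[]} {z} p@(edge _ x≢z) i with 2≤degree⇒another i z
    ... | w , a , w≢z = w , link (adj-sym a) w∉ p
      where
      w∉ : w ∉ x ∷ z ∷ []
      w∉ (here refl)         = adj-irrefl a refl
      w∉ (there (here refl)) = w≢z refl
    extend-step {x} {y ∷ ys} {z} p i with 2≤degree⇒another i y
    ... | w , a , w≢y = w , link (adj-sym a) w∉ p
      where
      w∉ : w ∉ x ∷ y ∷ ys ∷ʳ z
      w∉ (here refl) = adj-irrefl a refl
      w∉ (there w∈)  = chord p a w≢y w∈

    -- Neighbours are prepended until one is a leaf. The vertices of a path are distinct, so this
    -- stops: `fuel` together with the length of the path always amounts to at least `n`.
    extend-to-boundary : ∀ {x ys z} → Path Adj x ys z → IsInterior x →
      ∃[ b ] ∃[ pre ] (IsBoundary b × Path Adj b (pre ++ x ∷ ys) z)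
    extend-to-boundary {x} {ys} p i = go n p i (ℕₚ.m≤m+n n (length ys))
      where
      go : ∀ fuel {x ys z} → Path Adj x ys z → IsInterior x → n ≤ fuel ℕ.+ length ys →
        ∃[ b ] ∃[ pre ] (IsBoundary b × Path Adj b (pre ++ x ∷ ys) z)
      go zero {x} {ys} {z} p i le = ⊥-elim (ℕₚ.<-irrefl refl (ℕₚ.≤-<-trans le
        (ℕₚ.<-≤-trans (s≤s (ℕₚ.≤-trans (ℕₚ.m≤m+n (length ys) 1) (ℕₚ.≤-reflexive (sym (length-++ ys))))) (unique-length≤ (path-unique p)))))
      go (suc fuel) {x} {ys} p i le with extend-step p i
      ... | w , q with partition w
      ...   | inj₁ b  = w , [] , b , q
      ...   | inj₂ i′ with go fuel q i′ (subst (n ≤_) (sym (ℕₚ.+-suc fuel (length ys))) le)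
      ...     | b , pre , bd , r = b , pre ++ w ∷ [] , bd , subst (λ l → Path Adj b l _) (sym (++-assoc pre (w ∷ []) (x ∷ ys))) r

    path-from-boundary : ∀ {z} → IsInterior z → ∃[ b ] ∃[ ys ] (IsBoundary b × Path Adj b ys z)
    path-from-boundary {z} i with neighbour z
    ... | w , a with partition w
    ...   | inj₁ b  = w , [] , b , edge (adj-sym a) (≢-sym (adj-irrefl a))
    ...   | inj₂ i′ with extend-to-boundary (edge (adj-sym a) (≢-sym (adj-irrefl a))) i′
    ...     | b , pre , bd , p = b , pre ++ w ∷ [] , bd , p

    -- The path that joins `m` to `z` is prolonged backwards beyond `m` until it meets a leaf.
    path-through : ∀ {m z} → IsInterior m → IsInterior z → m ≢ z →
      ∃[ b ] ∃[ pre ] ∃[ mid ] (IsBoundary b × Path Adj b (pre ++ m ∷ mid) z)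
    path-through {m} {z} im iz m≢z with star⇒path (walk⇒star (connected m z))
    ... | inj₁ e         = ⊥-elim (m≢z e)
    ... | inj₂ (mid , p) with extend-to-boundary p im
    ...   | b , pre , bd , q = b , pre , mid , bd , q

    inner-interior : ∀ {x ys z} → Path Adj x ys z → ∀ {y} → y ∈ ys → IsInterior y
    inner-interior (link a x∉ (edge b y≢z)) (here refl) =
      two-neighbours⇒2≤degree (adj-sym a) b (λ { refl → x∉ (there (here refl)) })
    inner-interior (link a x∉ (link b y∉ p)) (here refl) =
      two-neighbours⇒2≤degree (adj-sym a) b (λ { refl → x∉ (there (here refl)) })
    inner-interior (link a x∉ p) (there y∈) = inner-interior p y∈

    -- The one-edge path into `b` is prolonged backwards from the neighbour of `b`; it starts at a
    -- leaf, and path vertices are distinct.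
    another-boundary : ∀ b → IsBoundary b → ∃[ c ] (IsBoundary c × c ≢ b)
    another-boundary b bd with neighbour b
    ... | u , a with extend-to-boundary (edge (adj-sym a) (≢-sym (adj-irrefl a))) (boundary-neighbour-interior bd a)
    ...   | c , pre , cbd , p = c , cbd , λ { refl → unique-head (path-unique p) (last∈ (pre ++ u ∷ [])) }


open PathsInTrees

-- Comets as orderings of the vertices

module Layouts where

  open ≡ using (refl; sym; trans; cong; cong₂; subst)
  open Star using (Star; ε; _◅_; _◅◅_)
  open D using (IsComet; CometEnds; _≅_)

  private variable A B : Set

  lookup-injective : ∀ {xs : List A} → Unique xs → ∀ i j → lookup xs i ≡ lookup xs j → i ≡ j
  lookup-injective {xs = x ∷ xs} u zero zero e = refl
  lookup-injective {xs = x ∷ xs} (p ∷ u) zero (suc j) e = ⊥-elim (All.lookup p (∈-lookup j) e)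
  lookup-injective {xs = x ∷ xs} (p ∷ u) (suc i) zero e = ⊥-elim (All.lookup p (∈-lookup i) (sym e))
  lookup-injective {xs = x ∷ xs} (p ∷ u) (suc i) (suc j) e = cong suc (lookup-injective u i j e)

  tabulate-cast : ∀ (xs : List B) (ys : List A) (e : length xs ≡ length ys) → tabulate (λ i → lookup ys (cast e i)) ≡ ys
  tabulate-cast []       []       e = refl
  tabulate-cast (x ∷ xs) (y ∷ ys) e = cong (y ∷_) (tabulate-cast xs ys (ℕₚ.suc-injective e))

  module _ {n : ℕ} {xs ys : List (Fin n)} (ux : Unique xs) (uy : Unique ys)
    (cx : ∀ v → v ∈ xs) (cy : ∀ v → v ∈ ys) (e : length xs ≡ length ys) where

    private
      index-lookup : ∀ {zs : List (Fin n)} → Unique zs → ∀ i (p : lookup zs i ∈ zs) → index p ≡ i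
      index-lookup u i p = lookup-injective u (index p) i (sym (Anyₚ.lookup-index p))

      to : Fin n → Fin n
      to u = lookup ys (cast e (index (cx u)))

      from : Fin n → Fin n
      from v = lookup xs (cast (sym e) (index (cy v)))

      to∘from : ∀ v → to (from v) ≡ v
      to∘from v = trans (cong (lookup ys) (trans (cong (cast e) (index-lookup ux _ (cx (from v)))) (Finₚ.cast-involutive e (sym e) _)))
        (sym (Anyₚ.lookup-index (cy v)))

      from∘to : ∀ u → from (to u) ≡ u
      from∘to u = trans (cong (lookup xs) (trans (cong (cast (sym e)) (index-lookup uy _ (cy (to u)))) (Finₚ.cast-involutive (sym e) e _)))
        (sym (Anyₚ.lookup-index (cx u)))

    -- The permutation pairs entries at equal positions. The equation between lists lets the images
    -- of start, spine and leaves be read off at once.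
    matching : Σ (Permutation′ n) λ π → map (π ⟨$⟩ʳ_) xs ≡ ys
    matching = permutation to from to∘from from∘to , (begin
      map to xs                                ≡⟨ cong (map to) (tabulate-lookup xs) ⟨
      map to (tabulate (lookup xs))            ≡⟨ map-tabulate (lookup xs) to ⟩
      tabulate (to ∘ lookup xs)                ≡⟨ tabulate-cong (λ i → cong (lookup ys ∘ cast e) (index-lookup ux i (cx (lookup xs i)))) ⟩
      tabulate (λ i → lookup ys (cast e i))    ≡⟨ tabulate-cast xs ys e ⟩
      ys                                       ∎)
      where
      open ≡.≡-Reasoning

  ++-injective : ∀ {as as′ bs bs′ : List A} → length as ≡ length as′ → as ++ bs ≡ as′ ++ bs′ → as ≡ as′ × bs ≡ bs′
  ++-injective {as = []}     {[]}     _ e = refl , e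
  ++-injective {as = a ∷ as} {a′ ∷ _} l e with ∷-injective e
  ... | refl , e′ = Product.map₁ (cong (a ∷_)) (++-injective (ℕₚ.suc-injective l) e′)

  -- Each undirected edge of the comet occurs once, directed away from `b`.
  cometEdges : A → List A → A → List A → List (A × A)
  cometEdges b ys z leaves = pairs b ys z ++ map (z ,_) leaves

  cometEdges-map : ∀ (π : A → B) b ys z leaves →
    map (Product.map π π) (cometEdges b ys z leaves) ≡ cometEdges (π b) (map π ys) (π z) (map π leaves)
  cometEdges-map π b ys z leaves = trans (map-++ (Product.map π π) (pairs b ys z) (map (z ,_) leaves))
    (cong₂ _++_ (pairs-map π b ys z) (trans (sym (map-∘ leaves)) (map-∘ leaves)))

  CometEdge : A → List A → A → List A → A → A → Set
  CometEdge b ys z leaves u v = (u , v) ∈ symmetrise (cometEdges b ys z leaves)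

  module _ (b : A) (ys : List A) (z : A) (leaves : List A) where

    private
      es = cometEdges b ys z leaves
      E = CometEdge b ys z leaves

    cometEdge-sym : ∀ {u v} → E u v → E v u
    cometEdge-sym p with ∈-symmetrise⁻ es p
    ... | inj₁ q = ∈-symmetrise⁺ es (inj₂ q)
    ... | inj₂ q = ∈-symmetrise⁺ es (inj₁ q)

    reach-end : ∀ {x v} zs → (∀ {e} → e ∈ pairs x zs z → e ∈ es) → v ∈ x ∷ zs ∷ʳ z → Star E v z
    reach-end []       sub (here refl)         = ∈-symmetrise⁺ es (inj₁ (sub (here refl))) ◅ ε
    reach-end []       sub (there (here refl)) = ε
    reach-end (y ∷ zs) sub (here refl) = ∈-symmetrise⁺ es (inj₁ (sub (here refl))) ◅ reach-end zs (sub ∘ there) (here refl)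
    reach-end (y ∷ zs) sub (there v∈)  = reach-end zs (sub ∘ there) v∈

    comet-reach : ∀ {v} → v ∈ b ∷ (ys ∷ʳ z) ++ leaves → Star E v z
    comet-reach v∈ with ∈-++⁻ (b ∷ ys ∷ʳ z) v∈
    ... | inj₁ p = reach-end ys ∈-++⁺ˡ p
    ... | inj₂ p = ∈-symmetrise⁺ es (inj₂ (∈-++⁺ʳ (pairs b ys z) (∈-map⁺ (z ,_) p))) ◅ ε

  module _ {n : ℕ} (T : TreeWithBoundary n) where

    open TreeWithBoundary T
    open TreePaths T
    open DecMembership (_≟ᶠ_ {n}) using (_∈?_)

    otherLeaf? : ∀ b v → Dec (¬ IsInterior v × v ≢ b)
    otherLeaf? b v = ¬? (interior? v) ×-dec ¬? (v ≟ᶠ b)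

    otherLeaves : Fin n → List (Fin n)
    otherLeaves b = filter (otherLeaf? b) (allFin n)

    ∈-otherLeaves⁺ : ∀ {b v} → IsBoundary v → v ≢ b → v ∈ otherLeaves b
    ∈-otherLeaves⁺ {b} {v} bd v≢b = ∈-filter⁺ (otherLeaf? b) (∈-allFin v) ((λ i → interior-not-boundary i bd) , v≢b)

    ∈-otherLeaves⁻ : ∀ {b v} → v ∈ otherLeaves b → IsBoundary v × v ≢ b
    ∈-otherLeaves⁻ {b} v∈ with ∈-filter⁻ (otherLeaf? b) {xs = allFin n} v∈
    ... | _ , k , v≢b = not-interior⇒boundary k , v≢b

    ∈-interior⁺ : ∀ {v} → IsInterior v → v ∈ interior
    ∈-interior⁺ {v} i = ∈-filter⁺ interior? (∈-allFin v) i

    ∈-interior⁻ : ∀ {v} → v ∈ interior → IsInterior v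
    ∈-interior⁻ v∈ = proj₂ (∈-filter⁻ interior? {xs = allFin n} v∈)

    interior-unique : Unique interior
    interior-unique = Uniqueₚ.filter⁺ interior? (Uniqueₚ.allFin⁺ n)

    -- A listing of all vertices in the order in which the comet visits
    -- them: a leaf b, the interior ys ∷ʳ z, and the remaining leaves.
    record IsLayout (b : Fin n) (ys : List (Fin n)) (z : Fin n) : Set where
      field
        start-boundary : IsBoundary b
        spine-unique   : Unique (ys ∷ʳ z)
        spine-interior : ∀ {v} → v ∈ ys ∷ʳ z → IsInterior v
        spine-complete : ∀ {v} → IsInterior v → v ∈ ys ∷ʳ z

      listing : List (Fin n)
      listing = b ∷ (ys ∷ʳ z) ++ otherLeaves b

      listing-complete : ∀ v → v ∈ listing
      listing-complete v with partition v
      ... | inj₂ i = there (∈-++⁺ˡ (spine-complete i))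
      ... | inj₁ bd with v ≟ᶠ b
      ...   | yes refl = here refl
      ...   | no v≢b   = there (∈-++⁺ʳ (ys ∷ʳ z) (∈-otherLeaves⁺ bd v≢b))

      listing-unique : Unique listing
      listing-unique = ∉⇒All≢ b∉ ∷ Uniqueₚ.++⁺ spine-unique (Uniqueₚ.filter⁺ (otherLeaf? b) (Uniqueₚ.allFin⁺ n))
        λ (p , q) → interior-not-boundary (spine-interior p) (proj₁ (∈-otherLeaves⁻ q))
        where
        b∉ : b ∉ (ys ∷ʳ z) ++ otherLeaves b
        b∉ b∈ with ∈-++⁻ (ys ∷ʳ z) b∈
        ... | inj₁ p = interior-not-boundary (spine-interior p) start-boundary
        ... | inj₂ p = proj₂ (∈-otherLeaves⁻ p) refl

      listing-↭ : listing ↭ allFin n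
      listing-↭ = unique-⊆⊇⇒↭ (Uniqueₚ.allFin⁺ n) listing-unique (λ {v} _ → listing-complete v) (λ {v} _ → ∈-allFin v)

      listing-length : length listing ≡ n
      listing-length = trans (↭-length listing-↭) (length-tabulate {n = n} id)

      spine-length : length (ys ∷ʳ z) ≡ ∣V₀∣
      spine-length = ↭-length (unique-⊆⊇⇒↭ interior-unique spine-unique (spine-complete ∘ ∈-interior⁻) (∈-interior⁺ ∘ spine-interior))

    -- Only the presence of the comet's edges is asked for: they connect all vertices, so acyclicity
    -- leaves no room for others, as `cometLayout⇒edges` shows.
    CometLayout : Fin n → List (Fin n) → Fin n → Set
    CometLayout b ys z = IsLayout b ys z × All (λ (u , v) → Adj u v) (cometEdges b ys z (otherLeaves b))

    cometEdge⇒adj : ∀ {b ys z} → CometLayout b ys z → ∀ {u v} → CometEdge b ys z (otherLeaves b) u v → Adj u v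
    cometEdge⇒adj {b} {ys} {z} (L , es) p with ∈-symmetrise⁻ (cometEdges b ys z (otherLeaves b)) p
    ... | inj₁ q = All.lookup es q
    ... | inj₂ q = adj-sym (All.lookup es q)

    cometLayout⇒edges : ∀ {b ys z} → CometLayout b ys z → ∀ {u v} → Adj u v → CometEdge b ys z (otherLeaves b) u v
    cometLayout⇒edges {b} {ys} {z} C = spanning-subrelation acyclic (cometEdge⇒adj C) conn
      where
      open IsLayout (proj₁ C)
      leaves = otherLeaves b
      conn : ∀ u v → Star (CometEdge b ys z (otherLeaves b)) u v
      conn u v = comet-reach b ys z leaves (listing-complete u)
        ◅◅ Star.reverse (cometEdge-sym b ys z leaves) (comet-reach b ys z leaves (listing-complete v))

    isLayout? : ∀ b ys z → Dec (IsLayout b ys z)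
    isLayout? b ys z = map′
      (λ (p , q , r , s) → record { start-boundary = p ; spine-unique = q ; spine-interior = All.lookup r ; spine-complete = λ {v} → s v })
      (λ L → let open IsLayout L in start-boundary , spine-unique , All.tabulate spine-interior , λ v → spine-complete {v})
      ((degree b ℕₚ.≟ 1) ×-dec DecUnique.unique? _≟ᶠ_ (ys ∷ʳ z) ×-dec All.all? interior? (ys ∷ʳ z)
        ×-dec Finₚ.all? λ v → interior? v →-dec v ∈? ys ∷ʳ z)

    cometLayout? : ∀ b ys z → Dec (CometLayout b ys z)
    cometLayout? b ys z = isLayout? b ys z ×-dec All.all? (λ (u , v) → T? (adj u v)) (cometEdges b ys z (otherLeaves b))

    init : ∀ m → (Fin (suc m) → Fin n) → List (Fin n)
    init zero    p = []
    init (suc m) p = p zero ∷ init m (p ∘ suc)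

    init-last : ∀ m p → init m p ∷ʳ p (fromℕ m) ≡ tabulate p
    init-last zero    p = refl
    init-last (suc m) p = cong (p zero ∷_) (init-last m (p ∘ suc))

    pairs-init : ∀ {Q : Fin n × Fin n → Set} m p x → Q (x , p zero) → (∀ i → Q (p (inject₁ i) , p (suc i))) →
      All Q (pairs x (init m p) (p (fromℕ m)))
    pairs-init zero    p x q qs = q ∷ []
    pairs-init (suc m) p x q qs = q ∷ pairs-init m (p ∘ suc) (p zero) (qs zero) (qs ∘ suc)

    path⇒layout : ∀ {m} (p : Fin (suc m) → Fin n) → (∀ {i j} → p i ≡ p j → i ≡ j) →
      (∀ i → Adj (p (inject₁ i)) (p (suc i))) → (∀ i → IsInterior (p i)) → (∀ u → IsInterior u → ∃[ i ] p i ≡ u) →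
      ∀ {b} → IsBoundary b → Adj b (p zero) → (∀ c → IsBoundary c → c ≢ b → Adj (p (fromℕ m)) c) →
      CometLayout b (init m p) (p (fromℕ m))
    path⇒layout {m} p distinct edges pathInterior exhaustive {b} bd a leaf = record
      { start-boundary = bd
      ; spine-unique   = subst Unique (sym (init-last m p)) (Uniqueₚ.tabulate⁺ distinct)
      ; spine-interior = λ v∈ → let i , e = ∈-tabulate⁻ {f = p} (subst (_ ∈_) (init-last m p) v∈) in subst IsInterior (sym e) (pathInterior i)
      ; spine-complete = λ {v} i → let j , e = exhaustive v i in subst (v ∈_) (sym (init-last m p)) (subst (_∈ tabulate p) e (∈-tabulate⁺ {f = p} j))
      } , Allₚ.++⁺ (pairs-init m p b a edges)
                   (Allₚ.map⁺ (All.tabulate λ l∈ → let lb , l≢b = ∈-otherLeaves⁻ l∈ in leaf _ lb l≢b))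

    isComet⇒layout : IsComet T → ∃[ b ] ∃[ ys ] ∃[ z ] CometLayout b ys z
    isComet⇒layout c =
      let b , bd , a , leaf = ends⇒ m path ends
      in b , init m path , path (fromℕ m) , path⇒layout path distinct edges pathInterior exhaustive bd a leaf
      where
      open IsComet c
      ends⇒ : ∀ m p → CometEnds T m p → ∃[ b ] (IsBoundary b × Adj b (p zero) × (∀ c → IsBoundary c → c ≢ b → Adj (p (fromℕ m)) c))
      -- On a star any leaf can serve as the start.
      ends⇒ zero    p e = let b , bd = someBoundary in b , bd , adj-sym (e b bd) , λ c cb _ → e c cb
      ends⇒ (suc m) p (b , bd , a , _ , e) = b , bd , adj-sym a , e

    layout⇒isComet : ∀ {b ys z} → CometLayout b ys z → IsComet T
    layout⇒isComet {b} {ys} {z} (L , es) = record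
      { m            = length ys
      ; path         = path
      ; distinct     = λ e → Finₚ.suc-injective (vertexAt-injective b ys z unique e)
      ; edges        = λ i → spine (vertexAt-pairs b ys z (suc i))
      ; pathInterior = λ i → spine-interior (vertexAt-∈-tail b ys z i)
      ; exhaustive   = λ u i → vertexAt-surjective b ys z (spine-complete i)
      ; ends         = endsOf ys refl
      }
      where
      open IsLayout L
      path : Fin (suc (length ys)) → Fin n
      path i = vertexAt b ys z (suc i)
      unique : Unique (b ∷ ys ∷ʳ z)
      unique = ∉⇒All≢ (λ b∈ → interior-not-boundary (spine-interior b∈) start-boundary) ∷ spine-unique
      spine : ∀ {u v} → (u , v) ∈ pairs b ys z → Adj u v
      spine p = All.lookup es (∈-++⁺ˡ p)
      leaf : ∀ c → IsBoundary c → c ≢ b → Adj z c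
      leaf c bd c≢b = All.lookup es (∈-++⁺ʳ (pairs b ys z) (∈-map⁺ (z ,_) (∈-otherLeaves⁺ bd c≢b)))
      -- The list is replaced by a variable because `CometEnds` computes by cases on its length.
      endsOf : ∀ ys′ → ys ≡ ys′ → CometEnds T (length ys′) (λ i → vertexAt b ys′ z (suc i))
      endsOf [] refl c bd with c ≟ᶠ b
      ... | yes refl = adj-sym (spine (here refl))
      ... | no c≢b   = leaf c bd c≢b
      endsOf (y ∷ ys′) refl = b , start-boundary , adj-sym (spine (here refl)) , only , λ c bd c≢b →
        subst (λ w → Adj w c) (sym (vertexAt-last y ys′ z)) (leaf c bd c≢b)
        where
        -- A further leaf at `y` would hang both at `y` and at `z`, which are different spine
        -- vertices.
        only : ∀ c → IsBoundary c → Adj y c → c ≡ b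
        only c bd a with c ≟ᶠ b
        ... | yes e = e
        ... | no c≢b with degree≡1⇒unique bd (adj-sym a) (adj-sym (leaf c bd c≢b))
        ...   | refl = ⊥-elim (unique-head spine-unique (last∈ ys′))

    anyVec? : ∀ m {P : Vec (Fin n) m → Set} → (∀ v → Dec (P v)) → Dec (∃ P)
    anyVec? zero    P? = map′ (Vec.[] ,_) (λ { (Vec.[] , p) → p }) (P? Vec.[])
    anyVec? (suc m) P? = map′ (λ (x , v , p) → x Vec.∷ v , p) (λ { (x Vec.∷ v , p) → x , v , p })
      (Finₚ.any? λ x → anyVec? m λ v → P? (x Vec.∷ v))

    -- The spine of a layout has `∣V₀∣` vertices, so `ys` ranges over vectors of one fixed length
    -- and a finite search decides.
    isComet-stable : ¬ ¬ (∃[ b ] ∃[ ys ] ∃[ z ] CometLayout b ys z) → IsComet T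
    isComet-stable k with Finₚ.any? (λ b → anyVec? (ℕ.pred ∣V₀∣) (λ ys → Finₚ.any? (λ z → cometLayout? b (Vec.toList ys) z)))
    ... | yes (_ , _ , _ , L) = layout⇒isComet L
    ... | no none = ⊥-elim (k λ (b , ys , z , L) → none (b , toVec ys (length-pred L) , z ,
        subst (λ l → CometLayout b l z) (sym (toList-toVec ys (length-pred L))) L))
      where
      length-pred : ∀ {b ys z} → CometLayout b ys z → length ys ≡ ℕ.pred ∣V₀∣
      length-pred {ys = ys} (L , _) = sym (cong ℕ.pred (trans (sym (IsLayout.spine-length L)) (trans (length-++ ys) (ℕₚ.+-comm (length ys) 1))))
      toVec : ∀ (ys : List (Fin n)) {m} → length ys ≡ m → Vec (Fin n) m
      toVec ys refl = Vec.fromList ys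
      toList-toVec : ∀ (ys : List (Fin n)) {m} (e : length ys ≡ m) → Vec.toList (toVec ys e) ≡ ys
      toList-toVec ys refl = Vecₚ.toList∘fromList ys

  module _ {n : ℕ} {G H : TreeWithBoundary n} {b ys z b′ ys′ z′}
    (L : IsLayout G b ys z) (L′ : IsLayout H b′ ys′ z′) (same : TreeWithBoundary.∣V₀∣ G ≡ TreeWithBoundary.∣V₀∣ H) where

    private
      module L = IsLayout L
      module L′ = IsLayout L′

    -- The two listings have the same length and so do their spines, so matching by position
    -- respects each of the blocks separately.
    layout-matching : Σ (Permutation′ n) λ π → π ⟨$⟩ʳ b ≡ b′ × map (π ⟨$⟩ʳ_) ys ≡ ys′ × π ⟨$⟩ʳ z ≡ z′
      × map (π ⟨$⟩ʳ_) (otherLeaves G b) ≡ otherLeaves H b′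
    layout-matching = let
        π , e   = matching L.listing-unique L′.listing-unique L.listing-complete L′.listing-complete
                    (trans L.listing-length (sym L′.listing-length))
        eb , e′ = ∷-injective e
        es , er = ++-injective {as = map (π ⟨$⟩ʳ_) (ys ∷ʳ z)}
                    (trans (length-map _ (ys ∷ʳ z)) (trans L.spine-length (trans same (sym L′.spine-length))))
                    (trans (sym (map-++ (π ⟨$⟩ʳ_) (ys ∷ʳ z) (otherLeaves G b))) e′)
        ey , ez = ∷ʳ-injective (map (π ⟨$⟩ʳ_) ys) ys′ (trans (sym (map-++ (π ⟨$⟩ʳ_) ys [ z ])) es)
      in π , eb , ey , ez , er

  symmetrise-map : ∀ (π : A → B) es → map (Product.map π π) (symmetrise es) ≡ symmetrise (map (Product.map π π) es)
  symmetrise-map π es = trans (map-++ (Product.map π π) es (map Product.swap es))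
    (cong (map (Product.map π π) es ++_) (trans (sym (map-∘ es)) (map-∘ es)))

  -- The comet `G` is carried over to the vertices of `H`, ordered by any layout of `H`; the image
  -- of its edges is the comet that competes with `H`.
  module CometTransport {n : ℕ} {G H : TreeWithBoundary n} {b ys z b′ ys′ z′}
    (C : CometLayout G b ys z) (L′ : IsLayout H b′ ys′ z′)
    (π : Permutation′ n) (b-to : π ⟨$⟩ʳ b ≡ b′) (ys-to : map (π ⟨$⟩ʳ_) ys ≡ ys′) (z-to : π ⟨$⟩ʳ z ≡ z′)
    (leaves-to : map (π ⟨$⟩ʳ_) (otherLeaves G b) ≡ otherLeaves H b′) where

    private
      module G where
        open TreeWithBoundary G public
        open TreePaths G public
      module H where
        open TreeWithBoundary H public
        open TreePaths H public
      L = proj₁ C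
      module L = IsLayout L
      module L′ = IsLayout L′

    to : Fin n → Fin n
    to = π ⟨$⟩ʳ_

    from : Fin n → Fin n
    from = π ⟨$⟩ˡ_

    to∘from : ∀ v → to (from v) ≡ v
    to∘from v = inverseʳ π

    from∘to : ∀ v → from (to v) ≡ v
    from∘to v = inverseˡ π

    to-injective : ∀ {u v} → to u ≡ to v → u ≡ v
    to-injective {u} {v} e = trans (sym (from∘to u)) (trans (cong from e) (from∘to v))

    edges-to : map (Product.map to to) (cometEdges b ys z (otherLeaves G b)) ≡ cometEdges b′ ys′ z′ (otherLeaves H b′)
    edges-to = trans (cometEdges-map to b ys z (otherLeaves G b))
      (trans (cong₂ (λ x y → cometEdges x y _ _) b-to ys-to) (cong₂ (cometEdges _ _) z-to leaves-to))

    symmetrised-to : map (Product.map to to) (symmetrise (cometEdges b ys z (otherLeaves G b)))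
      ≡ symmetrise (cometEdges b′ ys′ z′ (otherLeaves H b′))
    symmetrised-to = trans (symmetrise-map to (cometEdges b ys z (otherLeaves G b))) (cong symmetrise edges-to)

    spine-to : map to (ys ∷ʳ z) ≡ ys′ ∷ʳ z′
    spine-to = trans (map-++ to ys [ z ]) (cong₂ _∷ʳ_ ys-to z-to)

    listing-to : map to L.listing ≡ L′.listing
    listing-to = cong₂ _∷_ b-to (trans (map-++ to (ys ∷ʳ z) _) (cong₂ _++_ spine-to leaves-to))

    boundary-to : ∀ {u} → G.IsBoundary u → H.IsBoundary (to u)
    boundary-to {u} bd with u ≟ᶠ b
    ... | yes refl = subst H.IsBoundary (sym b-to) L′.start-boundary
    ... | no u≢b   = proj₁ (∈-otherLeaves⁻ H (subst (_ ∈_) leaves-to (∈-map⁺ to (∈-otherLeaves⁺ G bd u≢b))))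

    interior-from : ∀ {v} → H.IsInterior v → G.IsInterior (from v)
    interior-from {v} i with G.partition (from v)
    ... | inj₂ j  = j
    ... | inj₁ bd = ⊥-elim (H.interior-not-boundary (subst H.IsInterior (sym (to∘from v)) i) (boundary-to bd))

    adj⇒edge-to : ∀ {u v} → G.Adj u v → CometEdge b′ ys′ z′ (otherLeaves H b′) (to u) (to v)
    adj⇒edge-to {u} {v} a = subst ((to u , to v) ∈_) symmetrised-to
      (∈-map⁺ (Product.map to to) (cometLayout⇒edges G C a))

    edge-to⇒adj : ∀ {u v} → CometEdge b′ ys′ z′ (otherLeaves H b′) (to u) (to v) → G.Adj u v
    edge-to⇒adj {u} {v} p with ∈-map⁻ (Product.map to to) (subst ((to u , to v) ∈_) (sym symmetrised-to) p)
    ... | (u′ , v′) , q , e with to-injective (cong proj₁ e) | to-injective (cong proj₂ e)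
    ...   | refl | refl = cometEdge⇒adj G C q

  T-≡ : ∀ {a b : Bool} → (T a → T b) → (T b → T a) → a ≡ b
  T-≡ {false} {false} f g = refl
  T-≡ {false} {true}  f g = ⊥-elim (g _)
  T-≡ {true}  {false} f g = ⊥-elim (f _)
  T-≡ {true}  {true}  f g = refl

  comets-isomorphic : ∀ {n} (G H : TreeWithBoundary n) → TreeWithBoundary.∣V₀∣ G ≡ TreeWithBoundary.∣V₀∣ H →
    IsComet G → IsComet H → TreeWithBoundary.graph G ≅ TreeWithBoundary.graph H
  comets-isomorphic G H same cG cH =
    let b , ys , z , C = isComet⇒layout G cG
        b′ , ys′ , z′ , C′ = isComet⇒layout H cH
        π , eb , ey , ez , el = layout-matching (proj₁ C) (proj₁ C′) same
        open CometTransport C (proj₁ C′) π eb ey ez el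
    in π , λ u v → T-≡ (λ a → cometEdge⇒adj H C′ (adj⇒edge-to a)) (λ a → edge-to⇒adj (cometLayout⇒edges H C′ a))


open Layouts

-- A comet for given numbers of vertices

module StandardComets where

  open ≡ using (refl; sym; trans; cong; subst; subst₂)
  open import Data.Nat.Base using (pred; _≤_; _<_; _⊓_; z≤n; s≤s)

  module _ {n : ℕ} (G : Graph n) where

    open Graph G
    open GraphPaths G

    walk-trans : ∀ {u v w} → Walk u v → Walk v w → Walk u w
    walk-trans p here       = p
    walk-trans p (step q a) = step (walk-trans p q) a

    walk-sym : ∀ {u v} → Walk u v → Walk v u
    walk-sym here       = here
    walk-sym (step p a) = walk-trans (step here (adj-sym a)) (walk-sym p)

    -- Predecessor and successor along the cycle, with the closing edge for the first and last
    -- vertex. They differ because a cycle has at least three vertices.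
    cycle-neighbours : (c : Cycle) → let open Cycle c in ∀ i →
      ∃[ p ] ∃[ q ] (p ≢ q × Adj (vertex i) (vertex p) × Adj (vertex i) (vertex q))
    cycle-neighbours c zero = suc zero , fromℕ _ , (λ ()) , edges zero , adj-sym closing
      where open Cycle c
    cycle-neighbours c (suc i) with view i
    ... | ‵fromℕ     = inject₁ (fromℕ _) , zero , (λ ()) , adj-sym (edges (fromℕ _)) , closing
      where open Cycle c
    ... | ‵inject₁ j = inject₁ (inject₁ j) , suc (suc j) , distinct′ , adj-sym (edges (inject₁ j)) , edges (suc j)
      where
      open Cycle c
      distinct′ : inject₁ (inject₁ j) ≢ suc (suc j)
      distinct′ e = ℕₚ.<⇒≢ (ℕₚ.≤-trans ℕₚ.≤-refl (ℕₚ.n≤1+n _)) (trans (sym (trans (Finₚ.toℕ-inject₁ (inject₁ j)) (Finₚ.toℕ-inject₁ j))) (cong toℕ e))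

  maximum : ∀ {m} (h : Fin (suc m) → ℕ) → ∃[ i ] (∀ j → h j ≤ h i)
  maximum {zero}  h = zero , λ { zero → ℕₚ.≤-refl }
  maximum {suc m} h with maximum (h ∘ suc)
  ... | i , most with ℕₚ.≤-total (h zero) (h (suc i))
  ...   | inj₁ le = suc i , λ { zero → le ; (suc j) → most j }
  ...   | inj₂ le = zero , λ { zero → ℕₚ.≤-refl ; (suc j) → ℕₚ.≤-trans (most j) le }

  -- The comet on 0, …, n - 1 in which the parent of j is (j - 1) ⊓ k: the
  -- path 0, …, k with all further vertices attached to k.
  module StandardComet (n₁ k₁ : ℕ) (k<n₁ : suc k₁ < n₁) where

    private
      n = suc n₁
      k = suc k₁

    -- The inequality keeps vertex 0 from being its own parent, since `pred 0 ⊓ k` is 0.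
    Parent : Fin n → Fin n → Set
    Parent i j = toℕ i < toℕ j × toℕ i ≡ pred (toℕ j) ⊓ k

    parent? : ∀ i j → Dec (Parent i j)
    parent? i j = (toℕ i ℕₚ.<? toℕ j) ×-dec (toℕ i ℕₚ.≟ pred (toℕ j) ⊓ k)

    linked? : ∀ i j → Dec (Parent i j ⊎ Parent j i)
    linked? i j = parent? i j ⊎-dec parent? j i

    cometGraph : Graph n
    cometGraph = record
      { adj    = λ i j → ⌊ linked? i j ⌋
      ; symm   = λ i j → T-≡ (fromWitness ∘ Sum.swap ∘ toWitness {a? = linked? i j}) (fromWitness ∘ Sum.swap ∘ toWitness {a? = linked? j i})
      ; irrefl = λ i → T-≡ (λ t → no-loop (toWitness {a? = linked? i i} t)) λ ()
      }
      where
      no-loop : ∀ {i} → ¬ (Parent i i ⊎ Parent i i)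
      no-loop (inj₁ (lt , _)) = ℕₚ.<-irrefl refl lt
      no-loop (inj₂ (lt , _)) = ℕₚ.<-irrefl refl lt

    open Graph cometGraph
    open GraphPaths cometGraph

    adj⁺ : ∀ {i j} → Parent i j → Adj i j
    adj⁺ {i} {j} p = fromWitness {a? = linked? i j} (inj₁ p)

    adj⁻ : ∀ {i j} → Adj i j → Parent i j ⊎ Parent j i
    adj⁻ {i} {j} = toWitness {a? = linked? i j}

    parent-unique : ∀ {i i′ j} → Parent i j → Parent i′ j → i ≡ i′
    parent-unique (_ , e) (_ , e′) = Finₚ.toℕ-injective (trans e (sym e′))

    parent : ∀ {j t} → toℕ j ≡ suc t → ∃[ i ] Parent i j
    parent {j} {t} e = i , subst₂ _<_ (sym ei) (sym e) (s≤s (ℕₚ.m⊓n≤m t k)) , trans ei (cong (λ x → pred x ⊓ k) (sym e))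
      where
      lt : t ⊓ k < n
      lt = ℕₚ.≤-<-trans (ℕₚ.m⊓n≤m t k) (ℕₚ.<-trans (ℕₚ.n<1+n t) (subst (_< n) e (Finₚ.toℕ<n j)))
      i = fromℕ< lt
      ei : toℕ i ≡ t ⊓ k
      ei = Finₚ.toℕ-fromℕ< lt

    rooted : ∀ j → Walk zero j
    rooted j = <-rec (λ t → ∀ j → toℕ j ≡ t → Walk zero j) go (toℕ j) j refl
      where
      go : ∀ t → (∀ {s} → s < t → ∀ j → toℕ j ≡ s → Walk zero j) → ∀ j → toℕ j ≡ t → Walk zero j
      go t       rec zero      e = here
      go (suc t) rec j@(suc _) e = let i , p = parent {j} e in step (rec (subst (toℕ i <_) e (proj₁ p)) i refl) (adj⁺ p)

    connected : Connected
    connected u v = walk-trans cometGraph (walk-sym cometGraph (rooted u)) (rooted v)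

    -- The vertex of a cycle with the largest number has two smaller neighbours,
    -- both of which would have to be its parent.
    acyclic : Acyclic
    acyclic c = p≢q (distinct (parent-unique (below p ap) (below q aq)))
      where
      open Cycle c
      top = proj₁ (maximum (toℕ ∘ vertex))
      most = proj₂ (maximum (toℕ ∘ vertex))
      p = proj₁ (cycle-neighbours cometGraph c top)
      q = proj₁ (proj₂ (cycle-neighbours cometGraph c top))
      p≢q = proj₁ (proj₂ (proj₂ (cycle-neighbours cometGraph c top)))
      ap = proj₁ (proj₂ (proj₂ (proj₂ (cycle-neighbours cometGraph c top))))
      aq = proj₂ (proj₂ (proj₂ (proj₂ (cycle-neighbours cometGraph c top))))
      below : ∀ j → Adj (vertex top) (vertex j) → Parent (vertex j) (vertex top)
      below j a with adj⁻ a
      ... | inj₂ r        = r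
      ... | inj₁ (lt , _) = ⊥-elim (ℕₚ.<⇒≱ lt (most j))

    on-path : ∀ {i j} → toℕ j ≡ suc (toℕ i) → toℕ i ≤ k → Parent i j
    on-path {i} {j} e le = subst (toℕ i <_) (sym e) ℕₚ.≤-refl , trans (sym (ℕₚ.m≤n⇒m⊓n≡m le)) (cong (λ x → pred x ⊓ k) (sym e))

    to-hub : ∀ {i j} → toℕ i ≡ k → k < toℕ j → Parent i j
    to-hub {i} {j} e lt = subst (_< toℕ j) (sym e) lt , trans e (sym (ℕₚ.m≥n⇒m⊓n≡n (ℕₚ.<⇒≤pred lt)))

    1<n : 1 < n
    1<n = s≤s (ℕₚ.≤-trans (s≤s z≤n) k<n₁)

    start-boundary : degree zero ≡ 1
    start-boundary = unique⇒degree≡1 {zero} {fromℕ< 1<n} (adj⁺ (on-path (Finₚ.toℕ-fromℕ< 1<n) z≤n)) only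
      where
      only : ∀ {w} → Adj zero w → w ≡ fromℕ< 1<n
      only {w} a with adj⁻ {zero} {w} a
      ... | inj₁ (lt , e) = Finₚ.toℕ-injective (trans (one (toℕ w) lt e) (sym (Finₚ.toℕ-fromℕ< 1<n)))
        where
        -- As `k` is positive, the minimum vanishes only if `pred t` does.
        one : ∀ t → 0 < t → 0 ≡ pred t ⊓ k → t ≡ 1
        one (suc zero) _ _ = refl

    hub<n : k < n
    hub<n = ℕₚ.<-trans k<n₁ (ℕₚ.n<1+n n₁)

    hub : Fin n
    hub = fromℕ< hub<n

    leaf-boundary : ∀ {j} → k < toℕ j → degree j ≡ 1
    leaf-boundary {j} lt = unique⇒degree≡1 (adj-sym (adj⁺ up)) only
      where
      up : Parent hub j
      up = to-hub (Finₚ.toℕ-fromℕ< hub<n) lt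
      only : ∀ {w} → Adj j w → w ≡ hub
      only {w} a with adj⁻ {j} {w} a
      ... | inj₂ r       = parent-unique r up
      ... | inj₁ (_ , e) = ⊥-elim (ℕₚ.<⇒≱ lt (subst (_≤ k) (sym e) (ℕₚ.m⊓n≤n _ k)))

    path-interior : ∀ {j t} → toℕ j ≡ suc t → suc t ≤ k → 2 ≤ degree j
    path-interior {j} {t} e le = two-neighbours⇒2≤degree (adj-sym (adj⁺ (proj₂ (parent {j} e)))) (adj⁺ (on-path (Finₚ.toℕ-fromℕ< lt) (subst (_≤ k) (sym e) le)))
      λ q → ℕₚ.<-irrefl (cong toℕ q) (ℕₚ.<-trans (proj₁ (proj₂ (parent {j} e))) (subst (toℕ j <_) (sym (Finₚ.toℕ-fromℕ< lt)) ℕₚ.≤-refl))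
      where
      lt : suc (toℕ j) < n
      lt = s≤s (ℕₚ.≤-<-trans (subst (_≤ k) (sym e) le) k<n₁)

    data Kind (j : Fin n) : Set where
      start : j ≡ zero → Kind j
      spine : ∀ {t} → toℕ j ≡ suc t → suc t ≤ k → Kind j
      leaf  : k < toℕ j → Kind j

    kind : ∀ j → Kind j
    kind zero = start refl
    kind j@(suc i) with suc (toℕ i) ℕₚ.≤? k
    ... | yes le = spine refl le
    ... | no gt  = leaf (ℕₚ.≰⇒> gt)

    comet : TreeWithBoundary n
    comet = record
      { graph        = cometGraph
      ; connected    = connected
      ; acyclic      = acyclic
      ; partition    = λ j → classify (kind j)
      ; someBoundary = zero , start-boundary
      ; someInterior = fromℕ< 1<n , path-interior (Finₚ.toℕ-fromℕ< 1<n) (s≤s z≤n)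
      }
      where
      classify : ∀ {j} → Kind j → degree j ≡ 1 ⊎ 2 ≤ degree j
      classify (start refl) = inj₁ start-boundary
      classify (spine e le) = inj₂ (path-interior e le)
      classify (leaf lt)    = inj₁ (leaf-boundary lt)

    open TreePaths comet using (interior-not-boundary)

    path : Fin k → Fin n
    path i = suc (inject≤ i (ℕₚ.<⇒≤ k<n₁))

    toℕ-path : ∀ i → toℕ (path i) ≡ suc (toℕ i)
    toℕ-path i = cong suc (Finₚ.toℕ-inject≤ i _)

    comet-layout : CometLayout comet zero (init comet k₁ path) (path (fromℕ k₁))
    comet-layout = path⇒layout comet path
      (λ {i} {j} e → Finₚ.toℕ-injective (ℕₚ.suc-injective (trans (sym (toℕ-path i)) (trans (cong toℕ e) (toℕ-path j)))))
      (λ i → adj⁺ (on-path (trans (toℕ-path (suc i)) (cong suc (sym (trans (toℕ-path (inject₁ i)) (cong suc (Finₚ.toℕ-inject₁ i))))))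
        (subst (_≤ k) (sym (toℕ-path (inject₁ i))) (Finₚ.toℕ<n (inject₁ i)))))
      (λ i → path-interior (toℕ-path i) (Finₚ.toℕ<n i))
      (λ u i → locate i (kind u))
      start-boundary
      (adj⁺ (on-path (toℕ-path zero) z≤n))
      (λ c bd c≢0 → attach bd c≢0 (kind c))
      where
      locate : ∀ {u} → 2 ≤ degree u → Kind u → ∃[ i ] path i ≡ u
      locate i (start refl) = ⊥-elim (interior-not-boundary {zero} i start-boundary)
      locate {u} i (leaf lt) = ⊥-elim (interior-not-boundary {u} i (leaf-boundary lt))
      locate i (spine e le) = fromℕ< le , Finₚ.toℕ-injective (trans (toℕ-path (fromℕ< le)) (trans (cong suc (Finₚ.toℕ-fromℕ< le)) (sym e)))
      attach : ∀ {c} → degree c ≡ 1 → c ≢ zero → Kind c → Adj (path (fromℕ k₁)) c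
      attach bd c≢0 (start e)    = ⊥-elim (c≢0 e)
      attach {c} bd c≢0 (spine e le) = ⊥-elim (interior-not-boundary {c} (path-interior e le) bd)
      attach bd c≢0 (leaf lt)    = adj⁺ (to-hub (trans (toℕ-path (fromℕ k₁)) (cong suc (Finₚ.toℕ-fromℕ k₁))) lt)

    comet-interior : TreeWithBoundary.∣V₀∣ comet ≡ k
    comet-interior = trans (sym (IsLayout.spine-length (proj₁ comet-layout))) (trans (cong length (init-last comet k₁ path)) (length-tabulate path))


open StandardComets

-- Directed edges of a graph

module GraphEdges {n : ℕ} (G : Graph n) where

  open Graph G
  open GraphPaths G

  edgesFrom : List (Fin n) → List (Fin n × Fin n)
  edgesFrom = concatMap (λ u → map (u ,_) (neighbours u))

  directedEdges : List (Fin n × Fin n)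
  directedEdges = edgesFrom (allFin n)

  ∈-edgesFrom⁻ : ∀ {u v} us → (u , v) ∈ edgesFrom us → u ∈ us × Adj u v
  ∈-edgesFrom⁻ (w ∷ us) p with ∈-++⁻ (map (w ,_) (neighbours w)) p
  ... | inj₂ q = Product.map₁ there (∈-edgesFrom⁻ us q)
  ... | inj₁ q with ∈-map⁻ (w ,_) q
  ...   | _ , r , ≡.refl = here ≡.refl , ∈-neighbours⁻ r

  ∈-edgesFrom⁺ : ∀ {u v us} → u ∈ us → Adj u v → (u , v) ∈ edgesFrom us
  ∈-edgesFrom⁺ (here ≡.refl) a = ∈-++⁺ˡ (∈-map⁺ (_ ,_) (∈-neighbours⁺ a))
  ∈-edgesFrom⁺ {us = w ∷ _} (there u∈) a = ∈-++⁺ʳ (map (w ,_) (neighbours w)) (∈-edgesFrom⁺ u∈ a)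

  edgesFrom-unique : ∀ {us} → Unique us → Unique (edgesFrom us)
  edgesFrom-unique {[]} [] = []
  edgesFrom-unique {u ∷ us} un@(_ ∷ un′) = Uniqueₚ.++⁺
    (Uniqueₚ.map⁺ (≡.cong proj₂) (neighbours-unique u)) (edgesFrom-unique un′) disjoint
    where
    disjoint : ∀ {e} → ¬ (e ∈ map (u ,_) (neighbours u) × e ∈ edgesFrom us)
    disjoint (p , q) with ∈-map⁻ (u ,_) p
    ... | _ , _ , ≡.refl = unique-head un (proj₁ (∈-edgesFrom⁻ us q))

  ∈-directedEdges⁻ : ∀ {u v} → (u , v) ∈ directedEdges → Adj u v
  ∈-directedEdges⁻ = proj₂ ∘ ∈-edgesFrom⁻ (allFin n)

  ∈-directedEdges⁺ : ∀ {u v} → Adj u v → (u , v) ∈ directedEdges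
  ∈-directedEdges⁺ = ∈-edgesFrom⁺ (∈-allFin _)

  directedEdges-unique : Unique directedEdges
  directedEdges-unique = edgesFrom-unique (Uniqueₚ.allFin⁺ n)

  directedEdges-swap : directedEdges ↭ map Product.swap directedEdges
  directedEdges-swap = unique-⊆⊇⇒↭ (Uniqueₚ.map⁺ (≡.cong Product.swap) directedEdges-unique) directedEdges-unique to from
    where
    from : ∀ {e} → e ∈ directedEdges → e ∈ map Product.swap directedEdges
    from {u , v} p = ∈-map⁺ Product.swap (∈-directedEdges⁺ (adj-sym (∈-directedEdges⁻ p)))
    to : ∀ {e} → e ∈ map Product.swap directedEdges → e ∈ directedEdges
    to p with ∈-map⁻ Product.swap p
    ... | (u , v) , q , ≡.refl = ∈-directedEdges⁺ (adj-sym (∈-directedEdges⁻ q))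

-- Energy, Picone's identity and Rayleigh's principle

module Energy (R : OrderedRing) where

  open OrderedRing R
  open OrderedRingProperties R

  private variable A : Set

  ∑-⊆ : ∀ {f : A → Carrier} {xs ys} → (∀ {x} → x ∈ ys → 0# ≤ f x) → Unique xs →
    (∀ {x} → x ∈ xs → x ∈ ys) → ∑ f xs ≤ ∑ f ys
  ∑-⊆ {f = f} {xs} {ys} nn u sub with ⊆-complement u sub
  ... | zs , p = ≤-respʳ (sym (trans (∑-↭ f p) (∑-++ f xs zs)))
    (≤-respˡ (+-identityʳ _) (+-mono-≤ ≤-refl (∑-nonNeg zs λ z∈ → nn (∈-resp (∈-++⁺ʳ xs z∈)))))
    where
    ∈-resp : ∀ {z} → z ∈ xs ++ zs → z ∈ ys
    ∈-resp = ∈-resp-↭ (↭-sym p)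

  ∑-member : ∀ {f : A → Carrier} {x xs} → (∀ {x} → x ∈ xs → 0# ≤ f x) → x ∈ xs → f x ≤ ∑ f xs
  ∑-member nn x∈ = ≤-respˡ (+-identityʳ _) (∑-⊆ nn ([] ∷ []) λ { (here ≡.refl) → x∈ })

  stretch : (A → Carrier) → A × A → Carrier
  stretch x (u , v) = sq (x u - x v)

  stretch-nonNeg : ∀ (x : A → Carrier) e → 0# ≤ stretch x e
  stretch-nonNeg x (u , v) = sq-nonNeg _

  stretch-swap : ∀ (x : A → Carrier) e → stretch x (Product.swap e) ≈ stretch x e
  stretch-swap x (u , v) = solve 2 (λ a b → (b :- a) :* (b :- a) := (a :- b) :* (a :- b)) refl (x u) (x v)

  ∑-symmetrise : ∀ (x : A → Carrier) es → ∑ (stretch x) (symmetrise es) ≈ ∑ (stretch x) es + ∑ (stretch x) es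
  ∑-symmetrise x es = trans (∑-++ _ es _) (+-congˡ (trans (reflexive (∑-map _ Product.swap es)) (∑-cong es λ {e} _ → stretch-swap x e)))

  norm² : ∀ {n} → (Fin n → Carrier) → Carrier
  norm² {n} x = ∑ (λ u → sq (x u)) (allFin n)

  module Laplacian {n : ℕ} (G : Graph n) where

    open Graph G
    open GraphPaths G
    open GraphEdges G

    -- Every edge counts in both directions, so this is twice the Dirichlet form. The doubled terms
    -- `a + a` in later statements avoid a division by two.
    energy : (Fin n → Carrier) → Carrier
    energy x = ∑ (stretch x) directedEdges

    lap : (Fin n → Carrier) → Fin n → Carrier
    lap x u = ∑ (λ v → x u - x v) (neighbours u)

    ∑-directedEdges : ∀ (F : Fin n × Fin n → Carrier) → ∑ F directedEdges ≈ ∑ (λ u → ∑ (λ v → F (u , v)) (neighbours u)) (allFin n)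
    ∑-directedEdges F = trans (∑-concatMap F _ (allFin n)) (∑-cong (allFin n) λ {u} _ → reflexive (∑-map F (u ,_) (neighbours u)))

    ∑-directedEdges-swap : ∀ (F : Fin n × Fin n → Carrier) → ∑ F directedEdges ≈ ∑ (F ∘ Product.swap) directedEdges
    ∑-directedEdges-swap F = trans (∑-↭ F directedEdges-swap) (reflexive (∑-map F Product.swap directedEdges))

    gap : (φ t : Fin n → Carrier) → Fin n × Fin n → Carrier
    gap φ t (u , v) = (φ u * φ v) * sq (t u - t v)

    -- Picone's identity: the part of the energy of φ t not seen by the
    -- Laplacian of φ is a sum of squares.
    picone : ∀ (φ t : Fin n → Carrier) → let w = ∑ (λ u → sq (t u) * (φ u * lap φ u)) (allFin n) in
      energy (λ u → φ u * t u) ≈ ∑ (gap φ t) directedEdges + (w + w)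
    picone φ t = trans (∑-cong directedEdges λ {(u , v)} _ → pointwise (φ u) (φ v) (t u) (t v))
      (trans (∑-distrib-+ (gap φ t) (λ e → h e + h (Product.swap e)) directedEdges)
        (+-congˡ (trans (∑-distrib-+ h (h ∘ Product.swap) directedEdges)
          (+-cong ∑h (trans (sym (∑-directedEdges-swap h)) ∑h)))))
      where
      -- The part of the square attributed to the first endpoint; reversing all edges shows that the
      -- second endpoints contribute the same total.
      h : Fin n × Fin n → Carrier
      h (u , v) = (sq (t u) * φ u) * (φ u - φ v)
      pointwise : ∀ a b s r → sq (a * s - b * r) ≈ (a * b) * sq (s - r) + ((sq s * a) * (a - b) + (sq r * b) * (b - a))
      pointwise = solve 4 (λ a b s r → (a :* s :- b :* r) :* (a :* s :- b :* r) :=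
        (a :* b) :* ((s :- r) :* (s :- r)) :+ (((s :* s) :* a) :* (a :- b) :+ ((r :* r) :* b) :* (b :- a))) refl
      ∑h : ∑ h directedEdges ≈ ∑ (λ u → sq (t u) * (φ u * lap φ u)) (allFin n)
      ∑h = trans (∑-directedEdges h) (∑-cong (allFin n) λ {u} _ →
        trans (sym (*-distribˡ-∑ (sq (t u) * φ u) (λ v → φ u - φ v) (neighbours u))) (*-assoc _ _ _))

    -- Picone's identity for the constant quotient 1, whose gaps vanish.
    green : ∀ (x : Fin n → Carrier) → let w = ∑ (λ u → x u * lap x u) (allFin n) in energy x ≈ w + w
    green x = trans (∑-cong directedEdges λ {(u , v)} _ → sq-cong (+-cong (sym (*-identityʳ _)) (-‿cong (sym (*-identityʳ _)))))
      (trans (picone x (λ _ → 1#)) (trans (+-cong gaps (+-cong w w)) (+-identityˡ _)))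
      where
      gaps : ∑ (gap x (λ _ → 1#)) directedEdges ≈ 0#
      gaps = trans (∑-cong directedEdges λ {(u , v)} _ → trans (*-congˡ (trans (*-congʳ (-‿inverseʳ 1#)) (zeroˡ _))) (zeroʳ _)) (∑-zero directedEdges)
      w : ∑ (λ u → sq 1# * (x u * lap x u)) (allFin n) ≈ ∑ (λ u → x u * lap x u) (allFin n)
      w = ∑-cong (allFin n) λ _ → trans (*-congʳ (*-identityˡ 1#)) (*-identityˡ _)

  module _ {n : ℕ} (T : TreeWithBoundary n) where

    open TreeWithBoundary T
    open TreePaths T
    open GraphEdges graph
    open Laplacian graph public

    eigen-energy : ∀ {μ x} → (∀ {u} → IsBoundary u → x u ≈ 0#) → (∀ {u} → IsInterior u → lap x u ≈ μ * x u) →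
      energy x ≈ μ * norm² x + μ * norm² x
    eigen-energy {μ} {x} x0 eig = trans (green x) (+-cong w w)
      where
      pointwise : ∀ u → IsBoundary u ⊎ IsInterior u → x u * lap x u ≈ μ * sq (x u)
      pointwise u (inj₂ i) = trans (*-congˡ (eig i)) (solve 2 (λ μ a → a :* (μ :* a) := μ :* (a :* a)) refl μ (x u))
      pointwise u (inj₁ b) = trans (trans (*-congʳ (x0 b)) (zeroˡ _)) (sym (trans (*-congˡ (trans (*-congʳ (x0 b)) (zeroˡ _))) (zeroʳ μ)))
      w : ∑ (λ u → x u * lap x u) (allFin n) ≈ μ * norm² x
      w = trans (∑-cong (allFin n) λ {u} _ → pointwise u (partition u)) (sym (*-distribˡ-∑ μ (λ u → sq (x u)) (allFin n)))

    record IsGroundState (μ : Carrier) (φ : Fin n → Carrier) : Set where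
      field
        zero-boundary     : ∀ {u} → IsBoundary u → φ u ≈ 0#
        positive-interior : ∀ {u} → IsInterior u → Positive (φ u)
        eigen             : ∀ {u} → IsInterior u → lap φ u ≈ μ * φ u

      nonNeg : ∀ u → 0# ≤ φ u
      nonNeg u with partition u
      ... | inj₁ b = ≤-reflexive (sym (zero-boundary b))
      ... | inj₂ i = proj₁ (positive-interior i)

      -- The factor `φ u` extends the eigenvalue equation to the leaves, where both sides vanish.
      eigen* : ∀ t u → sq t * (φ u * lap φ u) ≈ μ * sq (φ u * t)
      eigen* t u with partition u
      ... | inj₂ i = trans (*-congˡ (*-congˡ (eigen i)))
        (solve 3 (λ t μ a → (t :* t) :* (a :* (μ :* a)) := μ :* ((a :* t) :* (a :* t))) refl t μ (φ u))
      ... | inj₁ b = trans (trans (*-congˡ (trans (*-congʳ (zero-boundary b)) (zeroˡ _))) (zeroʳ _))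
        (sym (trans (*-congˡ (trans (*-congʳ (trans (*-congʳ (zero-boundary b)) (zeroˡ t))) (zeroˡ _))) (zeroʳ μ)))

    module GroundState {μ φ} (ground : IsGroundState μ φ) where

      open IsGroundState ground

      -- This is `x` divided by `φ`. At the leaves, where `φ` vanishes, the default 0 is harmless
      -- because it is used for functions `x` that vanish there too.
      quotient : (Fin n → Carrier) → Fin n → Carrier
      quotient x u with partition u
      ... | inj₁ _ = 0#
      ... | inj₂ i = x u * proj₁ (proj₂ (positive-interior i))

      *-quotient : ∀ {x} → (∀ {u} → IsBoundary u → x u ≈ 0#) → ∀ u → φ u * quotient x u ≈ x u
      *-quotient {x} x0 u with partition u
      ... | inj₁ b = trans (zeroʳ _) (sym (x0 b))
      ... | inj₂ i with positive-interior i
      ...   | _ , y , e = trans (solve 3 (λ a x y → a :* (x :* y) := x :* (a :* y)) refl (φ u) (x u) y) (trans (*-congˡ e) (*-identityʳ _))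

      gap-nonNeg : ∀ t e → 0# ≤ gap φ t e
      gap-nonNeg t (u , v) = *-nonNeg (*-nonNeg (nonNeg u) (nonNeg v)) (sq-nonNeg _)

      energy-decomposition : ∀ {x} → (∀ {u} → IsBoundary u → x u ≈ 0#) →
        energy x ≈ ∑ (gap φ (quotient x)) directedEdges + (μ * norm² x + μ * norm² x)
      energy-decomposition {x} x0 = trans
        (∑-cong directedEdges λ {(u , v)} _ → sq-cong (+-cong (sym (xt u)) (-‿cong (sym (xt v)))))
        (trans (picone φ t) (+-congˡ (+-cong w w)))
        where
        t = quotient x
        xt = *-quotient x0
        w : ∑ (λ u → sq (t u) * (φ u * lap φ u)) (allFin n) ≈ μ * norm² x
        w = trans (∑-cong (allFin n) λ {u} _ → trans (eigen* (t u) u) (*-congˡ (sq-cong (xt u)))) (sym (*-distribˡ-∑ μ (λ u → sq (x u)) (allFin n)))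

      rayleigh : ∀ {x} → (∀ {u} → IsBoundary u → x u ≈ 0#) → μ * norm² x + μ * norm² x ≤ energy x
      rayleigh {x} x0 = ≤-respʳ (sym (energy-decomposition x0)) (≤-respˡ (+-identityˡ _)
        (+-mono-≤ (∑-nonNeg directedEdges λ {e} _ → gap-nonNeg (quotient x) e) ≤-refl))

      -- Equality makes every gap vanish, so the quotient `t` is constant along edges between
      -- interior vertices. Around `u` the function `x` is therefore `t u` times `φ` and inherits
      -- its equation.
      rayleigh-minimiser : ∀ {x} → (∀ {u} → IsBoundary u → x u ≈ 0#) →
        energy x ≤ μ * norm² x + μ * norm² x → ∀ {u} → IsInterior u → lap x u ≈ μ * x u
      rayleigh-minimiser {x} x0 le {u} i = trans
        (∑-cong (neighbours u) λ v∈ → term (∈-neighbours⁻ v∈))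
        (trans (sym (*-distribˡ-∑ (t u) (λ v → φ u - φ v) (neighbours u)))
          (trans (*-congˡ (eigen i)) (trans (solve 3 (λ t μ a → t :* (μ :* a) := μ :* (a :* t)) refl (t u) μ (φ u)) (*-congˡ (xt u)))))
        where
        t = quotient x
        xt = *-quotient x0
        total : ∑ (gap φ t) directedEdges ≤ 0#
        total = ≤-resp (solve 2 (λ a b → (a :+ b) :- b := a) refl _ _) (-‿inverseʳ _)
          (+-mono-≤ (≤-respˡ (energy-decomposition x0) le) (≤-refl { - (μ * norm² x + μ * norm² x)}))
        t-const : ∀ {v} → Adj u v → IsInterior v → t u ≈ t v
        t-const {v} a j = x-y≈0⇒x≈y (square≤0 (*-cancelʳ-≤0 (positive-* (positive-interior i) (positive-interior j))
          (≤-respˡ (*-comm _ _) (≤-trans (∑-member (λ {e} _ → gap-nonNeg t e) (∈-directedEdges⁺ a)) total))))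
        same : ∀ {v} → Adj u v → IsBoundary v ⊎ IsInterior v → φ v * t v ≈ t u * φ v
        same a (inj₁ b) = trans (trans (*-congʳ (zero-boundary b)) (zeroˡ _)) (sym (trans (*-congˡ (zero-boundary b)) (zeroʳ _)))
        same a (inj₂ j) = trans (*-congˡ (sym (t-const a j))) (*-comm _ _)
        term : ∀ {v} → Adj u v → x u - x v ≈ t u * (φ u - φ v)
        term {v} a = trans (+-cong (sym (xt u)) (-‿cong (trans (sym (xt v)) (same a (partition v)))))
          (solve 3 (λ a b t → a :* t :- t :* b := t :* (a :- b)) refl (φ u) (φ v) (t u))

      ground-energy : energy φ ≈ μ * norm² φ + μ * norm² φ
      ground-energy = eigen-energy zero-boundary eigen

-- Rearrangement of a tree's ground state on a comet

module Comparison (R : OrderedRing) where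

  open OrderedRing R
  open OrderedRingProperties R
  open Energy R

  -- The test function on the comet `G` is `f` pulled back along `π`. All results are stated on the
  -- vertices of `H`, where they can be compared with the energy of `f` itself.
  module CometBound {n : ℕ} {G H : TreeWithBoundary n} {b ys z b′ ys′ z′}
    (C : CometLayout G b ys z) (L′ : IsLayout H b′ ys′ z′)
    (π : Permutation′ n) (b-to : π ⟨$⟩ʳ b ≡ b′) (ys-to : map (π ⟨$⟩ʳ_) ys ≡ ys′) (z-to : π ⟨$⟩ʳ z ≡ z′)
    (leaves-to : map (π ⟨$⟩ʳ_) (otherLeaves G b) ≡ otherLeaves H b′)
    {μ φ} (ground : IsGroundState G μ φ) (f : Fin n → Carrier)
    (f0 : ∀ {u} → TreeWithBoundary.IsBoundary H u → f u ≈ 0#) where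

    open CometTransport C L′ π b-to ys-to z-to leaves-to
    open GroundState G ground
    private
      module G where
        open TreeWithBoundary G public
        open TreePaths G public
        open GraphEdges (TreeWithBoundary.graph G) public
      module H = TreeWithBoundary H
      module L = IsLayout (proj₁ C)
      module L′ = IsLayout L′
      es = cometEdges b ys z (otherLeaves G b)
      es′ = cometEdges b′ ys′ z′ (otherLeaves H b′)
      x = f ∘ to

    norm-to : norm² x ≈ norm² f
    norm-to = trans (∑-↭ _ (↭-sym L.listing-↭)) (trans (reflexive (≡.trans (≡.sym (∑-map _ to L.listing))
      (≡.cong (∑ _) listing-to))) (∑-↭ _ L′.listing-↭))

    x0 : ∀ {u} → G.IsBoundary u → x u ≈ 0#
    x0 = f0 ∘ boundary-to

    energy-to : energy G x ≤ ∑ (stretch f) es′ + ∑ (stretch f) es′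
    energy-to = ≤-respʳ (trans (∑-symmetrise x es) (+-cong moved moved))
      (∑-⊆ (λ {e} _ → stretch-nonNeg x e) G.directedEdges-unique (λ {(u , v)} p → cometLayout⇒edges G C (G.∈-directedEdges⁻ p)))
      where
      moved : ∑ (stretch x) es ≈ ∑ (stretch f) es′
      moved = reflexive (≡.trans (≡.sym (∑-map (stretch f) (Product.map to to) es)) (≡.cong (∑ (stretch f)) edges-to))

    comet-rayleigh : μ * norm² f + μ * norm² f ≤ ∑ (stretch f) es′ + ∑ (stretch f) es′
    comet-rayleigh = ≤-trans (≤-respˡ (+-cong (*-congˡ norm-to) (*-congˡ norm-to)) (rayleigh x0)) energy-to

    cometNeighbours : Fin n → List (Fin n)
    cometNeighbours v = map to (G.neighbours (from v))

    cometNeighbours-unique : ∀ v → Unique (cometNeighbours v)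
    cometNeighbours-unique v = Uniqueₚ.map⁺ to-injective (G.neighbours-unique (from v))

    ∈-cometNeighbours⁻ : ∀ {v w} → w ∈ cometNeighbours v → CometEdge b′ ys′ z′ (otherLeaves H b′) v w
    ∈-cometNeighbours⁻ {v} w∈ with ∈-map⁻ to w∈
    ... | w′ , p , ≡.refl = ≡.subst (λ v → CometEdge b′ ys′ z′ (otherLeaves H b′) v (to w′)) (to∘from v) (adj⇒edge-to (G.∈-neighbours⁻ p))

    ∈-cometNeighbours⁺ : ∀ {v w} → CometEdge b′ ys′ z′ (otherLeaves H b′) v w → w ∈ cometNeighbours v
    ∈-cometNeighbours⁺ {v} {w} e = ≡.subst (_∈ cometNeighbours v) (to∘from w) (∈-map⁺ to (G.∈-neighbours⁺
      (edge-to⇒adj (≡.subst₂ (CometEdge b′ ys′ z′ (otherLeaves H b′)) (≡.sym (to∘from v)) (≡.sym (to∘from w)) e))))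

    -- Equality in Rayleigh's principle makes the pull-back of `f` an eigenfunction of `G`; its
    -- equation is moved to the vertices of `H`, to stand beside the one that holds in `H`.
    balanced : ∑ (stretch f) es′ + ∑ (stretch f) es′ ≤ μ * norm² f + μ * norm² f → ∀ {v} → H.IsInterior v →
      ∑ (λ w → f v - f w) (cometNeighbours v) ≈ μ * f v
    balanced le {v} i = trans (reflexive (∑-map _ to (G.neighbours (from v))))
      (trans (∑-cong (G.neighbours (from v)) λ _ → +-congʳ (reflexive (≡.cong f (≡.sym (to∘from v)))))
        (trans (rayleigh-minimiser x0 (≤-trans energy-to (≤-respʳ (+-cong (*-congˡ (sym norm-to)) (*-congˡ (sym norm-to))) le)) (interior-from i))
          (*-congˡ (reflexive (≡.cong f (to∘from v))))))

  argmin : ∀ {A : Set} (f : A → Carrier) → (∀ u v → f u ≤ f v ⊎ f v ≤ f u) → ∀ x xs →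
    ∃[ m ] (m ∈ x ∷ xs × (∀ {y} → y ∈ x ∷ xs → f m ≤ f y))
  argmin f cmp x [] = x , here ≡.refl , λ { (here ≡.refl) → ≤-refl }
  argmin f cmp x (y ∷ ys) with argmin f cmp y ys
  ... | m , m∈ , least with cmp x m
  ...   | inj₁ le = x , here ≡.refl , λ { (here ≡.refl) → ≤-refl ; (there p) → ≤-trans le (least p) }
  ...   | inj₂ le = m , there m∈ , λ { (here ≡.refl) → le ; (there p) → least p }

  argmax : ∀ {A : Set} (f : A → Carrier) → (∀ u v → f u ≤ f v ⊎ f v ≤ f u) → ∀ x xs →
    ∃[ m ] (m ∈ x ∷ xs × (∀ {y} → y ∈ x ∷ xs → f y ≤ f m))
  argmax f cmp x [] = x , here ≡.refl , λ { (here ≡.refl) → ≤-refl }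
  argmax f cmp x (y ∷ ys) with argmax f cmp y ys
  ... | m , m∈ , most with cmp x m
  ...   | inj₂ le = x , here ≡.refl , λ { (here ≡.refl) → ≤-refl ; (there p) → ≤-trans (most p) le }
  ...   | inj₁ le = m , there m∈ , λ { (here ≡.refl) → le ; (there p) → most p }

  -- The two sides differ by twice `(x - c) * (c - y)`.
  split-square : ∀ {x c y} → c ≤ x → y ≤ c → sq (x - c) + sq (c - y) ≤ sq (x - y)
  split-square {x} {c} {y} c≤x y≤c = ≤-by
    (solve 3 (λ x c y → (x :- y) :* (x :- y) :- ((x :- c) :* (x :- c) :+ (c :- y) :* (c :- y)) :=
      (x :- c) :* (c :- y) :+ (x :- c) :* (c :- y)) refl x c y)
    (+-nonNeg p p)
    where p = *-nonNeg (diff-nonNeg c≤x) (diff-nonNeg y≤c)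

  module _ {A : Set} (f : A → Carrier) (cmp : ∀ u v → f u ≤ f v ⊎ f v ≤ f u) where

    -- The value `f c` lies between those at the ends of the chain, so some step of the chain passes
    -- from above it to below it; `c` goes into the first step found.
    insert-between : ∀ x ys z c → f c ≤ f x → f z ≤ f c →
      ∃[ ys′ ] (ys′ ↭ c ∷ ys × ∑ (stretch f) (pairs x ys′ z) ≤ ∑ (stretch f) (pairs x ys z))
    insert-between x [] z c c≤x z≤c = c ∷ [] , ↭-refl ,
      ≤-respˡ (+-assoc _ _ _) (+-mono-≤ (split-square c≤x z≤c) ≤-refl)
    insert-between x (y ∷ ys) z c c≤x z≤c with cmp c y
    ... | inj₂ y≤c = c ∷ y ∷ ys , ↭-refl , ≤-respˡ (+-assoc _ _ _) (+-mono-≤ (split-square c≤x y≤c) ≤-refl)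
    ... | inj₁ c≤y with insert-between y ys z c c≤y z≤c
    ...   | ys′ , p , le = y ∷ ys′ , ↭-trans (prep y p) (swap y c ↭-refl) , +-mono-≤ ≤-refl le

    -- The last component serves the equality case, where it identifies the chain with the original
    -- path.
    insert-all : ∀ x ys z cs → (∀ {c} → c ∈ cs → f c ≤ f x × f z ≤ f c) →
      ∃[ ys′ ] (ys′ ↭ cs ++ ys × ∑ (stretch f) (pairs x ys′ z) ≤ ∑ (stretch f) (pairs x ys z) × (cs ≡ [] → ys′ ≡ ys))
    insert-all x ys z [] _ = ys , ↭-refl , ≤-refl , λ _ → ≡.refl
    insert-all x ys z (c ∷ cs) bounds with insert-all x ys z cs (bounds ∘ there)
    ... | ys₁ , p₁ , le₁ , _ with insert-between x ys₁ z c (proj₁ (bounds (here ≡.refl))) (proj₂ (bounds (here ≡.refl)))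
    ...   | ys₂ , p₂ , le₂ = ys₂ , ↭-trans p₂ (prep c p₁) , ≤-trans le₂ le₁ , λ ()

  module _ {n : ℕ} (H : TreeWithBoundary n) where

    open TreeWithBoundary H
    open TreePaths H
    open GraphEdges graph
    open DecMembership (_≟ᶠ_ {n}) using (_∈?_)

    -- The path b, ys₀, z of the tree after the interior vertices missing
    -- from it have been inserted where they do not increase the energy.
    record Rearrangement (f : Fin n → Carrier) : Set where
      field
        {b z}     : Fin n
        {ys₀ ys}  : List (Fin n)
        path      : Path Adj b ys₀ z
        layout    : IsLayout H b ys z
        least     : ∀ {u} → IsInterior u → f z ≤ f u
        chain-≤   : ∑ (stretch f) (pairs b ys z) ≤ ∑ (stretch f) (pairs b ys₀ z)
        inserted  : ∀ {c v} → IsInterior c → c ∉ ys₀ ∷ʳ z → (v , c) ∈ pairs b ys z → v ∈ ys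
        unchanged : (∀ {c} → IsInterior c → c ∈ ys₀ ∷ʳ z) → ys ≡ ys₀

    module _ {f : Fin n → Carrier} (cmp : ∀ u v → f u ≤ f v ⊎ f v ≤ f u) where

      -- With a single interior vertex there is no `m`. Inner vertices of a path are interior, so
      -- the path from a leaf to `z` is one edge.
      rearrange-single : ∀ {z} → IsInterior z → (∀ {u} → IsInterior u → u ≡ z) → Rearrangement f
      rearrange-single {z} iz only with path-from-boundary iz
      ... | b , y ∷ ys , bd , p with only (inner-interior p (here ≡.refl))
      ...   | ≡.refl = ⊥-elim (unique-head (tail (path-unique p)) (last∈ ys))
        where
        tail : ∀ {x : Fin n} {xs} → Unique (x ∷ xs) → Unique xs
        tail (_ ∷ u) = u
      rearrange-single {z} iz only | b , [] , bd , p = record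
        { path      = p
        ; layout    = record
          { start-boundary = bd
          ; spine-unique   = [] ∷ []
          ; spine-interior = λ { (here ≡.refl) → iz }
          ; spine-complete = λ i → here (only i)
          }
        ; least     = λ i → ≤-reflexive (reflexive (≡.cong f (≡.sym (only i))))
        ; chain-≤   = ≤-refl
        ; inserted  = λ { i c∉ (here ≡.refl) → ⊥-elim (c∉ (here ≡.refl)) }
        ; unchanged = λ _ → ≡.refl
        }

      rearrange-via : ∀ {m z} → IsInterior m → IsInterior z → m ≢ z → (∀ {u} → IsInterior u → f z ≤ f u) →
        (∀ {u} → IsInterior u → u ≢ z → f u ≤ f m) → Rearrangement f
      rearrange-via {m} {z} im iz m≢z least most with path-through im iz m≢z
      ... | b , pre , mid , bd , p with insert-all f cmp m mid z offs bounds
        where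
        offs = filter (λ v → ¬? (v ∈? (pre ++ m ∷ mid) ∷ʳ z)) interior
        bounds : ∀ {c} → c ∈ offs → f c ≤ f m × f z ≤ f c
        bounds c∈ with ∈-filter⁻ (λ v → ¬? (v ∈? (pre ++ m ∷ mid) ∷ʳ z)) {xs = interior} c∈
        ... | c∈i , c∉ = most (∈-interior⁻ H c∈i) (λ { ≡.refl → c∉ (last∈ (pre ++ m ∷ mid)) }) , least (∈-interior⁻ H c∈i)
      ...   | mid′ , perm , le , same = record
        { path      = p
        ; layout    = record
          { start-boundary = bd
          ; spine-unique   = spine-unique
          ; spine-interior = spine-interior
          ; spine-complete = spine-complete
          }
        ; least     = least
        ; chain-≤   = ≤-resp (sym (split mid′)) (sym (split mid)) (+-mono-≤ ≤-refl le)
        ; inserted  = inserted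
        ; unchanged = λ all → ≡.cong (λ l → pre ++ m ∷ l) (same (none all))
        }
        where
        ys₀ = pre ++ m ∷ mid
        ys  = pre ++ m ∷ mid′
        off? : ∀ v → Dec (v ∉ ys₀ ∷ʳ z)
        off? v = ¬? (v ∈? ys₀ ∷ʳ z)
        offs = filter off? interior
        split : ∀ l → ∑ (stretch f) (pairs b (pre ++ m ∷ l) z) ≈ ∑ (stretch f) (pairs b pre m) + ∑ (stretch f) (pairs m l z)
        split l = trans (reflexive (≡.cong (∑ (stretch f)) (pairs-++ b pre m l z))) (∑-++ _ (pairs b pre m) _)
        ys↭ : ys ∷ʳ z ↭ offs ++ (ys₀ ∷ʳ z)
        ys↭ = begin
          ys ∷ʳ z                                ≡⟨ ≡.cong (_∷ʳ z) (++-assoc pre [ m ] mid′) ⟨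
          ((pre ∷ʳ m) ++ mid′) ∷ʳ z              ↭⟨ ↭-++⁺ʳ [ z ] (↭-++⁺ˡ (pre ∷ʳ m) perm) ⟩
          ((pre ∷ʳ m) ++ (offs ++ mid)) ∷ʳ z     ↭⟨ ↭-++⁺ʳ [ z ] (shifts (pre ∷ʳ m) offs) ⟩
          (offs ++ ((pre ∷ʳ m) ++ mid)) ∷ʳ z     ≡⟨ ≡.cong (λ l → (offs ++ l) ∷ʳ z) (++-assoc pre [ m ] mid) ⟩
          (offs ++ ys₀) ∷ʳ z                     ≡⟨ ++-assoc offs ys₀ [ z ] ⟩
          offs ++ (ys₀ ∷ʳ z)                     ∎
          where open PermutationReasoning
        path-tail-unique : Unique (ys₀ ∷ʳ z)
        path-tail-unique with path-unique p
        ... | _ ∷ u = u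
        spine-unique : Unique (ys ∷ʳ z)
        spine-unique = unique-resp-↭ (↭-sym ys↭) (Uniqueₚ.++⁺ (Uniqueₚ.filter⁺ off? (interior-unique H)) path-tail-unique
          λ (q , r) → proj₂ (∈-filter⁻ off? {xs = interior} q) r)
        spine-interior : ∀ {v} → v ∈ ys ∷ʳ z → IsInterior v
        spine-interior v∈ with ∈-++⁻ offs (∈-resp-↭ ys↭ v∈)
        ... | inj₁ q = ∈-interior⁻ H (proj₁ (∈-filter⁻ off? {xs = interior} q))
        ... | inj₂ q with ∈-∷ʳ⁻ ys₀ q
        ...   | inj₁ r      = inner-interior p r
        ...   | inj₂ ≡.refl = iz
        spine-complete : ∀ {v} → IsInterior v → v ∈ ys ∷ʳ z
        spine-complete {v} i with v ∈? ys₀ ∷ʳ z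
        ... | yes v∈ = ∈-resp-↭ (↭-sym ys↭) (∈-++⁺ʳ offs v∈)
        ... | no v∉  = ∈-resp-↭ (↭-sym ys↭) (∈-++⁺ˡ (∈-filter⁺ off? (∈-interior⁺ H i) v∉))
        -- Insertion takes place after `m`, so the predecessor of an inserted vertex is `m` or a
        -- later vertex of the chain, never `b`.
        inserted : ∀ {c v} → IsInterior c → c ∉ ys₀ ∷ʳ z → (v , c) ∈ pairs b ys z → v ∈ ys
        inserted {c} {v} i c∉ q with ∈-++⁻ (pairs b pre m) (≡.subst ((v , c) ∈_) (pairs-++ b pre m mid′ z) q)
        ... | inj₂ r = ∈-++⁺ʳ pre (∈-pairs₁ mid′ r)
        ... | inj₁ r with ∈-∷ʳ⁻ pre (∈-pairs₂ pre r)
        ...   | inj₁ c∈     = ⊥-elim (c∉ (∈-++⁺ˡ (∈-++⁺ˡ c∈)))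
        ...   | inj₂ ≡.refl = ⊥-elim (c∉ (∈-++⁺ˡ (∈-++⁺ʳ pre (here ≡.refl))))
        none : (∀ {c} → IsInterior c → c ∈ ys₀ ∷ʳ z) → offs ≡ []
        none all = filter-none off? (All.tabulate λ c∈ c∉ → c∉ (all (∈-interior⁻ H c∈)))

      -- The maximum is taken over the interior vertices other than `z`: this makes `m` differ from
      -- `z` even if all interior values coincide, and a path between them needs two vertices.
      rearrange : Rearrangement f
      rearrange with interior in e | someInterior
      ... | []     | v , i with ≡.subst (v ∈_) e (∈-interior⁺ H i)
      ...   | ()
      rearrange | x ∷ xs | _ with argmin f cmp x xs
      ... | z , z∈ , least with filter (λ v → ¬? (v ≟ᶠ z)) (x ∷ xs) in e′
      ...   | [] = rearrange-single (inside z∈) only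
        where
        inside : ∀ {v} → v ∈ x ∷ xs → IsInterior v
        inside = ∈-interior⁻ H ∘ ≡.subst (_ ∈_) (≡.sym e)
        only : ∀ {u} → IsInterior u → u ≡ z
        only {u} i with u ≟ᶠ z
        ... | yes q = q
        ... | no u≢z with ≡.subst (u ∈_) e′ (∈-filter⁺ (λ v → ¬? (v ≟ᶠ z)) (≡.subst (u ∈_) e (∈-interior⁺ H i)) u≢z)
        ...   | ()
      ...   | y ∷ ys with argmax f cmp y ys
      ...     | m , m∈ , most = rearrange-via (inside (proj₁ mz)) (inside z∈) (proj₂ mz) (least ∘ listed)
                (λ i u≢z → most (≡.subst (_ ∈_) e′ (∈-filter⁺ (λ v → ¬? (v ≟ᶠ z)) (listed i) u≢z)))
        where
        inside : ∀ {v} → v ∈ x ∷ xs → IsInterior v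
        inside = ∈-interior⁻ H ∘ ≡.subst (_ ∈_) (≡.sym e)
        listed : ∀ {v} → IsInterior v → v ∈ x ∷ xs
        listed i = ≡.subst (_ ∈_) e (∈-interior⁺ H i)
        mz = ∈-filter⁻ (λ v → ¬? (v ≟ᶠ z)) {xs = x ∷ xs} (≡.subst (m ∈_) (≡.sym e′) m∈)

    module Tightness {ν f} (ground : IsGroundState H ν f) (r : Rearrangement f) where

      open IsGroundState ground
      open GroundState H ground
      open Rearrangement r
      open IsLayout layout

      leaves = otherLeaves H b

      attachment : Fin n → Fin n
      attachment l = proj₁ (neighbour l)

      attachment-interior : ∀ {l} → l ∈ leaves → IsInterior (attachment l)
      attachment-interior {l} l∈ = boundary-neighbour-interior (proj₁ (∈-otherLeaves⁻ H l∈)) (proj₂ (neighbour l))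

      z-interior : IsInterior z
      z-interior = spine-interior (last∈ ys)

      inner-path : ∀ {v} → v ∈ ys₀ ∷ʳ z → IsInterior v
      inner-path v∈ with ∈-∷ʳ⁻ ys₀ v∈
      ... | inj₁ p      = inner-interior path p
      ... | inj₂ ≡.refl = z-interior

      -- The edges of the tree that enter the comparison, each once: those of the path and the edge
      -- at each leaf other than `b`.
      kept : List (Fin n × Fin n)
      kept = pairs b ys₀ z ++ map (λ l → attachment l , l) leaves

      ∈-kept⁻ : ∀ {u v} → (u , v) ∈ kept → (u , v) ∈ pairs b ys₀ z ⊎ (v ∈ leaves × u ≡ attachment v)
      ∈-kept⁻ p with ∈-++⁻ (pairs b ys₀ z) p
      ... | inj₁ q = inj₁ q
      ... | inj₂ q with ∈-map⁻ (λ l → attachment l , l) q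
      ...   | _ , l∈ , ≡.refl = inj₂ (l∈ , ≡.refl)

      not-leaf : ∀ {v} → IsInterior v → v ∉ leaves
      not-leaf i v∈ = interior-not-boundary i (proj₁ (∈-otherLeaves⁻ H v∈))

      leaf-not-first : ∀ {l v} → l ∈ leaves → (l , v) ∉ pairs b ys₀ z
      leaf-not-first l∈ p with ∈-pairs₁ ys₀ p
      ... | here ≡.refl = proj₂ (∈-otherLeaves⁻ H l∈) ≡.refl
      ... | there l∈ys  = not-leaf (inner-interior path l∈ys) l∈

      kept-adj : ∀ {u v} → (u , v) ∈ kept → Adj u v
      kept-adj {u} {v} p with ∈-kept⁻ p
      ... | inj₁ q            = path-pairs path q
      ... | inj₂ (_ , ≡.refl) = adj-sym (proj₂ (neighbour v))

      kept-seconds : map proj₂ kept ≡ (ys₀ ∷ʳ z) ++ leaves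
      kept-seconds = ≡.trans (map-++ proj₂ (pairs b ys₀ z) _)
        (≡.cong₂ _++_ (pairs-proj₂ b ys₀ z) (≡.trans (≡.sym (map-∘ leaves)) (map-id leaves)))

      kept-seconds-unique : Unique (map proj₂ kept)
      kept-seconds-unique = ≡.subst Unique (≡.sym kept-seconds)
        (Uniqueₚ.++⁺ (unique-tail (path-unique path)) (Uniqueₚ.filter⁺ (otherLeaf? H b) (Uniqueₚ.allFin⁺ n))
          λ (p , q) → not-leaf (inner-path p) q)
        where
        unique-tail : ∀ {x : Fin n} {xs} → Unique (x ∷ xs) → Unique xs
        unique-tail (_ ∷ u) = u

      kept-asym : ∀ {u v} → (u , v) ∈ kept → (v , u) ∉ kept
      kept-asym p q with ∈-kept⁻ p | ∈-kept⁻ q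
      ... | inj₁ p′            | inj₁ q′            = pairs-asym ys₀ (path-unique path) p′ q′
      ... | inj₁ p′            | inj₂ (u∈ , _)      = leaf-not-first u∈ p′
      ... | inj₂ (v∈ , _)      | inj₁ q′            = leaf-not-first v∈ q′
      ... | inj₂ (v∈ , ≡.refl) | inj₂ (u∈ , _)      = not-leaf (attachment-interior v∈) u∈

      kept-unique : Unique (symmetrise kept)
      kept-unique = symmetrise-unique kept-seconds-unique kept-asym

      symmetrise-kept-adj : ∀ {u v} → (u , v) ∈ symmetrise kept → Adj u v
      symmetrise-kept-adj p with ∈-symmetrise⁻ kept p
      ... | inj₁ q = kept-adj q
      ... | inj₂ q = adj-sym (kept-adj q)

      K X : Carrier
      K = ∑ (stretch f) kept
      X = ∑ (stretch f) (cometEdges b ys z leaves)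

      kept≤energy : K + K ≤ energy H f
      kept≤energy = ≤-respˡ (∑-symmetrise f kept)
        (∑-⊆ (λ {e} _ → stretch-nonNeg f e) kept-unique λ {(u , v)} p → ∈-directedEdges⁺ (symmetrise-kept-adj p))

      kept+1≤energy : ∀ {u v} → Adj u v → (u , v) ∉ symmetrise kept → stretch f (u , v) + (K + K) ≤ energy H f
      kept+1≤energy a e∉ = ≤-respˡ (+-congˡ (∑-symmetrise f kept))
        (∑-⊆ (λ {e} _ → stretch-nonNeg f e) (∉⇒All≢ e∉ ∷ kept-unique)
          λ { (here ≡.refl) → ∈-directedEdges⁺ a ; {_ , _} (there p) → ∈-directedEdges⁺ (symmetrise-kept-adj p) })

      -- As `f` vanishes at leaves, this compares squares of interior values; for `a` at least `c`,
      -- the difference of the squares is `(a - c) * (a - c)` plus twice `(a - c) * c`.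
      leaf-≤ : ∀ {l} → l ∈ leaves → stretch f (z , l) ≤ stretch f (attachment l , l)
      leaf-≤ {l} l∈ = ≤-resp (sq-cong (drop z)) (sq-cong (drop (attachment l)))
        (≤-by (solve 2 (λ a c → a :* a :- c :* c := (a :- c) :* (a :- c) :+ ((a :- c) :* c :+ (a :- c) :* c)) refl (f (attachment l)) (f z))
          (+-nonNeg (sq-nonNeg _) (+-nonNeg p p)))
        where
        p = *-nonNeg (diff-nonNeg (least (attachment-interior l∈))) (nonNeg z)
        drop : ∀ u → f u ≈ f u - f l
        drop u = sym (minus-zero (zero-boundary (proj₁ (∈-otherLeaves⁻ H l∈))))

      X≤K : X ≤ K
      X≤K = ≤-resp (sym (∑-++ _ (pairs b ys z) _)) (sym (∑-++ _ (pairs b ys₀ z) _)) (+-mono-≤ chain-≤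
        (≤-resp (reflexive (≡.sym (∑-map _ _ leaves))) (reflexive (≡.sym (∑-map _ _ leaves))) (∑-mono-≤ leaves leaf-≤)))

      X≤energy : X + X ≤ energy H f
      X≤energy = ≤-trans (+-mono-≤ X≤K X≤K) kept≤energy

      -- A nonpositive eigenvalue would make the energy vanish, and the edge at `b` would then force
      -- the value 0 at an interior vertex.
      ν≰0 : ¬ (ν ≤ 0#)
      ν≰0 ν≤0 = positive≰0 (positive-interior i) (≤-reflexive (trans (sym (x-y≈0⇒x≈y (square≤0 (≤-trans
        (∑-member (λ {e} _ → stretch-nonNeg f e) (∈-directedEdges⁺ (proj₂ (neighbour b)))) energy≤0)))) (zero-boundary start-boundary)))
        where
        i = boundary-neighbour-interior start-boundary (proj₂ (neighbour b))
        νN≤0 : ν * norm² f ≤ 0#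
        νN≤0 = ≤-respʳ (zeroˡ _) (*-monoʳ-≤ (∑-nonNeg (allFin n) λ _ → sq-nonNeg _) ν≤0)
        energy≤0 : energy H f ≤ 0#
        energy≤0 = ≤-resp (sym ground-energy) (+-identityˡ 0#) (+-mono-≤ νN≤0 νN≤0)

      ν*f≰0 : ∀ {u} → IsInterior u → ¬ (ν * f u ≤ 0#)
      ν*f≰0 i le = ν≰0 (*-cancelʳ-≤0 (positive-interior i) le)

      module Tight (tight : energy H f ≤ X + X) where

        K≤X : K ≤ X
        K≤X = +-cancelˡ-≤ K (≤-trans kept≤energy (≤-trans tight (+-mono-≤ X≤K ≤-refl)))

        -- The kept edges already exhaust the energy, so a further edge has stretch 0.
        level-edge : ∀ {u v} → Adj u v → (u , v) ∉ symmetrise kept → f u ≈ f v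
        level-edge a e∉ = x-y≈0⇒x≈y (square≤0 (+-cancelʳ-≤ (K + K) (≤-trans (kept+1≤energy a e∉)
          (≤-respʳ (sym (+-identityˡ _)) (≤-trans tight (+-mono-≤ X≤K X≤K))))))

        leaf-tight : ∀ {l} → l ∈ leaves → stretch f (attachment l , l) ≤ stretch f (z , l)
        leaf-tight = ∑-tight leaves leaf-≤ (≤-resp (reflexive (∑-map _ _ leaves)) (reflexive (∑-map _ _ leaves))
          (+-cancelˡ-≤ _ (≤-trans (≤-resp (∑-++ _ (pairs b ys₀ z) _) (∑-++ _ (pairs b ys z) _) K≤X) (+-mono-≤ chain-≤ ≤-refl))))

        -- For `a ≥ c ≥ d` the square of `a - c` is at most the difference of the squares of `a - d`
        -- and `c - d`, and by `leaf-tight` that difference is nonpositive here.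
        attachment-least : ∀ {l} → l ∈ leaves → f (attachment l) ≈ f z
        attachment-least {l} l∈ = x-y≈0⇒x≈y (square≤0 (≤-trans
          (≤-by (solve 3 (λ a c d → ((a :- d) :* (a :- d) :- (c :- d) :* (c :- d)) :- (a :- c) :* (a :- c) :=
            (a :- c) :* (c :- d) :+ (a :- c) :* (c :- d)) refl (f (attachment l)) (f z) (f l)) (+-nonNeg p p))
          (≤-respʳ (-‿inverseʳ _) (+-mono-≤ (leaf-tight l∈) ≤-refl))))
          where
          p = *-nonNeg (diff-nonNeg (least (attachment-interior l∈)))
            (≤-respʳ (sym (minus-zero (zero-boundary (proj₁ (∈-otherLeaves⁻ H l∈))))) (nonNeg z))

        -- The comet enters through its neighbour lists `nbs` on the vertices of the tree and
        -- through the equation `bal`. So `f` solves two equations at each interior vertex, one for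
        -- either graph.
        module Rigidity {μ} (ν≤μ : ν ≤ μ) (nbs : Fin n → List (Fin n)) (nbs-unique : ∀ v → Unique (nbs v))
          (nbs⁻ : ∀ {v w} → w ∈ nbs v → CometEdge b ys z leaves v w)
          (nbs⁺ : ∀ {v w} → CometEdge b ys z leaves v w → w ∈ nbs v)
          (bal : ∀ {v} → IsInterior v → ∑ (λ w → f v - f w) (nbs v) ≈ μ * f v) where

          ∈-cometEdges⁻ : ∀ {u v} → (u , v) ∈ cometEdges b ys z leaves → (u , v) ∈ pairs b ys z ⊎ (u ≡ z × v ∈ leaves)
          ∈-cometEdges⁻ p with ∈-++⁻ (pairs b ys z) p
          ... | inj₁ q = inj₁ q
          ... | inj₂ q with ∈-map⁻ (z ,_) q
          ...   | _ , l∈ , ≡.refl = inj₂ (≡.refl , l∈)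

          start-neighbour : ∀ {c} → Adj b c → c ∈ ys₀ ∷ʳ z
          start-neighbour a with first ys₀
            where
            first : ∀ l → ∃[ y ] (b , y) ∈ pairs b l z
            first []      = z , here ≡.refl
            first (y ∷ _) = y , here ≡.refl
          ... | y , q with degree≡1⇒unique start-boundary a (path-pairs path q)
          ...   | ≡.refl = ∈-pairs₂ ys₀ q

          -- A vertex off the path with a leaf attached has the least value, but it
          -- was inserted strictly inside the chain, where it is a local minimum.
          off-path-no-leaf : ∀ {c l} → IsInterior c → c ∉ ys₀ ∷ʳ z → Adj c l → ¬ IsBoundary l
          off-path-no-leaf {c} {l} i c∉ a bd = ν≰0 (≤-trans ν≤μ (*-cancelʳ-≤0 (positive-interior i)
            (≤-respˡ (bal i) (∑-nonPos (nbs c) λ w∈ → ≤-respʳ (-‿inverseʳ _) (+-mono-≤ (≤-trans (≤-reflexive fc≈fz) (least (inner (nbs⁻ w∈)))) ≤-refl)))))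
            where
            l∈ : l ∈ leaves
            l∈ = ∈-otherLeaves⁺ H bd λ { ≡.refl → c∉ (start-neighbour (adj-sym a)) }
            fc≈fz : f c ≈ f z
            fc≈fz = trans (reflexive (≡.cong f (degree≡1⇒unique bd (adj-sym a) (proj₂ (neighbour l))))) (attachment-least l∈)
            -- The comet neighbours of `c` are interior: `c` is not `z`, so none of the other leaves
            -- hangs at it, and `inserted` rules out `b` as its predecessor.
            inner : ∀ {w} → CometEdge b ys z leaves c w → IsInterior w
            inner e with ∈-symmetrise⁻ (cometEdges b ys z leaves) e
            ... | inj₁ p with ∈-cometEdges⁻ p
            ...   | inj₁ q            = spine-interior (∈-pairs₂ ys q)
            ...   | inj₂ (≡.refl , _) = ⊥-elim (c∉ (last∈ ys₀))
            inner e | inj₂ p with ∈-cometEdges⁻ p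
            ...   | inj₁ q            = spine-interior (∈-++⁺ˡ (inserted i c∉ q))
            ...   | inj₂ (_ , c∈)     = ⊥-elim (not-leaf i c∈)

          -- A vertex off the path has no leaf attached, and none of its edges to interior vertices
          -- is kept. So `f` is constant around it, its Laplacian vanishes there, and `ν * f c`
          -- would be 0.
          on-path : ∀ {c} → IsInterior c → c ∈ ys₀ ∷ʳ z
          on-path {c} i with c ∈? ys₀ ∷ʳ z
          ... | yes c∈ = c∈
          ... | no c∉  = ⊥-elim (ν*f≰0 i (≤-respˡ (eigen i) (∑-nonPos (neighbours c) λ {v} v∈ → level (∈-neighbours⁻ v∈) (partition v))))
            where
            not-kept : ∀ {v} → IsInterior v → (c , v) ∉ symmetrise kept
            not-kept j e with ∈-symmetrise⁻ kept e
            ... | inj₁ p with ∈-kept⁻ p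
            ...   | inj₂ (v∈ , _) = not-leaf j v∈
            ...   | inj₁ q with ∈-pairs₁ ys₀ q
            ...     | here ≡.refl = interior-not-boundary i start-boundary
            ...     | there c∈    = c∉ (∈-++⁺ˡ c∈)
            not-kept j e | inj₂ p with ∈-kept⁻ p
            ...   | inj₁ q        = c∉ (∈-pairs₂ ys₀ q)
            ...   | inj₂ (c∈ , _) = not-leaf i c∈
            level : ∀ {v} → Adj c v → IsBoundary v ⊎ IsInterior v → f c - f v ≤ 0#
            level a (inj₁ bd) = ⊥-elim (off-path-no-leaf i c∉ a bd)
            level a (inj₂ j)  = ≤-reflexive (trans (+-congʳ (level-edge a (not-kept j))) (-‿inverseʳ _))

          chain≡path : ys ≡ ys₀
          chain≡path = unchanged on-path

          spine-adj : ∀ {u v} → (u , v) ∈ pairs b ys z → Adj u v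
          spine-adj p = path-pairs path (≡.subst (λ l → _ ∈ pairs b l z) chain≡path p)

          -- Away from z the tree has at least the comet's edges, so a further leaf
          -- would make the Laplacian there too large.
          attached-to-z : ∀ {l} → l ∈ leaves → attachment l ≡ z
          attached-to-z {l} l∈ with attachment l ≟ᶠ z
          ... | yes e  = e
          -- From `below`, `f u + ν * f u ≤ f u + μ * f u ≤ ν * f u`, so `f u` would be nonpositive.
          ... | no u≢z = ⊥-elim (positive≰0 (positive-interior i) (+-cancelʳ-≤ (ν * f u) (≤-respʳ (sym (+-identityˡ _))
              (≤-trans (+-mono-≤ ≤-refl (*-monoʳ-≤ (nonNeg u) ν≤μ)) (≤-trans below (≤-reflexive (eigen i)))))))
            where
            u = attachment l
            i = attachment-interior l∈
            bd = proj₁ (∈-otherLeaves⁻ H l∈)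
            comet-adj : ∀ {w} → CometEdge b ys z leaves u w → Adj u w
            comet-adj e with ∈-symmetrise⁻ (cometEdges b ys z leaves) e
            ... | inj₁ p with ∈-cometEdges⁻ p
            ...   | inj₁ q       = spine-adj q
            ...   | inj₂ (e , _) = ⊥-elim (u≢z e)
            comet-adj e | inj₂ p with ∈-cometEdges⁻ p
            ...   | inj₁ q        = adj-sym (spine-adj q)
            ...   | inj₂ (_ , u∈) = ⊥-elim (not-leaf i u∈)
            l∉ : l ∉ nbs u
            l∉ l∈nbs with ∈-symmetrise⁻ (cometEdges b ys z leaves) (nbs⁻ l∈nbs)
            ... | inj₁ p with ∈-cometEdges⁻ p
            ...   | inj₁ q       = not-leaf (spine-interior (∈-pairs₂ ys q)) l∈
            ...   | inj₂ (e , _) = u≢z e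
            l∉ l∈nbs | inj₂ p with ∈-cometEdges⁻ p
            ...   | inj₂ (_ , u∈) = not-leaf i u∈
            ...   | inj₁ q        = leaf-not-first l∈ (≡.subst (λ l′ → _ ∈ pairs b l′ z) chain≡path q)
            xs = l ∷ nbs u
            sub : ∀ {w} → w ∈ xs → w ∈ neighbours u
            sub (here ≡.refl) = ∈-neighbours⁺ (adj-sym (proj₂ (neighbour l)))
            sub (there w∈)    = ∈-neighbours⁺ (comet-adj (nbs⁻ w∈))
            complement = ⊆-complement (∉⇒All≢ l∉ ∷ nbs-unique u) sub
            zs = proj₁ complement
            neighbours↭ = proj₂ complement
            others-unique : Unique (xs ++ zs)
            others-unique = unique-resp-↭ neighbours↭ (neighbours-unique u)
            disjoint : ∀ {w} → w ∈ zs → w ∉ xs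
            disjoint w∈ w∈xs = separate xs others-unique w∈xs w∈
              where
              separate : ∀ (as : List (Fin n)) {bs w} → Unique (as ++ bs) → w ∈ as → w ∉ bs
              separate (a ∷ as) un       (here ≡.refl) w∈bs = unique-head un (∈-++⁺ʳ as w∈bs)
              separate (a ∷ as) (_ ∷ un) (there w∈as)  w∈bs = separate as un w∈as w∈bs
            kept⇒comet : ∀ {w} → IsInterior w → (u , w) ∈ symmetrise kept → CometEdge b ys z leaves u w
            kept⇒comet j e with ∈-symmetrise⁻ kept e
            ... | inj₁ p with ∈-kept⁻ p
            ...   | inj₁ q        = ∈-symmetrise⁺ (cometEdges b ys z leaves) (inj₁ (∈-++⁺ˡ (≡.subst (λ l′ → _ ∈ pairs b l′ z) (≡.sym chain≡path) q)))
            ...   | inj₂ (w∈ , _) = ⊥-elim (not-leaf j w∈)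
            kept⇒comet j e | inj₂ p with ∈-kept⁻ p
            ...   | inj₁ q        = ∈-symmetrise⁺ (cometEdges b ys z leaves) (inj₂ (∈-++⁺ˡ (≡.subst (λ l′ → _ ∈ pairs b l′ z) (≡.sym chain≡path) q)))
            ...   | inj₂ (u∈ , _) = ⊥-elim (not-leaf i u∈)
            -- Among the neighbours beyond `l` and those in the comet, a leaf contributes `f u`, and
            -- an interior vertex is reached by a level edge and contributes 0.
            other : ∀ {w} → w ∈ zs → IsBoundary w ⊎ IsInterior w → 0# ≤ f u - f w
            other w∈ (inj₁ wb) = ≤-respʳ (sym (minus-zero (zero-boundary wb))) (nonNeg u)
            other w∈ (inj₂ j)  = ≤-reflexive (sym (trans (+-congʳ (level-edge
              (∈-neighbours⁻ (∈-resp-↭ (↭-sym neighbours↭) (∈-++⁺ʳ xs w∈)))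
              (λ e → disjoint w∈ (there (nbs⁺ (kept⇒comet j e)))))) (-‿inverseʳ _)))
            below : f u + μ * f u ≤ lap H f u
            below = ≤-resp (+-identityʳ _) (sym (trans (∑-↭ _ neighbours↭) (∑-++ _ xs zs)))
              (+-mono-≤ (≤-reflexive (+-cong (sym (minus-zero (zero-boundary bd))) (sym (bal i))))
                (∑-nonNeg zs λ {w} w∈ → other w∈ (partition w)))

          cometLayout : CometLayout H b ys z
          cometLayout = layout , Allₚ.++⁺ (All.tabulate λ {(u , v)} → spine-adj)
            (Allₚ.map⁺ (All.tabulate λ {l} l∈ → ≡.subst (λ w → Adj w l) (attached-to-z l∈) (adj-sym (proj₂ (neighbour l)))))

  -- Double negation commutes with quantification over a finite type, so all comparisons of values
  -- can be assumed at once when the goal is stable.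
  ¬¬-all : ∀ {n} {P : Fin n → Set} → (∀ i → ¬ ¬ P i) → ¬ ¬ (∀ i → P i)
  ¬¬-all {zero}  p k = k λ ()
  ¬¬-all {suc n} p k = p zero λ p₀ → ¬¬-all (p ∘ suc) λ ps → k λ { zero → p₀ ; (suc i) → ps i }

  module _ {n : ℕ} {G H : TreeWithBoundary n} {b ys z} (C : CometLayout G b ys z)
    (same : TreeWithBoundary.∣V₀∣ G ≡ TreeWithBoundary.∣V₀∣ H)
    {μ φ ν f} (groundG : IsGroundState G μ φ) (groundH : IsGroundState H ν f) where

    open IsGroundState groundH using (zero-boundary; positive-interior; nonNeg)

    private
      comparable : ¬ ¬ (∀ u v → f u ≤ f v ⊎ f v ≤ f u)
      comparable = ¬¬-all λ u → ¬¬-all λ v → ≤-total (f u) (f v)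

      N = norm² f

      module _ (r : Rearrangement H f) where

        open Tightness H groundH r
        open Rearrangement r using (layout)
        private
          M = layout-matching (proj₁ C) layout same
          module B = CometBound C layout (proj₁ M) (proj₁ (proj₂ M)) (proj₁ (proj₂ (proj₂ M)))
            (proj₁ (proj₂ (proj₂ (proj₂ M)))) (proj₂ (proj₂ (proj₂ (proj₂ M)))) groundG f zero-boundary

        μN≤νN : μ * N + μ * N ≤ ν * N + ν * N
        μN≤νN = ≤-trans B.comet-rayleigh (≤-respʳ (GroundState.ground-energy H groundH) X≤energy)

        -- The estimates give `μ * N + μ * N ≤ X + X ≤ energy H f`, and the energy is
        -- `ν * N + ν * N`. With `ν ≤ μ` this closes into a circle, so equality holds throughout.
        comet-when-≤ : ν ≤ μ → ∃[ b ] ∃[ ys ] ∃[ z ] CometLayout H b ys z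
        comet-when-≤ ν≤μ = _ , _ , _ , Rigidity.cometLayout ν≤μ B.cometNeighbours B.cometNeighbours-unique
            B.∈-cometNeighbours⁻ B.∈-cometNeighbours⁺ (B.balanced (≤-trans X≤energy energy≤))
          where
          νN≤μN : ν * N ≤ μ * N
          νN≤μN = *-monoʳ-≤ (∑-nonNeg (allFin n) λ _ → sq-nonNeg _) ν≤μ
          energy≤ : energy H f ≤ μ * N + μ * N
          energy≤ = ≤-respˡ (sym (GroundState.ground-energy H groundH)) (+-mono-≤ νN≤μN νN≤μN)
          open Tight (≤-trans energy≤ B.comet-rayleigh)

    faber-krahn : μ ≤ ν
    faber-krahn = ≤-stable λ k → comparable λ cmp → ≤-total μ ν λ
      { (inj₁ le)  → k le
      ; (inj₂ ν≤μ) → k (ordered (rearrange H cmp) ν≤μ) }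
      where
      -- The norm is cancelled by way of the single term `sq (f z′)`, which has an inverse.
      -- Replacing `N` by this term needs `μ - ν` nonnegative, hence the preceding case distinction.
      ordered : Rearrangement H f → ν ≤ μ → μ ≤ ν
      ordered r ν≤μ = diff-nonNeg⁻¹ (≤-respʳ (solve 2 (λ μ ν → :- (μ :- ν) := ν :- μ) refl μ ν) (neg-nonNeg
        (*-cancelʳ-≤0 (positive-* fz fz) (≤-trans (*-monoˡ-≤ (diff-nonNeg ν≤μ) (∑-member (λ _ → sq-nonNeg _) (∈-allFin z′))) small))))
        where
        open Rearrangement r using (layout) renaming (z to z′)
        fz = positive-interior (IsLayout.spine-interior layout (last∈ (Rearrangement.ys r)))
        doubled : (μ - ν) * N + (μ - ν) * N ≤ 0#
        doubled = ≤-resp (solve 3 (λ μ ν N → (μ :* N :+ μ :* N) :- (ν :* N :+ ν :* N) := (μ :- ν) :* N :+ (μ :- ν) :* N) refl μ ν N)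
          (-‿inverseʳ _) (+-mono-≤ (μN≤νN r) (≤-refl { - (ν * N + ν * N)}))
        small : (μ - ν) * N ≤ 0#
        small = +-nonPosˡ (*-nonNeg (diff-nonNeg ν≤μ) (∑-nonNeg (allFin n) λ _ → sq-nonNeg _)) doubled

    faber-krahn-rigid : ν ≤ μ → ¬ ¬ (∃[ b ] ∃[ ys ] ∃[ z ] CometLayout H b ys z)
    faber-krahn-rigid ν≤μ k = comparable λ cmp → k (comet-when-≤ (rearrange H cmp) ν≤μ)

-- Contraction by positive matrices and approximate eigenvectors

module Matrices (R : OrderedRing) {m : ℕ} where

  open OrderedRing R renaming (refl to ≈-refl; sym to ≈-sym; trans to ≈-trans)
  open OrderedRingProperties R
  open Energy R using (∑-member)

  I : List (Fin m)
  I = allFin m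

  Mat : Set
  Mat = Fin m → Fin m → Carrier

  infixl 7 _⊗_
  _⊗_ : Mat → Mat → Mat
  (X ⊗ Y) i j = ∑ (λ k → X i k * Y k j) I

  ⊗-assoc : ∀ X Y Z i j → ((X ⊗ Y) ⊗ Z) i j ≈ (X ⊗ (Y ⊗ Z)) i j
  ⊗-assoc X Y Z i j = ≈-trans (∑-cong I λ {k} _ → *-distribʳ-∑ (λ l → X i l * Y l k) (Z k j) I)
    (≈-trans (∑-swap (λ k l → (X i l * Y l k) * Z k j) I I)
      (∑-cong I λ {l} _ → ≈-trans (∑-cong I λ _ → *-assoc _ _ _) (≈-sym (*-distribˡ-∑ (X i l) (λ k → Y l k * Z k j) I))))

  -- The exponent is shifted: `pow M n` is the power of `M` with exponent `n + 1`, so no identity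
  -- matrix occurs.
  pow : Mat → ℕ → Mat
  pow M zero    = M
  pow M (suc n) = pow M n ⊗ M

  pow-commutes : ∀ M P → (∀ i j → (M ⊗ P) i j ≈ (P ⊗ M) i j) → ∀ n i j → (M ⊗ pow P n) i j ≈ (pow P n ⊗ M) i j
  pow-commutes M P c zero    i j = c i j
  pow-commutes M P c (suc n) i j =
    ≈-trans (≈-sym (⊗-assoc M (pow P n) P i j))
    (≈-trans (∑-cong I λ _ → *-congʳ (pow-commutes M P c n i _))
    (≈-trans (⊗-assoc (pow P n) M P i j)
    (≈-trans (∑-cong I λ {k} _ → *-congˡ (c k j))
    (≈-sym (⊗-assoc (pow P n) P M i j)))))

  module Contraction (P : Mat) {B β : Carrier} (B*β : B * β ≈ 1#)
    (1≤P : ∀ i j → 1# ≤ P i j) (P≤B : ∀ i j → P i j ≤ B) (0≤β : 0# ≤ β) where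

    -- Here `c` is the ratio of the sums of `a` and `z`. The excess `a k - lo * z k` is nonnegative
    -- with total `(c - lo) * Z`; entries of `P` that are at least 1 do not diminish it, and entries
    -- at most `B` bound `z′` by `Z * B`. So in every column the lower bound rises by
    -- `β * (c - lo)`.
    raise : ∀ (a z : Fin m → Carrier) {y} lo → 0# ≤ y → ∑ z I * y ≈ 1# → (∀ k → 0# ≤ z k) → (∀ k → lo * z k ≤ a k) →
      0# ≤ ∑ a I * y - lo × (∀ l → (lo + β * (∑ a I * y - lo)) * ∑ (λ k → z k * P k l) I ≤ ∑ (λ k → a k * P k l) I)
    raise a z {y} lo 0≤y Zy 0≤z below = 0≤c-lo , final
      where
      A = ∑ a I
      Z = ∑ z I
      c = A * y
      slack : ∑ (λ k → a k - lo * z k) I ≈ A - lo * Z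
      slack = ≈-trans (∑-distrib-+ a (λ k → - (lo * z k)) I)
        (+-congˡ (≈-trans (∑-neg (λ k → lo * z k) I) (-‿cong (≈-sym (*-distribˡ-∑ lo z I)))))
      c-lo : (c - lo) ≈ (A - lo * Z) * y
      c-lo = ≈-trans (+-congˡ (-‿cong (≈-trans (≈-sym (*-identityʳ lo)) (*-congˡ (≈-sym Zy)))))
        (solve 4 (λ A y l Z → A :* y :- l :* (Z :* y) := (A :- l :* Z) :* y) ≈-refl A y lo Z)
      c-lo-Z : (c - lo) * Z ≈ A - lo * Z
      c-lo-Z = ≈-trans (*-congʳ c-lo) (≈-trans (solve 3 (λ d y Z → (d :* y) :* Z := d :* (Z :* y)) ≈-refl (A - lo * Z) y Z)
        (≈-trans (*-congˡ Zy) (*-identityʳ _)))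
      0≤c-lo : 0# ≤ c - lo
      0≤c-lo = ≤-respʳ (≈-sym c-lo) (*-nonNeg (≤-respʳ slack (∑-nonNeg I λ {k} _ → diff-nonNeg (below k))) 0≤y)
      final : ∀ l → (lo + β * (c - lo)) * ∑ (λ k → z k * P k l) I ≤ ∑ (λ k → a k * P k l) I
      final l = ≤-trans (≤-reflexive (solve 4 (λ l b d w → (l :+ b :* d) :* w := l :* w :+ d :* (b :* w)) ≈-refl lo β (c - lo) z′))
        (≤-trans (+-mono-≤ (≤-refl {lo * z′}) (≤-respʳ c-lo-Z (*-monoˡ-≤ 0≤c-lo βz′≤Z)))
          (≤-trans (+-mono-≤ (≤-refl {lo * z′}) (≤-respˡ slack spread))
            (≤-reflexive (solve 2 (λ u v → u :+ (v :- u) := v) ≈-refl (lo * z′) a′))))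
        where
        z′ = ∑ (λ k → z k * P k l) I
        a′ = ∑ (λ k → a k * P k l) I
        βz′≤Z : β * z′ ≤ Z
        βz′≤Z = ≤-respʳ (≈-trans (solve 3 (λ b Z B → b :* (Z :* B) := Z :* (B :* b)) ≈-refl β Z B) (≈-trans (*-congˡ B*β) (*-identityʳ Z)))
          (*-monoˡ-≤ 0≤β (≤-respʳ (≈-sym (*-distribʳ-∑ z B I)) (∑-mono-≤ I λ {k} _ → *-monoˡ-≤ (0≤z k) (P≤B k l))))
        spread : ∑ (λ k → a k - lo * z k) I ≤ a′ - lo * z′
        spread = ≤-trans (∑-mono-≤ I λ {k} _ → ≤-respˡ (*-identityʳ _) (*-monoˡ-≤ (diff-nonNeg (below k)) (1≤P k l)))
          (≤-reflexive (≈-trans (∑-cong I λ {k} _ → solve 4 (λ a l z p → (a :- l :* z) :* p := a :* p :+ (:- (l :* (z :* p)))) ≈-refl (a k) lo (z k) (P k l))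
            (≈-trans (∑-distrib-+ (λ k → a k * P k l) _ I) (+-congˡ (≈-trans (∑-neg _ I) (-‿cong (≈-sym (*-distribˡ-∑ lo (λ k → z k * P k l) I))))))))

    -- This is `raise` for the negated row and the bound `- hi`.
    lower : ∀ (a z : Fin m → Carrier) {y} hi → 0# ≤ y → ∑ z I * y ≈ 1# → (∀ k → 0# ≤ z k) → (∀ k → a k ≤ hi * z k) →
      0# ≤ hi - ∑ a I * y × (∀ l → ∑ (λ k → a k * P k l) I ≤ (hi - β * (hi - ∑ a I * y)) * ∑ (λ k → z k * P k l) I)
    lower a z {y} hi 0≤y Zy 0≤z above = ≤-respʳ flip (proj₁ raised) , λ l →
      negate (≤-resp (≈-trans (*-congʳ (+-congˡ (*-congˡ flip))) (solve 4 (λ h b d w → ((:- h) :+ b :* d) :* w := :- ((h :- b :* d) :* w)) ≈-refl hi β _ _))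
        (≈-trans (∑-cong I λ {k} _ → solve 2 (λ a p → (:- a) :* p := :- (a :* p)) ≈-refl (a k) (P k l)) (∑-neg _ I)) (proj₂ raised l))
      where
      negate : ∀ {u v} → - u ≤ - v → v ≤ u
      negate {u} {v} p = diff-nonNeg⁻¹ (≤-respʳ (solve 2 (λ u v → (:- v) :- (:- u) := u :- v) ≈-refl u v) (diff-nonNeg p))
      raised = raise (λ k → - a k) z {y} (- hi) 0≤y Zy 0≤z λ k → diff-nonNeg⁻¹
        (≤-respʳ (solve 3 (λ h z a → h :* z :- a := (:- a) :- (:- h) :* z) ≈-refl hi (z k) (a k)) (diff-nonNeg (above k)))
      flip : ∑ (λ k → - a k) I * y - (- hi) ≈ hi - ∑ a I * y
      flip = ≈-trans (+-congʳ (*-congʳ (∑-neg a I))) (solve 3 (λ A y h → (:- A) :* y :- (:- h) := h :- A :* y) ≈-refl (∑ a I) y hi)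

  *-cancelʳ-≤ : ∀ {x y z} → Positive z → x * z ≤ y * z → x ≤ y
  *-cancelʳ-≤ {x} {y} {z} pos p = diff-nonNeg⁻¹ (≤-respʳ (solve 2 (λ x y → :- (x :- y) := y :- x) ≈-refl x y) (neg-nonNeg
    (*-cancelʳ-≤0 pos (≤-respˡ (solve 3 (λ x y z → (x :* z) :- (y :* z) := (x :- y) :* z) ≈-refl x y z)
      (≤-respʳ (-‿inverseʳ (y * z)) (+-mono-≤ p (≤-refl { - (y * z)})))))))

  -- If M commutes with q, and every column of q is proportional to v up to
  -- a relative error g, then v is an eigenvector of M up to an error C g.
  module ApproximateEigenvector (M q : Mat) (v lo hi : Fin m → Carrier) {g g₀ : Carrier} (o : Fin m)
    (0≤M : ∀ i j → 0# ≤ M i j) (0≤q : ∀ i j → 0# ≤ q i j) (0≤v : ∀ i → 0# ≤ v i)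
    (0≤g : 0# ≤ g) (g≤g₀ : g ≤ g₀)
    (commute : ∀ i j → (M ⊗ q) i j ≈ (q ⊗ M) i j)
    (hi≈ : ∀ i → hi i ≈ lo i + g) (lo≤v : ∀ i → lo i ≤ v i) (v≤hi : ∀ i → v i ≤ hi i)
    (below : ∀ i j → lo i * q o j ≤ q i j) (above : ∀ i j → q i j ≤ hi i * q o j)
    (Z⁺ : Positive (q o o)) where

    private
      Z = q o o

    image : Fin m → Carrier
    image i = ∑ (λ j → M i j * v j) I

    rowSum : Fin m → Carrier
    rowSum i = ∑ (M i) I

    -- Collects the coefficients of `g` in the two estimates below. In the quadratic term one factor
    -- `g` is replaced by its bound `g₀`, so that the constant stays the same while `g` tends to 0.
    constant : Fin m → Carrier
    constant i = rowSum i + image o + g₀ * rowSum o + v i * rowSum o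

    private
      up : ∀ i j → q i j ≤ (v i + g) * q o j
      up i j = ≤-trans (above i j) (*-monoʳ-≤ (0≤q o j) (≤-respˡ (≈-sym (hi≈ i)) (+-mono-≤ (lo≤v i) ≤-refl)))

      down : ∀ i j → v i * q o j ≤ q i j + g * q o j
      down i j = ≤-trans (*-monoʳ-≤ (0≤q o j) (≤-respʳ (hi≈ i) (v≤hi i)))
        (≤-respˡ (≈-sym (distribʳ (q o j) (lo i) g)) (+-mono-≤ (below i j) ≤-refl))

      -- These entries are estimated twice: directly, through column `o` of `q`, and after
      -- commuting, through row `i` of `q`.
      W : Fin m → Carrier
      W i = (M ⊗ q) i o

      W-up : ∀ i → W i ≤ (v i + g) * W o
      W-up i = ≤-resp (≈-sym (commute i o)) (*-congˡ (≈-sym (commute o o))) (≤-respʳ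
        (≈-trans (∑-cong I λ _ → *-assoc _ _ _) (≈-sym (*-distribˡ-∑ (v i + g) (λ k → q o k * M k o) I)))
        (∑-mono-≤ I λ {k} _ → *-monoʳ-≤ (0≤M k o) (up i k)))

      W-down : ∀ i → v i * W o ≤ W i + g * W o
      W-down i = ≤-resp (*-congˡ (≈-sym (commute o o))) (+-cong (≈-sym (commute i o)) (*-congˡ (≈-sym (commute o o)))) (≤-resp
        (≈-trans (∑-cong I λ _ → *-assoc _ _ _) (≈-sym (*-distribˡ-∑ (v i) (λ k → q o k * M k o) I)))
        (≈-trans (∑-cong I λ _ → distribʳ _ _ _) (≈-trans (∑-distrib-+ (λ k → q i k * M k o) (λ k → (g * q o k) * M k o) I)
          (+-congˡ (≈-trans (∑-cong I λ _ → *-assoc _ _ _) (≈-sym (*-distribˡ-∑ g (λ k → q o k * M k o) I))))))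
        (∑-mono-≤ I λ {k} _ → *-monoʳ-≤ (0≤M k o) (down i k)))

      W≤X : ∀ i → W i ≤ (image i + g * rowSum i) * Z
      W≤X i = ≤-respʳ
        (≈-trans (∑-cong I λ {j} _ → solve 4 (λ M v g Z → M :* ((v :+ g) :* Z) := (M :* v :+ g :* M) :* Z) ≈-refl (M i j) (v j) g Z)
          (≈-trans (≈-sym (*-distribʳ-∑ (λ j → M i j * v j + g * M i j) Z I))
            (*-congʳ (≈-trans (∑-distrib-+ (λ j → M i j * v j) (λ j → g * M i j) I) (+-congˡ (≈-sym (*-distribˡ-∑ g (M i) I)))))))
        (∑-mono-≤ I λ {j} _ → *-monoˡ-≤ (0≤M i j) (up j o))

      X≤W : ∀ i → image i * Z ≤ W i + (g * rowSum i) * Z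
      X≤W i = ≤-resp (≈-sym (*-distribʳ-∑ (λ j → M i j * v j) Z I))
        (≈-trans (∑-distrib-+ (λ j → M i j * q j o) (λ j → (g * M i j) * Z) I)
          (+-congˡ (≈-trans (≈-sym (*-distribʳ-∑ (λ j → g * M i j) Z I)) (*-congʳ (≈-sym (*-distribˡ-∑ g (M i) I))))))
        (∑-mono-≤ I λ {j} _ → ≤-resp (≈-sym (*-assoc _ _ _))
          (solve 4 (λ M q g Z → M :* (q :+ g :* Z) := M :* q :+ (g :* M) :* Z) ≈-refl (M i j) (q j o) g Z)
          (*-monoˡ-≤ (0≤M i j) (down j o)))

      0≤Z : 0# ≤ Z
      0≤Z = 0≤q o o

      spare : 0# ≤ (g * (g₀ - g)) * (rowSum o * Z)
      spare = *-nonNeg (*-nonNeg 0≤g (diff-nonNeg g≤g₀)) (*-nonNeg (∑-nonNeg I λ {j} _ → 0≤M o j) 0≤Z)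

    image≤ : ∀ i → image i ≤ v i * image o + g * constant i
    image≤ i = *-cancelʳ-≤ Z⁺ (≤-trans (X≤W i) (≤-trans (+-mono-≤ (W-up i) ≤-refl)
      (≤-trans (+-mono-≤ (*-monoˡ-≤ (≤-respˡ (+-identityˡ 0#) (+-mono-≤ (0≤v i) 0≤g)) (W≤X o)) ≤-refl)
        (≤-by (solve 7 (λ v g g₀ X r s Z → (v :* X :+ g :* (s :+ X :+ g₀ :* r :+ v :* r)) :* Z :- ((v :+ g) :* ((X :+ g :* r) :* Z) :+ (g :* s) :* Z) := (g :* (g₀ :- g)) :* (r :* Z))
          ≈-refl (v i) g g₀ (image o) (rowSum o) (rowSum i) Z) spare))))

    ≤image : ∀ i → v i * image o ≤ image i + g * constant i
    ≤image i = *-cancelʳ-≤ Z⁺ (≤-respˡ (≈-sym (*-assoc _ _ _)) (≤-trans (*-monoˡ-≤ (0≤v i) (X≤W o))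
      (≤-respˡ (≈-sym (distribˡ (v i) _ _)) (≤-trans (+-mono-≤ (≤-trans (W-down i) (+-mono-≤ (W≤X i) (*-monoˡ-≤ 0≤g (W≤X o)))) ≤-refl)
        (≤-by (solve 8 (λ v g g₀ X r s Z Y → (Y :+ g :* (s :+ X :+ g₀ :* r :+ v :* r)) :* Z :- ((Y :+ g :* s) :* Z :+ g :* ((X :+ g :* r) :* Z) :+ v :* ((g :* r) :* Z)) := (g :* (g₀ :- g)) :* (r :* Z))
          ≈-refl (v i) g g₀ (image o) (rowSum o) (rowSum i) Z (image i)) spare)))))

-- The Dirichlet matrix as the Laplacian on functions vanishing at the leaves

module InteriorIndex {n : ℕ} (T : TreeWithBoundary n) where

  open TreeWithBoundary T
  open TreePaths T

  vertex : Fin ∣V₀∣ → Fin n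
  vertex = lookup interior

  vertex-interior : ∀ i → IsInterior (vertex i)
  vertex-interior i = ∈-interior⁻ T (∈-lookup {xs = interior} i)

  vertex-injective : ∀ {i j} → vertex i ≡ vertex j → i ≡ j
  vertex-injective = lookup-injective (interior-unique T) _ _

  position : ∀ {u} → IsInterior u → Fin ∣V₀∣
  position i = index (∈-interior⁺ T i)

  vertex-position : ∀ {u} (i : IsInterior u) → vertex (position i) ≡ u
  vertex-position i = ≡.sym (Anyₚ.lookup-index (∈-interior⁺ T i))

  position-vertex : ∀ j (i : IsInterior (vertex j)) → position i ≡ j
  position-vertex j i = vertex-injective (vertex-position i)

module DirichletForm (R : OrderedRing) where

  open OrderedRing R
  open OrderedRingProperties R
  open Energy R

  private variable A : Set

  ∑-filter : ∀ {P : A → Set} (P? : Decidable P) {f : A → Carrier} xs → (∀ x → ¬ P x → f x ≈ 0#) → ∑ f (filter P? xs) ≈ ∑ f xs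
  ∑-filter P? []       z = refl
  ∑-filter P? (x ∷ xs) z with P? x
  ... | yes _ = +-congˡ (∑-filter P? xs z)
  ... | no ¬p = trans (∑-filter P? xs z) (trans (sym (+-identityˡ _)) (+-congʳ (sym (z x ¬p))))

  ∑-single : ∀ {f : A → Carrier} {u xs} → Unique xs → u ∈ xs → (∀ x → x ≢ u → f x ≈ 0#) → ∑ f xs ≈ f u
  ∑-single {f = f} {u} {xs} un u∈ z with ⊆-complement {xs = u ∷ []} {xs} ([] ∷ []) (λ { (here ≡.refl) → u∈ })
  ... | zs , p = trans (∑-↭ f p) (trans (+-congˡ (trans (∑-cong zs λ {x} x∈ → z x λ { ≡.refl → unique-head (unique-resp-↭ p un) x∈ }) (∑-zero zs))) (+-identityʳ _))

  ∑-tabulate : ∀ {m} (f : A → Carrier) (g : Fin m → A) → ∑ f (tabulate g) ≡ ∑ (f ∘ g) (allFin m)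
  ∑-tabulate {m = m} f g = ≡.trans (≡.cong (∑ f) (≡.sym (map-tabulate id g))) (∑-map f g (allFin m))

  module _ {n : ℕ} (T : TreeWithBoundary n) where

    open TreeWithBoundary T
    open TreePaths T
    open InteriorIndex T

    extend : (Fin ∣V₀∣ → Carrier) → Fin n → Carrier
    extend x u with interior? u
    ... | yes i = x (position i)
    ... | no _  = 0#

    extend-boundary : ∀ x {u} → IsBoundary u → extend x u ≈ 0#
    extend-boundary x {u} b with interior? u
    ... | yes i = ⊥-elim (interior-not-boundary i b)
    ... | no _  = refl

    extend-vertex : ∀ x j → extend x (vertex j) ≡ x j
    extend-vertex x j with interior? (vertex j)
    ... | yes i = ≡.cong x (position-vertex j i)
    ... | no k  = ⊥-elim (k (vertex-interior j))

  -- The embedding of the integers, described by the few laws that the matrix entries need; it is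
  -- later `fromℤ`.
  module _ (ζ : ℤ → Carrier) (ζ-0 : ζ (ℤ.+ 0) ≈ 0#) (ζ-suc : ∀ d → ζ (ℤ.+ suc d) ≈ 1# + ζ (ℤ.+ d))
    (ζ-- : ∀ a b → ζ (a ℤ.- b) ≈ ζ a - ζ b) where

    ζ-length : ∀ (xs : List A) y → ζ (ℤ.+ length xs) * y ≈ ∑ (λ _ → y) xs
    ζ-length []       y = trans (*-congʳ ζ-0) (zeroˡ y)
    ζ-length (x ∷ xs) y = trans (*-congʳ (ζ-suc (length xs))) (trans (distribʳ y 1# _) (+-cong (*-identityˡ y) (ζ-length xs y)))

    module _ {n : ℕ} (T : TreeWithBoundary n) where

      open TreeWithBoundary T
      open TreePaths T
      open InteriorIndex T

      laplacian-lap : ∀ (x : Fin n → Carrier) u → ∑ (λ v → ζ (laplacian u v) * x v) (allFin n) ≈ lap T x u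
      laplacian-lap x u = trans
        (∑-cong (allFin n) λ {v} _ → trans (*-congʳ (ζ-- _ _)) (solve 3 (λ a b c → (a :- b) :* c := a :* c :+ (:- (b :* c))) refl (ζ (degreeMatrix u v)) (ζ (adjacencyMatrix u v)) (x v)))
        (trans (∑-distrib-+ (λ v → ζ (degreeMatrix u v) * x v) (λ v → - (ζ (adjacencyMatrix u v) * x v)) (allFin n))
        (trans (+-cong diagonal (trans (∑-neg _ (allFin n)) (-‿cong offDiagonal)))
        (sym (trans (∑-distrib-+ (λ _ → x u) (λ v → - x v) (neighbours u)) (+-congˡ (∑-neg x (neighbours u)))))))
        where
        degree-off : ∀ v → v ≢ u → ζ (degreeMatrix u v) * x v ≈ 0#
        degree-off v v≢u with u ≟ᶠ v
        ... | yes e = ⊥-elim (v≢u (≡.sym e))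
        ... | no _  = trans (*-congʳ ζ-0) (zeroˡ _)
        degree-on : ζ (degreeMatrix u u) * x u ≈ ζ (ℤ.+ degree u) * x u
        degree-on with u ≟ᶠ u
        ... | yes _ = refl
        ... | no k  = ⊥-elim (k ≡.refl)
        diagonal : ∑ (λ v → ζ (degreeMatrix u v) * x v) (allFin n) ≈ ∑ (λ _ → x u) (neighbours u)
        diagonal = trans (∑-single (Uniqueₚ.allFin⁺ n) (∈-allFin u) degree-off) (trans degree-on (ζ-length (neighbours u) (x u)))
        not-adjacent : ∀ v → ¬ Adj u v → ζ (adjacencyMatrix u v) * x v ≈ 0#
        not-adjacent v k with adj u v
        ... | true  = ⊥-elim (k _)
        ... | false = trans (*-congʳ ζ-0) (zeroˡ _)
        adjacent : ∀ v → Adj u v → ζ (adjacencyMatrix u v) * x v ≈ x v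
        adjacent v a with adj u v
        ... | true  = trans (*-congʳ (trans (ζ-suc 0) (trans (+-congˡ ζ-0) (+-identityʳ 1#)))) (*-identityˡ _)
        ... | false = ⊥-elim a
        offDiagonal : ∑ (λ v → ζ (adjacencyMatrix u v) * x v) (allFin n) ≈ ∑ x (neighbours u)
        offDiagonal = trans (sym (∑-filter (λ v → T? (adj u v)) (allFin n) not-adjacent)) (∑-cong (neighbours u) λ {v} v∈ → adjacent v (∈-neighbours⁻ v∈))

      -- The deleted columns belong to leaves, where `x` vanishes, so they contribute nothing.
      dirichlet-lap : ∀ {x : Fin n → Carrier} → (∀ {u} → IsBoundary u → x u ≈ 0#) → ∀ i →
        ∑ (λ j → ζ (dirichlet i j) * x (vertex j)) (allFin ∣V₀∣) ≈ lap T x (vertex i)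
      dirichlet-lap {x} x0 i = trans (reflexive (≡.trans (≡.sym (∑-tabulate (λ v → ζ (laplacian (vertex i) v) * x v) vertex)) (≡.cong (∑ _) (tabulate-lookup interior))))
        (trans (∑-filter interior? (allFin n) λ v k → trans (*-congˡ (x0 (not-interior⇒boundary k))) (zeroʳ _)) (laplacian-lap x (vertex i)))

      extend-eigen : ∀ {μ x} → (∀ i → ∑ (λ j → ζ (dirichlet i j) * x j) (allFin ∣V₀∣) ≈ μ * x i) →
        ∀ {u} → IsInterior u → lap T (extend T x) u ≈ μ * extend T x u
      extend-eigen {μ} {x} eig {u} iu = ≡.subst (λ u → lap T (extend T x) u ≈ μ * extend T x u) (vertex-position iu)
        (trans (sym (dirichlet-lap (extend-boundary T x) i)) (trans (∑-cong (allFin ∣V₀∣) λ {j} _ → *-congˡ (reflexive (extend-vertex T x j)))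
          (trans (eig i) (*-congˡ (reflexive (≡.sym (extend-vertex T x i)))))))
        where i = position iu

      extend-ground : ∀ {μ x} → (∀ i → Positive (x i)) → (∀ i → ∑ (λ j → ζ (dirichlet i j) * x j) (allFin ∣V₀∣) ≈ μ * x i) →
        IsGroundState T μ (extend T x)
      extend-ground {μ} {x} pos eig = record
        { zero-boundary     = extend-boundary T x
        ; positive-interior = λ {u} i → ≡.subst Positive (≡.trans (≡.sym (extend-vertex T x (position i))) (≡.cong (extend T x) (vertex-position i))) (pos (position i))
        ; eigen             = extend-eigen eig
        }

      -- Otherwise the Rayleigh quotient of x would be less than μ.
      ground-minimal : ∀ {μ φ} → IsGroundState T μ φ → ∀ {ν δ x} → Positive δ → ν + δ ≤ μ →
        (∀ i → ∑ (λ j → ζ (dirichlet i j) * x j) (allFin ∣V₀∣) ≈ ν * x i) → ∀ i → x i ≈ 0#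
      ground-minimal {μ} ground {ν} {δ} {x} δ⁺ sep eig i = trans (reflexive (≡.sym (extend-vertex T x i)))
        (square≤0 (*-cancelʳ-≤0 δ⁺ (≤-respˡ (*-comm _ _) (≤-trans (*-monoˡ-≤ (proj₁ δ⁺) (∑-member (λ _ → sq-nonNeg _) (∈-allFin (vertex i)))) small))))
        where
        x̃ = extend T x
        N = norm² x̃
        0≤N : 0# ≤ N
        0≤N = ∑-nonNeg (allFin n) λ _ → sq-nonNeg _
        raised : (ν * N + δ * N) + (ν * N + δ * N) ≤ ν * N + ν * N
        raised = ≤-trans (+-mono-≤ one one) (≤-respʳ (eigen-energy T (extend-boundary T x) (extend-eigen eig))
          (GroundState.rayleigh T ground (extend-boundary T x)))
          where
          one : ν * N + δ * N ≤ μ * N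
          one = ≤-respˡ (distribʳ N ν δ) (*-monoʳ-≤ 0≤N sep)
        small : δ * N ≤ 0#
        small = +-nonPosˡ (*-nonNeg (proj₁ δ⁺) 0≤N) (≤-resp (solve 2 (λ a b → ((a :+ b) :+ (a :+ b)) :- (a :+ a) := b :+ b) refl (ν * N) (δ * N))
          (-‿inverseʳ _) (+-mono-≤ raised (≤-refl { - (ν * N + ν * N)})))

  scalar : ∀ {m} → Carrier → Fin m → Fin m → Carrier
  scalar c i j = if ⌊ i ≟ᶠ j ⌋ then c else 0#

  shift-eigenvector : ∀ {m} {L N : Fin m → Fin m → Carrier} {c ρ : Carrier} {v : Fin m → Carrier} → (∀ i j → N i j ≈ scalar c i j - L i j) →
    (∀ i → ∑ (λ j → N i j * v j) (allFin m) ≈ v i * ρ) → ∀ i → ∑ (λ j → L i j * v j) (allFin m) ≈ (c - ρ) * v i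
  shift-eigenvector {m} {L} {N} {c} {ρ} {v} split eig i = trans
    (∑-cong (allFin m) λ {j} _ → trans
      (solve 3 (λ s l v → l :* v := s :* v :+ (:- ((s :- l) :* v))) refl (scalar c i j) (L i j) (v j))
      (+-congˡ (-‿cong (*-congʳ (sym (split i j))))))
    (trans (∑-distrib-+ (λ j → scalar c i j * v j) (λ j → - (N i j * v j)) (allFin m))
    (trans (+-cong (trans (∑-single (Uniqueₚ.allFin⁺ m) (∈-allFin i) off) on) (trans (∑-neg _ (allFin m)) (-‿cong (eig i))))
      (solve 3 (λ c r v → c :* v :- v :* r := (c :- r) :* v) refl c ρ (v i))))
    where
    off : ∀ j → j ≢ i → scalar c i j * v j ≈ 0#
    off j j≢i with i ≟ᶠ j
    ... | yes e = ⊥-elim (j≢i (≡.sym e))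
    ... | no _  = zeroˡ _
    on : scalar c i i * v i ≈ c * v i
    on with i ≟ᶠ i
    ... | yes _ = refl
    ... | no k  = ⊥-elim (k ≡.refl)

-- The ordered rings of rationals and of Cauchy reals

module Reals where

  open ≡ using (refl; sym; trans; cong; cong₂; subst; subst₂)
  open import Data.Rational.Base using (_+_; _*_; -_; _-_; _<_; ∣_∣; 1/_)
  open D using (ℝ; mkℝ; seq; cauchy; IsCauchy; fromℚ; 0<half; half+half; eventually-bounded; bounded-*-small)

  ℚ-orderedRing : OrderedRing
  ℚ-orderedRing = record
    { commutativeRing = ℚₚ.+-*-commutativeRing
    ; _≤_         = ℚ._≤_
    ; ≤-reflexive = ℚₚ.≤-reflexive
    ; ≤-trans     = ℚₚ.≤-trans
    ; ≤-antisym   = ℚₚ.≤-antisym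
    ; +-mono-≤    = ℚₚ.+-mono-≤
    ; *-nonNeg    = λ {x} {y} p q → *-nonNeg x y p q
    ; ≤-stable    = λ {x} {y} k → stable x y k
    ; ≤-total     = λ x y k → k (ℚₚ.≤-total x y)
    ; square≤0    = λ {x} → square≤0 x
    ; 1≰0         = λ p → ℚₚ.<-irrefl refl (ℚₚ.<-≤-trans (ℚₚ.positive⁻¹ 1ℚ) p)
    }
    where
    open Algebra.Properties.Ring (CommutativeRing.ring ℚₚ.+-*-commutativeRing) using (-‿involutive)
    *-nonNeg : ∀ x y → 0ℚ ℚ.≤ x → 0ℚ ℚ.≤ y → 0ℚ ℚ.≤ x * y
    *-nonNeg x y p q = subst (ℚ._≤ x * y) (ℚₚ.*-zeroʳ x) (ℚₚ.*-monoˡ-≤-nonNeg x {{ℚ.nonNegative p}} q)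
    stable : ∀ x y → ¬ ¬ (x ℚ.≤ y) → x ℚ.≤ y
    stable x y k with x ℚₚ.≤? y
    ... | yes p = p
    ... | no p  = ⊥-elim (k p)
    <⇒≱ : ∀ {x y} → x < y → ¬ (y ℚ.≤ x)
    <⇒≱ p q = ℚₚ.<-irrefl refl (ℚₚ.<-≤-trans p q)
    pos-square : ∀ x → 0ℚ < x → 0ℚ < x * x
    pos-square x p = subst (_< x * x) (ℚₚ.*-zeroʳ x) (ℚₚ.*-monoʳ-<-pos x {{ℚ.positive p}} p)
    square≤0 : ∀ x → x * x ℚ.≤ 0ℚ → x ≡ 0ℚ
    square≤0 x p with ℚₚ.<-cmp x 0ℚ
    ... | tri≈ _ e _ = e
    ... | tri> _ _ q = ⊥-elim (<⇒≱ (pos-square x q) p)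
    ... | tri< q _ _ = ⊥-elim (<⇒≱ (subst (0ℚ <_) (trans (sym (ℚₚ.neg-distribˡ-* x (- x))) (trans (cong -_ (sym (ℚₚ.neg-distribʳ-* x x))) (-‿involutive (x * x)))) (pos-square (- x) (ℚₚ.neg-antimono-< q))) p)

  module ℚR = OrderedRingProperties ℚ-orderedRing
  open ℚR using (solve; _:=_; _:+_; _:*_; _:-_; :-_)


  p-q<e⇒p<q+e : ∀ {p q e} → p - q < e → p < q + e
  p-q<e⇒p<q+e {p} {q} {e} h = subst₂ _<_ (solve 2 (λ p q → (p :- q) :+ q := p) refl p q) (ℚₚ.+-comm e q) (ℚₚ.+-monoˡ-< q h)

  p<q+e⇒p-q<e : ∀ {p q e} → p < q + e → p - q < e
  p<q+e⇒p-q<e {p} {q} {e} h = subst (p - q <_) (solve 2 (λ q e → (q :+ e) :- q := e) refl q e) (ℚₚ.+-monoˡ-< (- q) h)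

  ∣p-q∣≡∣q-p∣ : ∀ p q → ∣ p - q ∣ ≡ ∣ q - p ∣
  ∣p-q∣≡∣q-p∣ p q = trans (sym (ℚₚ.∣-p∣≡∣p∣ (p - q))) (cong ∣_∣ (solve 2 (λ p q → :- (p :- q) := q :- p) refl p q))

  p≤∣p∣ : ∀ p → p ℚ.≤ ∣ p ∣
  p≤∣p∣ p with ℚₚ.≤-total 0ℚ p
  ... | inj₁ h = ℚₚ.≤-reflexive (sym (ℚₚ.0≤p⇒∣p∣≡p h))
  ... | inj₂ h = ℚₚ.≤-trans h (ℚₚ.0≤∣p∣ p)

  ∣p-q∣<e⇒p<q+e : ∀ {p q e} → ∣ p - q ∣ < e → p < q + e
  ∣p-q∣<e⇒p<q+e {p} {q} h = p-q<e⇒p<q+e (ℚₚ.≤-<-trans (p≤∣p∣ (p - q)) h)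

  ∣p-q∣<e⇒q<p+e : ∀ {p q e} → ∣ p - q ∣ < e → q < p + e
  ∣p-q∣<e⇒q<p+e {p} {q} {e} h = ∣p-q∣<e⇒p<q+e (subst (_< e) (∣p-q∣≡∣q-p∣ p q) h)

  between⇒∣p-q∣<e : ∀ {p q e} → p < q + e → q < p + e → ∣ p - q ∣ < e
  between⇒∣p-q∣<e {p} {q} {e} h k with ℚₚ.∣p∣≡p∨∣p∣≡-p (p - q)
  ... | inj₁ eq = subst (_< e) (sym eq) (p<q+e⇒p-q<e h)
  ... | inj₂ eq = subst (_< e) (sym (trans eq (solve 2 (λ p q → :- (p :- q) := q :- p) refl p q))) (p<q+e⇒p-q<e k)

  Eventually : (ℕ → Set) → Set
  Eventually P = ∃[ N ] (∀ n → N ℕ.≤ n → P n)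

  eventually₂ : ∀ {P Q R : ℕ → Set} → (∀ n → P n → Q n → R n) → Eventually P → Eventually Q → Eventually R
  eventually₂ h (M , p) (N , q) = M ⊔ N , λ n le → h n (p n (ℕₚ.m⊔n≤o⇒m≤o M N le)) (q n (ℕₚ.m⊔n≤o⇒n≤o M N le))

  eventually₁ : ∀ {P Q : ℕ → Set} → (∀ n → P n → Q n) → Eventually P → Eventually Q
  eventually₁ h (N , p) = N , λ n le → h n (p n le)

  ¬eventually : ∀ {P : ℕ → Set} → (∀ n → ¬ P n) → ¬ Eventually P
  ¬eventually h (N , p) = h N (p N ℕₚ.≤-refl)

  always : ∀ {P : ℕ → Set} → (∀ n → P n) → Eventually P
  always p = 0 , λ n _ → p n

  pointwise-≈ : ∀ {x y} → (∀ n → seq x n ≡ seq y n) → x D.≈ y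
  pointwise-≈ {x} {y} e ε 0<ε = always λ n → subst (_< ε) (sym (trans (cong (λ q → ∣ seq x n - q ∣) (sym (e n))) (cong ∣_∣ (ℚₚ.+-inverseʳ (seq x n))))) 0<ε

  pointwise-≤ : ∀ {x y} → (∀ n → seq x n ℚ.≤ seq y n) → x D.≤ y
  pointwise-≤ {x} {y} h ε 0<ε = always λ n → ℚₚ.≤-<-trans (h n) (subst (_< seq y n + ε) (ℚₚ.+-identityʳ (seq y n)) (ℚₚ.+-monoʳ-< (seq y n) 0<ε))

  ≈⇒≤ : ∀ {x y} → x D.≈ y → x D.≤ y
  ≈⇒≤ e ε 0<ε = eventually₁ (λ n → ∣p-q∣<e⇒p<q+e) (e ε 0<ε)

  ≈-sym : ∀ {x y} → x D.≈ y → y D.≈ x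
  ≈-sym {x} {y} e ε 0<ε = eventually₁ (λ n → subst (_< ε) (∣p-q∣≡∣q-p∣ (seq x n) (seq y n))) (e ε 0<ε)

  ≤-trans : ∀ {x y z} → x D.≤ y → y D.≤ z → x D.≤ z
  ≤-trans {x} {y} {z} p q ε 0<ε = eventually₂
    (λ n h k → ℚₚ.<-trans h (subst (seq y n + ½ * ε <_)
      (trans (ℚₚ.+-assoc (seq z n) _ _) (cong (seq z n +_) (half+half ε))) (ℚₚ.+-monoˡ-< (½ * ε) k)))
    (p _ (0<half 0<ε)) (q _ (0<half 0<ε))

  ≤-antisym : ∀ {x y} → x D.≤ y → y D.≤ x → x D.≈ y
  ≤-antisym p q ε 0<ε = eventually₂ (λ n → between⇒∣p-q∣<e) (p ε 0<ε) (q ε 0<ε)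

  ≈-trans : ∀ {x y z} → x D.≈ y → y D.≈ z → x D.≈ z
  ≈-trans {x} {y} {z} e f = ≤-antisym {x} {z} (≤-trans {x} {y} {z} (≈⇒≤ {x} {y} e) (≈⇒≤ {y} {z} f))
    (≤-trans {z} {y} {x} (≈⇒≤ {z} {y} (≈-sym {y} {z} f)) (≈⇒≤ {y} {x} (≈-sym {x} {y} e)))

  +-mono-≤ : ∀ {x y u v} → x D.≤ y → u D.≤ v → x D.+ u D.≤ y D.+ v
  +-mono-≤ {x} {y} {u} {v} p q ε 0<ε = eventually₂
    (λ n h k → subst (seq x n + seq u n <_)
      (trans (solve 3 (λ a b e → (a :+ e) :+ (b :+ e) := (a :+ b) :+ (e :+ e)) refl (seq y n) (seq v n) (½ * ε)) (cong ((seq y n + seq v n) +_) (half+half ε)))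
      (ℚₚ.+-mono-< h k))
    (p _ (0<half 0<ε)) (q _ (0<half 0<ε))

  +-cong : ∀ {x y u v} → x D.≈ y → u D.≈ v → x D.+ u D.≈ y D.+ v
  +-cong {x} {y} {u} {v} e f = ≤-antisym {x D.+ u} {y D.+ v}
    (+-mono-≤ {x} {y} {u} {v} (≈⇒≤ {x} {y} e) (≈⇒≤ {u} {v} f))
    (+-mono-≤ {y} {x} {v} {u} (≈⇒≤ {y} {x} (≈-sym {x} {y} e)) (≈⇒≤ {v} {u} (≈-sym {u} {v} f)))

  neg : ℝ → ℝ
  neg x = mkℝ (λ n → - seq x n) λ ε 0<ε → let N , c = cauchy x ε 0<ε in
    N , λ m n hm hn → subst (_< ε)
      (trans (∣p-q∣≡∣q-p∣ (seq x m) (seq x n)) (cong ∣_∣ (solve 2 (λ p q → q :- p := (:- p) :- (:- q)) refl (seq x m) (seq x n)))) (c m n hm hn)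

  neg-cong : ∀ {x y} → x D.≈ y → neg x D.≈ neg y
  neg-cong {x} {y} e ε 0<ε = eventually₁ (λ n → subst (_< ε)
    (trans (∣p-q∣≡∣q-p∣ (seq x n) (seq y n)) (cong ∣_∣ (solve 2 (λ p q → q :- p := (:- p) :- (:- q)) refl (seq x n) (seq y n))))) (e ε 0<ε)

  *-cong : ∀ {x y u v} → x D.≈ y → u D.≈ v → x D.* u D.≈ y D.* v
  *-cong {x} {y} {u} {v} e f ε 0<ε
    with eventually-bounded (cauchy x) | eventually-bounded (cauchy v)
  ... | B , 0<B , xB | C , 0<C , vC
    with bounded-*-small 0<B (0<half 0<ε) | bounded-*-small 0<C (0<half 0<ε)
  ... | δ , 0<δ , smallB | η , 0<η , smallC =
    eventually₂ combine (eventually₂ (λ n → smallB (seq x n) (seq u n - seq v n)) xB (f δ 0<δ))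
                        (eventually₂ (λ n → smallC (seq v n) (seq x n - seq y n)) vC (e η 0<η))
    where
    combine : ∀ n → ∣ seq x n * (seq u n - seq v n) ∣ < ½ * ε → ∣ seq v n * (seq x n - seq y n) ∣ < ½ * ε →
      ∣ seq x n * seq u n - seq y n * seq v n ∣ < ε
    combine n h k = begin-strict
      ∣ seq x n * seq u n - seq y n * seq v n ∣
        ≡⟨ cong ∣_∣ (solve 4 (λ a b c d → a :* b :- c :* d := a :* (b :- d) :+ d :* (a :- c)) refl (seq x n) (seq u n) (seq y n) (seq v n)) ⟩
      ∣ seq x n * (seq u n - seq v n) + seq v n * (seq x n - seq y n) ∣
        ≤⟨ ℚₚ.∣p+q∣≤∣p∣+∣q∣ (seq x n * (seq u n - seq v n)) (seq v n * (seq x n - seq y n)) ⟩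
      ∣ seq x n * (seq u n - seq v n) ∣ + ∣ seq v n * (seq x n - seq y n) ∣  <⟨ ℚₚ.+-mono-< h k ⟩
      ½ * ε + ½ * ε  ≡⟨ half+half ε ⟩
      ε ∎
      where open ℚₚ.≤-Reasoning

  -- The constructive substitute for deciding the order: at a stage where both sequences have
  -- settled within ε/8, comparing two rationals with margin ε/2 selects the alternative.
  ≤-approx : ∀ x y ε → 0ℚ < ε → Eventually (λ n → seq x n < seq y n + ε) ⊎
    ∃[ δ ] (0ℚ < δ × Eventually (λ n → seq y n + δ < seq x n))
  ≤-approx x y ε 0<ε with cauchy x _ (0<half (0<half (0<half 0<ε))) | cauchy y _ (0<half (0<half (0<half 0<ε)))
  ... | M , cx | N , cy with seq x (M ⊔ N) ℚₚ.<? seq y (M ⊔ N) + ½ * ε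
  ... | yes h = inj₁ (M ⊔ N , λ n le → begin-strict
      seq x n                                        <⟨ ∣p-q∣<e⇒p<q+e {seq x n} {seq x K} (cx n K (ℕₚ.m⊔n≤o⇒m≤o M N le) (ℕₚ.m≤m⊔n M N)) ⟩
      seq x K + ½ * (½ * (½ * ε))                    <⟨ ℚₚ.+-monoˡ-< (½ * (½ * (½ * ε))) h ⟩
      seq y K + ½ * ε + ½ * (½ * (½ * ε))            <⟨ ℚₚ.+-monoˡ-< (½ * (½ * (½ * ε))) (ℚₚ.+-monoˡ-< (½ * ε) (∣p-q∣<e⇒p<q+e {seq y K} {seq y n} (cy K n (ℕₚ.m≤n⊔m M N) (ℕₚ.m⊔n≤o⇒n≤o M N le)))) ⟩
      seq y n + ½ * (½ * (½ * ε)) + ½ * ε + ½ * (½ * (½ * ε)) ≡⟨ arrange₁ (seq y n) (½ * (½ * (½ * ε))) (½ * (½ * ε)) (half+half (½ * (½ * ε))) (½ * ε) ⟩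
      seq y n + (½ * ε + ½ * (½ * ε))                <⟨ ℚₚ.+-monoʳ-< (seq y n) (ℚₚ.+-monoʳ-< (½ * ε) half<) ⟩
      seq y n + (½ * ε + ½ * ε)                      ≡⟨ cong (seq y n +_) (half+half ε) ⟩
      seq y n + ε                                    ∎)
    where
    open ℚₚ.≤-Reasoning
    K = M ⊔ N
    half< : ½ * (½ * ε) < ½ * ε
    half< = subst₂ _<_ (ℚₚ.+-identityʳ _) (half+half (½ * ε)) (ℚₚ.+-monoʳ-< (½ * (½ * ε)) (0<half (0<half 0<ε)))
    arrange₁ : ∀ a b c → b + b ≡ c → ∀ d → a + b + d + b ≡ a + (d + c)
    arrange₁ a b c refl d = solve 3 (λ a b d → a :+ b :+ d :+ b := a :+ (d :+ (b :+ b))) refl a b d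
  ... | no h = inj₂ (η , 0<half (0<half (0<half 0<ε)) , M ⊔ N , λ n le → begin-strict
      seq y n + η                   <⟨ ℚₚ.+-monoˡ-< η (∣p-q∣<e⇒p<q+e {seq y n} {seq y K} (cy n K (ℕₚ.m⊔n≤o⇒n≤o M N le) (ℕₚ.m≤n⊔m M N))) ⟩
      seq y K + η + η               ≡⟨ arrange (seq y K) η ⟩
      (seq y K + (η + η + (η + η))) - (η + η) ≡⟨ cong (λ t → (seq y K + t) - (η + η)) (trans (cong₂ _+_ (half+half (½ * (½ * ε))) (half+half (½ * (½ * ε)))) (half+half (½ * ε))) ⟩
      (seq y K + ½ * ε) - (η + η)   ≤⟨ ℚₚ.+-monoˡ-≤ (- (η + η)) (ℚₚ.≮⇒≥ h) ⟩
      seq x K - (η + η)             <⟨ ℚₚ.+-monoˡ-< (- (η + η)) (∣p-q∣<e⇒p<q+e {seq x K} {seq x n} (cx K n (ℕₚ.m≤m⊔n M N) (ℕₚ.m⊔n≤o⇒m≤o M N le))) ⟩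
      (seq x n + η) - (η + η)       ≡⟨ solve 2 (λ a e → (a :+ e) :- (e :+ e) := a :- e) refl (seq x n) η ⟩
      seq x n - η                   <⟨ subst (seq x n - η <_) (ℚₚ.+-identityʳ (seq x n)) (ℚₚ.+-monoʳ-< (seq x n) (ℚₚ.neg-antimono-< (0<half (0<half (0<half 0<ε))))) ⟩
      seq x n                       ∎)
    where
    open ℚₚ.≤-Reasoning
    K = M ⊔ N
    η = ½ * (½ * (½ * ε))
    arrange : ∀ a e → a + e + e ≡ (a + (e + e + (e + e))) - (e + e)
    arrange = solve 2 (λ a e → a :+ e :+ e := (a :+ (e :+ e :+ (e :+ e))) :- (e :+ e)) refl

  separated⇒≰ : ∀ {x y} → ∃[ δ ] (0ℚ < δ × Eventually (λ n → seq y n + δ < seq x n)) → ¬ (x D.≤ y)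
  separated⇒≰ (δ , 0<δ , h) p = ¬eventually (λ n (u , v) → ℚₚ.<-irrefl refl (ℚₚ.<-trans u v)) (eventually₂ (λ n u v → u , v) h (p δ 0<δ))

  separated⇒≥ : ∀ {x y} → ∃[ δ ] (0ℚ < δ × Eventually (λ n → seq y n + δ < seq x n)) → y D.≤ x
  separated⇒≥ {x} {y} (δ , 0<δ , h) ε 0<ε = eventually₁ (λ n u → begin-strict
      seq y n        ≡⟨ ℚₚ.+-identityʳ (seq y n) ⟨
      seq y n + 0ℚ   <⟨ ℚₚ.+-monoʳ-< (seq y n) 0<δ ⟩
      seq y n + δ    <⟨ u ⟩
      seq x n        ≡⟨ ℚₚ.+-identityʳ (seq x n) ⟨
      seq x n + 0ℚ   <⟨ ℚₚ.+-monoʳ-< (seq x n) 0<ε ⟩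
      seq x n + ε    ∎) h
    where open ℚₚ.≤-Reasoning

  -- A separation reported by `≤-approx` would refute `x ≤ y`, against the double negation; so for
  -- each ε the other alternative holds.
  ≤-stable : ∀ {x y} → ¬ ¬ (x D.≤ y) → x D.≤ y
  ≤-stable {x} {y} k ε 0<ε = decide (≤-approx x y ε 0<ε)
    where
    decide : _ ⊎ _ → Eventually (λ n → seq x n < seq y n + ε)
    decide (inj₁ h) = h
    decide (inj₂ h) = ⊥-elim (k (separated⇒≰ {x} {y} h))

  -- If neither order held, `≤-approx` could never report a separation, since this would give
  -- `y ≤ x`; so it would prove `x ≤ y` for one ε after the other.
  ≤-total : ∀ x y → ¬ ¬ (x D.≤ y ⊎ y D.≤ x)
  ≤-total x y k = k (inj₁ λ ε 0<ε → decide ε 0<ε (≤-approx x y ε 0<ε))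
    where
    decide : ∀ ε → 0ℚ < ε → _ ⊎ _ → Eventually (λ n → seq x n < seq y n + ε)
    decide ε 0<ε (inj₁ h) = h
    decide ε 0<ε (inj₂ h) = ⊥-elim (k (inj₂ (separated⇒≥ {x} {y} h)))

  small-negative : ∀ {p e} → 0ℚ < p + e → p ℚ.≤ 0ℚ → 0ℚ < e → ∣ p ∣ < e
  small-negative {p} {e} h p≤0 0<e = subst (λ t → ∣ t ∣ < e) (ℚR.minus-zero refl)
    (between⇒∣p-q∣<e {p} {0ℚ} (ℚₚ.≤-<-trans p≤0 (subst (0ℚ <_) (sym (ℚₚ.+-identityˡ e)) 0<e)) h)

  small⇒0<+ : ∀ {p e} → ∣ p ∣ < e → 0ℚ < p + e
  small⇒0<+ {p} {e} h = ∣p-q∣<e⇒q<p+e {p} {0ℚ} (subst (λ t → ∣ t ∣ < e) (sym (ℚR.minus-zero refl)) h)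

  -- Where one approximation is not positive it is small, and the other is bounded, so the product
  -- is small in absolute value; where both are nonnegative there is nothing to estimate.
  *-nonNeg : ∀ {x y} → D.0ℝ D.≤ x → D.0ℝ D.≤ y → D.0ℝ D.≤ x D.* y
  *-nonNeg {x} {y} p q ε 0<ε
    with eventually-bounded (cauchy x) | eventually-bounded (cauchy y)
  ... | B , 0<B , xB | C , 0<C , yC
    with bounded-*-small 0<B 0<ε | bounded-*-small 0<C 0<ε
  ... | δ , 0<δ , smallB | η , 0<η , smallC =
    eventually₂ (λ n (xb , xp) (yb , yp) → combine n xb xp yb yp)
      (eventually₂ (λ n → _,_) xB (p η 0<η)) (eventually₂ (λ n → _,_) yC (q δ 0<δ))
    where
    combine : ∀ n → ∣ seq x n ∣ ℚ.≤ B → 0ℚ < seq x n + η → ∣ seq y n ∣ ℚ.≤ C → 0ℚ < seq y n + δ → 0ℚ < seq x n * seq y n + ε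
    combine n xb xp yb yp with ℚₚ.≤-total (seq x n) 0ℚ | ℚₚ.≤-total (seq y n) 0ℚ
    ... | inj₁ x≤0 | _ = small⇒0<+ (subst (λ t → ∣ t ∣ < ε) (ℚₚ.*-comm (seq y n) (seq x n)) (smallC _ _ yb (small-negative xp x≤0 0<η)))
    ... | inj₂ _ | inj₁ y≤0 = small⇒0<+ (smallB _ _ xb (small-negative yp y≤0 0<δ))
    ... | inj₂ 0≤x | inj₂ 0≤y = subst (_< seq x n * seq y n + ε) (ℚₚ.+-identityˡ 0ℚ)
      (ℚₚ.+-mono-≤-< (OrderedRing.*-nonNeg ℚ-orderedRing 0≤x 0≤y) 0<ε)

  square≤0 : ∀ {x} → x D.* x D.≤ D.0ℝ → x D.≈ D.0ℝ
  square≤0 {x} p ε 0<ε = eventually₁ (λ n h → subst (λ t → ∣ t ∣ < ε) (sym (ℚR.minus-zero refl)) (root (seq x n) (subst (seq x n * seq x n <_) (ℚₚ.+-identityˡ (ε * ε)) h)))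
      (p (ε * ε) (positive-product 0<ε))
    where
    positive-product : ∀ {e} → 0ℚ < e → 0ℚ < e * e
    positive-product {e} h = subst (_< e * e) (ℚₚ.*-zeroʳ e) (ℚₚ.*-monoʳ-<-pos e {{ℚ.positive h}} h)
    abs-square : ∀ q → q * q ≡ ∣ q ∣ * ∣ q ∣
    abs-square q = trans (sym (ℚₚ.0≤p⇒∣p∣≡p (ℚR.sq-nonNeg q))) (ℚₚ.∣p*q∣≡∣p∣*∣q∣ q q)
    root : ∀ q → q * q < ε * ε → ∣ q ∣ < ε
    root q h with ∣ q ∣ ℚₚ.<? ε
    ... | yes k = k
    ... | no k  = ⊥-elim (ℚₚ.<-irrefl refl (ℚₚ.<-≤-trans (subst (_< ε * ε) (abs-square q) h)
      (ℚₚ.≤-trans (ℚₚ.*-monoˡ-≤-nonNeg ε {{ℚ.nonNegative (ℚₚ.<⇒≤ 0<ε)}} (ℚₚ.≮⇒≥ k)) (ℚₚ.*-monoʳ-≤-nonNeg ∣ q ∣ {{ℚₚ.∣-∣-nonNeg q}} (ℚₚ.≮⇒≥ k)))))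

  ℝ-commutativeRing : CommutativeRing 0ℓ 0ℓ
  ℝ-commutativeRing = record
    { Carrier = ℝ
    ; _≈_ = D._≈_
    ; _+_ = D._+_
    ; _*_ = D._*_
    ; -_  = neg
    ; 0#  = D.0ℝ
    ; 1#  = fromℚ 1ℚ
    ; isCommutativeRing = record
      { isRing = record
        { +-isAbelianGroup = record
          { isGroup = record
            { isMonoid = record
              { isSemigroup = record
                { isMagma = record
                  { isEquivalence = record
                    { refl  = λ {x} → pointwise-≈ {x} {x} λ _ → refl
                    ; sym   = λ {x} {y} → ≈-sym {x} {y}
                    ; trans = λ {x} {y} {z} → ≈-trans {x} {y} {z}
                    }
                  ; ∙-cong = λ {x} {y} {u} {v} → +-cong {x} {y} {u} {v}
                  }
                ; assoc = λ x y z → pointwise-≈ {(x D.+ y) D.+ z} {x D.+ (y D.+ z)} λ n → ℚₚ.+-assoc (seq x n) (seq y n) (seq z n)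
                }
              ; identity = (λ x → pointwise-≈ {D.0ℝ D.+ x} {x} λ n → ℚₚ.+-identityˡ (seq x n))
                         , (λ x → pointwise-≈ {x D.+ D.0ℝ} {x} λ n → ℚₚ.+-identityʳ (seq x n))
              }
            ; inverse = (λ x → pointwise-≈ {neg x D.+ x} {D.0ℝ} λ n → ℚₚ.+-inverseˡ (seq x n))
                      , (λ x → pointwise-≈ {x D.+ neg x} {D.0ℝ} λ n → ℚₚ.+-inverseʳ (seq x n))
            ; ⁻¹-cong = λ {x} {y} → neg-cong {x} {y}
            }
          ; comm = λ x y → pointwise-≈ {x D.+ y} {y D.+ x} λ n → ℚₚ.+-comm (seq x n) (seq y n)
          }
        ; *-cong = λ {x} {y} {u} {v} → *-cong {x} {y} {u} {v}
        ; *-assoc = λ x y z → pointwise-≈ {(x D.* y) D.* z} {x D.* (y D.* z)} λ n → ℚₚ.*-assoc (seq x n) (seq y n) (seq z n)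
        ; *-identity = (λ x → pointwise-≈ {fromℚ 1ℚ D.* x} {x} λ n → ℚₚ.*-identityˡ (seq x n))
                     , (λ x → pointwise-≈ {x D.* fromℚ 1ℚ} {x} λ n → ℚₚ.*-identityʳ (seq x n))
        ; distrib = (λ x y z → pointwise-≈ {x D.* (y D.+ z)} {x D.* y D.+ x D.* z} λ n → ℚₚ.*-distribˡ-+ (seq x n) (seq y n) (seq z n))
                  , (λ x y z → pointwise-≈ {(y D.+ z) D.* x} {y D.* x D.+ z D.* x} λ n → ℚₚ.*-distribʳ-+ (seq x n) (seq y n) (seq z n))
        }
      ; *-comm = λ x y → pointwise-≈ {x D.* y} {y D.* x} λ n → ℚₚ.*-comm (seq x n) (seq y n)
      }
    }

  ℝ-orderedRing : OrderedRing
  ℝ-orderedRing = record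
    { commutativeRing = ℝ-commutativeRing
    ; _≤_         = D._≤_
    ; ≤-reflexive = λ {x} {y} → ≈⇒≤ {x} {y}
    ; ≤-trans     = λ {x} {y} {z} → ≤-trans {x} {y} {z}
    ; ≤-antisym   = λ {x} {y} → ≤-antisym {x} {y}
    ; +-mono-≤    = λ {x} {y} {u} {v} → +-mono-≤ {x} {y} {u} {v}
    ; *-nonNeg    = λ {x} {y} → *-nonNeg {x} {y}
    ; ≤-stable    = λ {x} {y} → ≤-stable {x} {y}
    ; ≤-total     = ≤-total
    ; square≤0    = λ {x} → square≤0 {x}
    ; 1≰0         = separated⇒≰ {fromℚ 1ℚ} {D.0ℝ} (½ , ℚₚ.positive⁻¹ ½ , always λ _ → ℚₚ.<-respˡ-≡ (sym (ℚₚ.+-identityˡ ½)) (ℚ.*<* (ℤ.+<+ ℕₚ.≤-refl)))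
    }

  -- The bound `c` keeps the termwise reciprocals below `1/ c`, and their differences are those of
  -- `x` times a bounded factor.
  reciprocal : ∀ x c → 0ℚ < c → (∀ n → c ℚ.≤ seq x n) → ∃[ y ] x D.* y D.≈ fromℚ 1ℚ
  reciprocal x c 0<c c≤x = mkℝ inv cauchy-inv , pointwise-≈ {x D.* mkℝ inv cauchy-inv} {fromℚ 1ℚ} *-inv
    where
    pos : ∀ n → ℚ.Positive (seq x n)
    pos n = ℚ.positive (ℚₚ.<-≤-trans 0<c (c≤x n))
    inv : ℕ → ℚ
    inv n = (1/ seq x n) {{ℚₚ.pos⇒nonZero (seq x n) {{pos n}}}}
    *-inv : ∀ n → seq x n * inv n ≡ 1ℚ
    *-inv n = ℚₚ.*-inverseʳ (seq x n) {{ℚₚ.pos⇒nonZero (seq x n) {{pos n}}}}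
    inv-nonNeg : ∀ n → 0ℚ ℚ.≤ inv n
    inv-nonNeg n = ℚR.inverse-nonNeg (ℚₚ.<⇒≤ (ℚₚ.positive⁻¹ (seq x n) {{pos n}}) , inv n , *-inv n)
    K : ℚ
    K = (1/ c) {{ℚₚ.pos⇒nonZero c {{ℚ.positive 0<c}}}}
    c*K : c * K ≡ 1ℚ
    c*K = ℚₚ.*-inverseʳ c {{ℚₚ.pos⇒nonZero c {{ℚ.positive 0<c}}}}
    0<K : 0ℚ < K
    0<K = ℚₚ.positive⁻¹ K {{ℚₚ.1/pos⇒pos c {{ℚ.positive 0<c}}}}
    inv≤K : ∀ n → inv n ℚ.≤ K
    inv≤K n = subst₂ ℚ._≤_ (trans (cong (_* inv n) c*K) (ℚₚ.*-identityˡ (inv n)))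
      (trans (trans (solve 3 (λ x k i → (x :* k) :* i := (x :* i) :* k) refl (seq x n) K (inv n)) (cong (_* K) (*-inv n))) (ℚₚ.*-identityˡ K))
      (ℚR.*-monoʳ-≤ (inv-nonNeg n) (ℚR.*-monoʳ-≤ (ℚₚ.<⇒≤ 0<K) (c≤x n)))
    bound : ∀ m n → ∣ inv m * inv n ∣ ℚ.≤ K * K
    bound m n = subst (ℚ._≤ K * K) (sym (ℚₚ.0≤p⇒∣p∣≡p (OrderedRing.*-nonNeg ℚ-orderedRing (inv-nonNeg m) (inv-nonNeg n))))
      (ℚₚ.≤-trans (ℚR.*-monoʳ-≤ (inv-nonNeg n) (inv≤K m)) (ℚR.*-monoˡ-≤ (ℚₚ.<⇒≤ 0<K) (inv≤K n)))
    difference : ∀ m n → inv m - inv n ≡ (inv m * inv n) * (seq x n - seq x m)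
    difference m n = sym (trans (solve 4 (λ a b p q → (a :* b) :* (q :- p) := (q :* b) :* a :- (p :* a) :* b) refl (inv m) (inv n) (seq x m) (seq x n))
      (cong₂ _-_ (trans (cong (_* inv m) (*-inv n)) (ℚₚ.*-identityˡ (inv m))) (trans (cong (_* inv n) (*-inv m)) (ℚₚ.*-identityˡ (inv n)))))
    cauchy-inv : IsCauchy inv
    cauchy-inv ε 0<ε =
      let 0<KK = subst (_< K * K) (ℚₚ.*-zeroʳ K) (ℚₚ.*-monoʳ-<-pos K {{ℚ.positive 0<K}} 0<K)
          δ , 0<δ , small = bounded-*-small 0<KK 0<ε
          N , c = cauchy x δ 0<δ
      in N , λ m n hm hn → subst (λ t → ∣ t ∣ < ε) (sym (difference m n)) (small _ _ (bound m n) (c n m hn hm))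


open Reals using (ℚ-orderedRing; ℝ-orderedRing; module ℚR; Eventually; eventually₁; eventually₂; between⇒∣p-q∣<e; p≤∣p∣; ≤-approx; pointwise-≈; pointwise-≤; reciprocal)

-- A positive eigenvector as a limit of ratios of rows

module PerronVectors where

  open ≡ using (refl; sym; trans; cong; cong₂; subst; subst₂)
  open import Data.Rational.Base using (_+_; _*_; -_; _-_; _<_; ∣_∣; 1/_)
  open D using (ℝ; mkℝ; seq; cauchy; fromℚ; 0<half; half+half; eventually-bounded)

  open ℚR using (solve; _:=_; _:+_; _:*_; _:-_; :-_)
  module ℝR = OrderedRingProperties ℝ-orderedRing

  naturals : ℕ → ℚ
  naturals zero    = 0ℚ
  naturals (suc n) = 1ℚ + naturals n

  naturals≡ : ∀ n → naturals n ≡ mkℚ (ℤ.+ n) 0 (Coprime.sym (Coprime.1-coprimeTo n))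
  naturals≡ zero    = refl
  naturals≡ (suc n) = trans (cong (1ℚ +_) (naturals≡ n)) (ℚₚ.toℚᵘ-injective (ℚᵘₚ.≃-trans (ℚₚ.toℚᵘ-homo-+ 1ℚ (mkℚ (ℤ.+ n) 0 (Coprime.sym (Coprime.1-coprimeTo n))))
    (ℚᵘ.*≡* (cong (ℤ._* ℤ.+ 1) (cong₂ ℤ._+_ (refl {x = ℤ.+ 1}) (ℤₚ.*-identityʳ (ℤ.+ n)))))))

  -- Dropping the denominator does not decrease the absolute value, so the successor of the absolute
  -- value of the numerator suffices.
  archimedean : ∀ q → ∃[ n ] q < naturals n
  archimedean q@(mkℚ a d _) = suc ℤ.∣ a ∣ , ℚₚ.≤-<-trans q≤ (subst (_< 1ℚ + naturals ℤ.∣ a ∣) (ℚₚ.+-identityˡ _) (ℚₚ.+-monoˡ-< (naturals ℤ.∣ a ∣) (ℚₚ.positive⁻¹ 1ℚ)))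
    where
    q≤ : q ℚ.≤ naturals ℤ.∣ a ∣
    q≤ = subst (q ℚ.≤_) (sym (naturals≡ ℤ.∣ a ∣)) (ℚ.*≤* (subst (ℤ._≤ ℤ.+ ℤ.∣ a ∣ ℤ.* ℤ.+ suc d) (sym (ℤₚ.*-identityʳ a))
      (ℤₚ.≤-trans (a≤∣a∣ a) (subst (ℤ.+ ℤ.∣ a ∣ ℤ.≤_) (ℤₚ.pos-* ℤ.∣ a ∣ (suc d)) (ℤ.+≤+ (ℕₚ.m≤m*n ℤ.∣ a ∣ (suc d)))))))
      where
      a≤∣a∣ : ∀ a → a ℤ.≤ ℤ.+ ℤ.∣ a ∣
      a≤∣a∣ (ℤ.+ n)    = ℤₚ.≤-refl
      a≤∣a∣ ℤ.-[1+ n ] = ℤ.-≤+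

  -- One small member for each ε is enough: for nested intervals it controls all later ones.
  Vanishing : (ℕ → ℚ) → Set
  Vanishing d = ∀ ε → 0ℚ < ε → ∃[ n ] d n < ε

  module Decay (g β : ℚ) (0≤g : 0ℚ ℚ.≤ g) (0<β : 0ℚ < β) (β≤1 : β ℚ.≤ 1ℚ) where

    open OrderedRing ℚ-orderedRing using (*-nonNeg)

    -- The geometric sequence with ratio 1 - `β`, in the form in which the distance between the two
    -- bounds shrinks.
    decay : ℕ → ℚ
    decay zero    = g
    decay (suc n) = decay n - β * decay n

    0≤β : 0ℚ ℚ.≤ β
    0≤β = ℚₚ.<⇒≤ 0<β

    naturals-nonNeg : ∀ n → 0ℚ ℚ.≤ naturals n
    naturals-nonNeg zero    = ℚₚ.≤-refl
    naturals-nonNeg (suc n) = ℚR.+-nonNeg ℚR.0≤1 (naturals-nonNeg n)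

    decay-nonNeg : ∀ n → 0ℚ ℚ.≤ decay n
    decay-nonNeg zero    = 0≤g
    decay-nonNeg (suc n) = subst (0ℚ ℚ.≤_) (trans (ℚₚ.*-distribʳ-+ d 1ℚ (- β)) (cong₂ _+_ (ℚₚ.*-identityˡ d) (sym (ℚₚ.neg-distribˡ-* β d))))
      (*-nonNeg (ℚR.diff-nonNeg β≤1) (decay-nonNeg n))
      where d = decay n

    decay-antitone : ∀ n → decay (suc n) ℚ.≤ decay n
    decay-antitone n = ℚR.≤-by (solve 2 (λ d b → d :- (d :- b :* d) := b :* d) refl (decay n) β) (*-nonNeg 0≤β (decay-nonNeg n))

    decay≤g : ∀ n → decay n ℚ.≤ g
    decay≤g zero    = ℚₚ.≤-refl
    decay≤g (suc n) = ℚₚ.≤-trans (decay-antitone n) (decay≤g n)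

    -- Bernoulli's inequality, in the form (1 - β)ⁿ (1 + n β) ≤ 1.
    bernoulli : ∀ n → decay n + (decay n * β) * naturals n ℚ.≤ g
    bernoulli zero    = ℚₚ.≤-reflexive (trans (cong (g +_) (ℚₚ.*-zeroʳ (g * β))) (ℚₚ.+-identityʳ g))
    bernoulli (suc n) = ℚₚ.≤-trans (ℚR.≤-by
      (trans (cong (λ t → (d + (d * β) * k) - (d - β * d + t)) (ℚₚ.*-distribˡ-+ ((d - β * d) * β) 1ℚ k))
        (trans (cong (λ t → (d + (d * β) * k) - (d - β * d + (t + ((d - β * d) * β) * k))) (ℚₚ.*-identityʳ ((d - β * d) * β)))
          (solve 3 (λ d b k → (d :+ (d :* b) :* k) :- (d :- b :* d :+ ((d :- b :* d) :* b :+ ((d :- b :* d) :* b) :* k))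
            := ((b :* b) :* d) :+ ((b :* b) :* d) :* k) refl d β k)))
      (ℚR.+-nonNeg ββd (*-nonNeg ββd (naturals-nonNeg n)))) (bernoulli n)
      where
      d = decay n
      k = naturals n
      ββd = *-nonNeg (*-nonNeg 0≤β 0≤β) (decay-nonNeg n)

    decay-vanishing : Vanishing decay
    decay-vanishing ε 0<ε = n , small
      where
      instance
        εβ⁺ : ℚ.Positive (ε * β)
        εβ⁺ = ℚ.positive (subst (_< ε * β) (ℚₚ.*-zeroʳ ε) (ℚₚ.*-monoʳ-<-pos ε {{ℚ.positive 0<ε}} 0<β))
        εβ≢0 : ℚ.NonZero (ε * β)
        εβ≢0 = ℚₚ.pos⇒nonZero (ε * β)
      -- Were `decay n` at least ε, Bernoulli's inequality would give ε β n ≤ g; hence a number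
      -- beyond g / (ε β).
      N = archimedean (g * (1/ (ε * β)))
      n = proj₁ N
      g<εβn : g < (ε * β) * naturals n
      g<εβn = subst (_< (ε * β) * naturals n) (trans (solve 3 (λ e g r → e :* (g :* r) := g :* (e :* r)) refl (ε * β) g _)
        (trans (cong (g *_) (ℚₚ.*-inverseʳ (ε * β))) (ℚₚ.*-identityʳ g))) (ℚₚ.*-monoʳ-<-pos (ε * β) (proj₂ N))
      small : decay n < ε
      small with decay n ℚₚ.<? ε
      ... | yes h = h
      ... | no h  = ⊥-elim (ℚₚ.<-irrefl refl (ℚₚ.<-≤-trans g<εβn (ℚₚ.≤-trans
        (ℚR.*-monoʳ-≤ (naturals-nonNeg n) (ℚR.*-monoʳ-≤ 0≤β (ℚₚ.≮⇒≥ h)))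
        (ℚₚ.≤-trans (subst (ℚ._≤ decay n + (decay n * β) * naturals n) (ℚₚ.+-identityˡ _) (ℚₚ.+-monoˡ-≤ _ (decay-nonNeg n))) (bernoulli n)))))

  monotone : ∀ (s : ℕ → ℚ) → (∀ n → s n ℚ.≤ s (suc n)) → ∀ {m n} → m ℕ.≤ n → s m ℚ.≤ s n
  monotone s inc {m} le = go (ℕₚ.≤⇒≤′ le)
    where
    go : ∀ {n} → m ℕ.≤′ n → s m ℚ.≤ s n
    go (ℕ.≤′-reflexive refl) = ℚₚ.≤-refl
    go (ℕ.≤′-step {n} p) = ℚₚ.≤-trans (go p) (inc n)

  module NestedIntervals (lo hi gap : ℕ → ℚ) (inc : ∀ n → lo n ℚ.≤ lo (suc n)) (dec : ∀ n → hi (suc n) ℚ.≤ hi n)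
    (lo≤hi : ∀ n → lo n ℚ.≤ hi n) (hi≡ : ∀ n → hi n ≡ lo n + gap n) (vanish : Vanishing gap) where

    hi-antitone : ∀ {m n} → m ℕ.≤ n → hi n ℚ.≤ hi m
    hi-antitone {m} {n} le = subst₂ ℚ._≤_ (neg-neg (hi n)) (neg-neg (hi m)) (ℚₚ.neg-antimono-≤ (monotone (-_ ∘ hi) (λ n → ℚₚ.neg-antimono-≤ (dec n)) le))
      where
      neg-neg : ∀ p → - (- p) ≡ p
      neg-neg = solve 1 (λ p → :- (:- p) := p) refl

    close : ∀ {N m n} → N ℕ.≤ m → N ℕ.≤ n → lo m ℚ.≤ lo n + gap N
    close {N} {m} {n} p q = ℚₚ.≤-trans (lo≤hi m) (ℚₚ.≤-trans (hi-antitone p)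
      (subst (ℚ._≤ lo n + gap N) (sym (hi≡ N)) (ℚₚ.+-monoˡ-≤ (gap N) (monotone lo inc q))))

    limit : ℝ
    limit = mkℝ lo λ ε 0<ε → let N , h = vanish ε 0<ε in N , λ m n p q → between⇒∣p-q∣<e
      (ℚₚ.≤-<-trans (close p q) (ℚₚ.+-monoʳ-< (lo n) h))
      (ℚₚ.≤-<-trans (close q p) (ℚₚ.+-monoʳ-< (lo m) h))

    lo≤limit : ∀ n → fromℚ (lo n) D.≤ limit
    lo≤limit n ε 0<ε = n , λ k le → ℚₚ.≤-<-trans (monotone lo inc le)
      (subst (_< lo k + ε) (ℚₚ.+-identityʳ (lo k)) (ℚₚ.+-monoʳ-< (lo k) 0<ε))

    limit≤hi : ∀ n → limit D.≤ fromℚ (hi n)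
    limit≤hi n ε 0<ε = n , λ k le → ℚₚ.≤-<-trans (ℚₚ.≤-trans (lo≤hi k) (hi-antitone le))
      (subst (_< hi n + ε) (ℚₚ.+-identityʳ (hi n)) (ℚₚ.+-monoʳ-< (hi n) 0<ε))

  -- An index `n` that brings the error below ε/2 is fixed first, using a bound on `C`; the stage of
  -- the Cauchy sequences is chosen afterwards.
  ≤-limit : ∀ {x y} (C : ℝ) {d : ℕ → ℚ} → (∀ n → 0ℚ ℚ.≤ d n) → Vanishing d →
    (∀ n → x D.≤ y D.+ fromℚ (d n) D.* C) → x D.≤ y
  ≤-limit {x} {y} C {d} 0≤d vanish h ε 0<ε =
    let B , 0<B , bounded = eventually-bounded (cauchy C)
        δ , 0<δ , small = D.bounded-*-small 0<B (0<half 0<ε)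
        n , dn<δ = vanish δ 0<δ
    in eventually₂ (λ k xk Ck → begin-strict
        seq x k                                   <⟨ xk ⟩
        (seq y k + d n * seq C k) + ½ * ε         <⟨ ℚₚ.+-monoˡ-< (½ * ε) (ℚₚ.+-monoʳ-< (seq y k) (ℚₚ.≤-<-trans (p≤∣p∣ _)
          (subst (λ t → ∣ t ∣ < ½ * ε) (ℚₚ.*-comm (seq C k) (d n)) (small (seq C k) (d n) Ck (subst (_< δ) (sym (ℚₚ.0≤p⇒∣p∣≡p (0≤d n))) dn<δ))))) ⟩
        (seq y k + ½ * ε) + ½ * ε                 ≡⟨ ℚₚ.+-assoc (seq y k) (½ * ε) (½ * ε) ⟩
        seq y k + (½ * ε + ½ * ε)                 ≡⟨ cong (seq y k +_) (half+half ε) ⟩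
        seq y k + ε                               ∎)
      (h n (½ * ε) (0<half 0<ε)) bounded
    where open ℚₚ.≤-Reasoning

  module ℚ≤ = OrderedRing ℚ-orderedRing
  module ℝ≤ = OrderedRing ℝ-orderedRing

  fromℚ-mono : ∀ {p q} → p ℚ.≤ q → fromℚ p D.≤ fromℚ q
  fromℚ-mono {p} {q} h = pointwise-≤ {fromℚ p} {fromℚ q} λ _ → h

  fromℚ-+ : ∀ p q → fromℚ (p + q) D.≈ fromℚ p D.+ fromℚ q
  fromℚ-+ p q = pointwise-≈ {fromℚ (p + q)} {fromℚ p D.+ fromℚ q} λ _ → refl

  fromℚ-* : ∀ p q → fromℚ (p * q) D.≈ fromℚ p D.* fromℚ q
  fromℚ-* p q = pointwise-≈ {fromℚ (p * q)} {fromℚ p D.* fromℚ q} λ _ → refl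

  fromℚ-∑ : ∀ {A : Set} (f : A → ℚ) xs → fromℚ (ℚR.∑ f xs) D.≈ ℝR.∑ (fromℚ ∘ f) xs
  fromℚ-∑ f []       = ℝ≤.refl {D.0ℝ}
  fromℚ-∑ f (x ∷ xs) = ℝ≤.trans {fromℚ (f x + ℚR.∑ f xs)} {fromℚ (f x) D.+ fromℚ (ℚR.∑ f xs)} {fromℚ (f x) D.+ ℝR.∑ (fromℚ ∘ f) xs}
    (fromℚ-+ (f x) (ℚR.∑ f xs)) (ℝ≤.+-congˡ {fromℚ (f x)} {fromℚ (ℚR.∑ f xs)} {ℝR.∑ (fromℚ ∘ f) xs} (fromℚ-∑ f xs))

  -- Entry `i` of the vector will be the limit of the ratios of row `i` to the reference row `o` in
  -- the powers of `P`. Commutation with `M` turns it into an eigenvector of `M`, of which `P` will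
  -- be a power.
  module Perron {m : ℕ} (o : Fin m) (M P : Fin m → Fin m → ℚ) (0≤M : ∀ i j → 0ℚ ℚ.≤ M i j)
    (commute : ∀ i j → ℚR.∑ (λ k → M i k * P k j) (allFin m) ≡ ℚR.∑ (λ k → P i k * M k j) (allFin m))
    (B : ℚ) (1≤P : ∀ i j → 1ℚ ℚ.≤ P i j) (P≤B : ∀ i j → P i j ℚ.≤ B) where

    module ℚM = Matrices ℚ-orderedRing {m}
    module ℝM = Matrices ℝ-orderedRing {m}
    open ℚM using (pow; _⊗_; I)
    open Energy ℚ-orderedRing using (∑-member)

    0<1 : 0ℚ < 1ℚ
    0<1 = ℚₚ.positive⁻¹ 1ℚ

    1≤B : 1ℚ ℚ.≤ B
    1≤B = ℚₚ.≤-trans (1≤P o o) (P≤B o o)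

    invert : ∀ q → 1ℚ ℚ.≤ q → ∃[ r ] (0ℚ < r × q * r ≡ 1ℚ)
    invert q 1≤q = 1/ q , ℚₚ.positive⁻¹ (1/ q) {{ℚₚ.1/pos⇒pos q}} , ℚₚ.*-inverseʳ q
      where
      instance
        q⁺ : ℚ.Positive q
        q⁺ = ℚ.positive (ℚₚ.<-≤-trans 0<1 1≤q)
        q≢0 : ℚ.NonZero q
        q≢0 = ℚₚ.pos⇒nonZero q

    β : ℚ
    β = proj₁ (invert B 1≤B)

    0<β : 0ℚ < β
    0<β = proj₁ (proj₂ (invert B 1≤B))

    B*β : B * β ≡ 1ℚ
    B*β = proj₂ (proj₂ (invert B 1≤B))

    0≤β : 0ℚ ℚ.≤ β
    0≤β = ℚₚ.<⇒≤ 0<β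

    β≤1 : β ℚ.≤ 1ℚ
    β≤1 = subst₂ ℚ._≤_ (ℚₚ.*-identityˡ β) B*β (ℚR.*-monoʳ-≤ 0≤β 1≤B)

    open ℚM.Contraction P B*β 1≤P P≤B 0≤β

    Q : ℕ → Fin m → Fin m → ℚ
    Q = pow P

    mutual
      1≤Q : ∀ n i j → 1ℚ ℚ.≤ Q n i j
      1≤Q zero    i j = 1≤P i j
      1≤Q (suc n) i j = ℚₚ.≤-trans
        (ℚₚ.≤-trans (1≤Q n i o) (subst (ℚ._≤ Q n i o * P o j) (ℚₚ.*-identityʳ (Q n i o)) (ℚR.*-monoˡ-≤ (0≤Q n i o) (1≤P o j))))
        (∑-member {f = λ k → Q n i k * P k j} (λ {k} _ → ℚ≤.*-nonNeg (0≤Q n i k) (ℚₚ.≤-trans ℚR.0≤1 (1≤P k j))) (∈-allFin o))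

      0≤Q : ∀ n i j → 0ℚ ℚ.≤ Q n i j
      0≤Q n i j = ℚₚ.≤-trans ℚR.0≤1 (1≤Q n i j)

    total : ∀ n → ∃[ y ] (0ℚ < y × ℚR.∑ (Q n o) I * y ≡ 1ℚ)
    total n = invert _ (ℚₚ.≤-trans (1≤Q n o o) (∑-member {f = Q n o} (λ {k} _ → 0≤Q n o k) (∈-allFin o)))

    -- The ratio of the sums of row `i` and of the reference row, towards which both bounds move.
    centre : ℕ → Fin m → ℚ
    centre n i = ℚR.∑ (Q n i) I * proj₁ (total n)

    lo hi : ℕ → Fin m → ℚ
    -- The entries of `P` lie between 1 and `B`, so a ratio of two of them lies between `β` and `B`.
    lo zero    i = β
    lo (suc n) i = lo n i + β * (centre n i - lo n i)
    hi zero    i = B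
    hi (suc n) i = hi n i - β * (hi n i - centre n i)

    open Decay (B - β) β (ℚR.diff-nonNeg (ℚₚ.≤-trans β≤1 1≤B)) 0<β β≤1 hiding (0≤β)

    -- The mean ratio cancels, so the gap is the same for all rows and shrinks by the fixed factor 1
    -- - `β`.
    hi≡lo+gap : ∀ n i → hi n i ≡ lo n i + decay n
    hi≡lo+gap zero    i = solve 2 (λ b B → B := b :+ (B :- b)) refl β B
    hi≡lo+gap (suc n) i = trans (cong (λ h → h - β * (h - centre n i)) (hi≡lo+gap n i))
      (solve 4 (λ l d b c → (l :+ d) :- b :* ((l :+ d) :- c) := (l :+ b :* (c :- l)) :+ (d :- b :* d)) refl (lo n i) (decay n) β (centre n i))

    mutual
      below : ∀ n i j → lo n i * Q n o j ℚ.≤ Q n i j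
      below zero    i j = ℚₚ.≤-trans (subst (β * P o j ℚ.≤_) (trans (ℚₚ.*-comm β B) B*β) (ℚR.*-monoˡ-≤ 0≤β (P≤B o j))) (1≤P i j)
      below (suc n) i j = proj₂ (raised n i) j

      raised : ∀ n i → _ × _
      raised n i = raise (Q n i) (Q n o) {proj₁ (total n)} (lo n i) (ℚₚ.<⇒≤ (proj₁ (proj₂ (total n)))) (proj₂ (proj₂ (total n))) (0≤Q n o) (below n i)

    mutual
      above : ∀ n i j → Q n i j ℚ.≤ hi n i * Q n o j
      above zero    i j = ℚₚ.≤-trans (P≤B i j) (subst (ℚ._≤ B * P o j) (ℚₚ.*-identityʳ B) (ℚR.*-monoˡ-≤ (ℚₚ.≤-trans ℚR.0≤1 1≤B) (1≤P o j)))
      above (suc n) i j = proj₂ (lowered n i) j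

      lowered : ∀ n i → _ × _
      lowered n i = lower (Q n i) (Q n o) {proj₁ (total n)} (hi n i) (ℚₚ.<⇒≤ (proj₁ (proj₂ (total n)))) (proj₂ (proj₂ (total n))) (0≤Q n o) (above n i)

    lo-increasing : ∀ i n → lo n i ℚ.≤ lo (suc n) i
    lo-increasing i n = subst (ℚ._≤ lo (suc n) i) (ℚₚ.+-identityʳ (lo n i)) (ℚₚ.+-monoʳ-≤ (lo n i) (ℚ≤.*-nonNeg 0≤β (proj₁ (raised n i))))

    hi-decreasing : ∀ i n → hi (suc n) i ℚ.≤ hi n i
    hi-decreasing i n = ℚR.≤-by (solve 2 (λ h t → h :- (h :- t) := t) refl (hi n i) (β * (hi n i - centre n i))) (ℚ≤.*-nonNeg 0≤β (proj₁ (lowered n i)))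

    lo≤hi : ∀ i n → lo n i ℚ.≤ hi n i
    lo≤hi i n = subst₂ ℚ._≤_ (ℚₚ.+-identityʳ (lo n i)) (sym (hi≡lo+gap n i)) (ℚₚ.+-monoʳ-≤ (lo n i) (decay-nonNeg n))

    module Entry (i : Fin m) = NestedIntervals (λ n → lo n i) (λ n → hi n i) decay (lo-increasing i) (hi-decreasing i) (lo≤hi i) (λ n → hi≡lo+gap n i) decay-vanishing

    vector : Fin m → ℝ
    vector i = Entry.limit i

    vector-positive : ∀ i → ℝR.Positive (vector i)
    vector-positive i = pointwise-≤ {D.0ℝ} {vector i} (λ n → ℚₚ.≤-trans 0≤β (β≤lo n)) , reciprocal (vector i) β 0<β β≤lo
      where
      β≤lo : ∀ n → β ℚ.≤ lo n i
      β≤lo n = monotone (λ n → lo n i) (lo-increasing i) {0} {n} ℕ.z≤n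

    Mℝ : Fin m → Fin m → ℝ
    Mℝ i j = fromℚ (M i j)

    -- The vector is normalised at the reference row, where it is a limit of ratios of a row to
    -- itself; so the entry of its image there is the eigenvalue.
    eigenvalue : ℝ
    eigenvalue = ℝR.∑ (λ j → Mℝ o j D.* vector j) I

    private
      fromℚ-⊗ : ∀ X Y i j → fromℚ ((X ⊗ Y) i j) D.≈ ℝM._⊗_ (λ i j → fromℚ (X i j)) (λ i j → fromℚ (Y i j)) i j
      fromℚ-⊗ X Y i j = ℝ≤.trans {fromℚ ((X ⊗ Y) i j)} {ℝR.∑ (λ k → fromℚ (X i k * Y k j)) I} {ℝR.∑ (λ k → fromℚ (X i k) D.* fromℚ (Y k j)) I}
        (fromℚ-∑ (λ k → X i k * Y k j) I)
        (ℝR.∑-cong {f = λ k → fromℚ (X i k * Y k j)} {g = λ k → fromℚ (X i k) D.* fromℚ (Y k j)} I λ {k} _ → fromℚ-* (X i k) (Y k j))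

      Qℝ : ℕ → Fin m → Fin m → ℝ
      Qℝ n i j = fromℚ (Q n i j)

      commuteℝ : ∀ n i j → ℝM._⊗_ Mℝ (Qℝ n) i j D.≈ ℝM._⊗_ (Qℝ n) Mℝ i j
      commuteℝ n i j = ℝ≤.trans {ℝM._⊗_ Mℝ (Qℝ n) i j} {fromℚ ((M ⊗ Q n) i j)} {ℝM._⊗_ (Qℝ n) Mℝ i j}
        (ℝ≤.sym {fromℚ ((M ⊗ Q n) i j)} {ℝM._⊗_ Mℝ (Qℝ n) i j} (fromℚ-⊗ M (Q n) i j))
        (subst (λ t → fromℚ t D.≈ ℝM._⊗_ (Qℝ n) Mℝ i j) (sym (ℚM.pow-commutes M P commute n i j)) (fromℚ-⊗ (Q n) M i j))

      module Approx (n : ℕ) = ℝM.ApproximateEigenvector Mℝ (Qℝ n) vector (λ i → fromℚ (lo n i)) (λ i → fromℚ (hi n i)) {fromℚ (decay n)} {fromℚ (B - β)} o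
        (λ i j → fromℚ-mono (0≤M i j)) (λ i j → fromℚ-mono (0≤Q n i j)) (λ i → proj₁ (vector-positive i))
        (fromℚ-mono (decay-nonNeg n)) (fromℚ-mono (decay≤g n))
        (commuteℝ n)
        (λ i → pointwise-≈ {fromℚ (hi n i)} {fromℚ (lo n i) D.+ fromℚ (decay n)} λ _ → hi≡lo+gap n i)
        (λ i → Entry.lo≤limit i n) (λ i → Entry.limit≤hi i n)
        (λ i j → pointwise-≤ {fromℚ (lo n i) D.* Qℝ n o j} {Qℝ n i j} λ _ → below n i j)
        (λ i j → pointwise-≤ {Qℝ n i j} {fromℚ (hi n i) D.* Qℝ n o j} λ _ → above n i j)
        (fromℚ-mono (0≤Q n o o) , reciprocal (fromℚ (Q n o o)) 1ℚ 0<1 λ _ → 1≤Q n o o)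

      C : Fin m → ℝ
      C i = Approx.constant 0 i

    eigenvector : ∀ i → ℝR.∑ (λ j → Mℝ i j D.* vector j) I D.≈ vector i D.* eigenvalue
    eigenvector i = ℝ≤.≤-antisym {X} {Y}
      (≤-limit {X} {Y} (C i) decay-nonNeg decay-vanishing (λ n → Approx.image≤ n i))
      (≤-limit {Y} {X} (C i) decay-nonNeg decay-vanishing (λ n → Approx.≤image n i))
      where
      X = ℝR.∑ (λ j → Mℝ i j D.* vector j) I
      Y = vector i D.* eigenvalue

  abstract

    perron : ∀ {m : ℕ} (o : Fin m) (M P : Fin m → Fin m → ℚ) → (∀ i j → 0ℚ ℚ.≤ M i j) →
      (∀ i j → ℚR.∑ (λ k → M i k * P k j) (allFin m) ≡ ℚR.∑ (λ k → P i k * M k j) (allFin m)) →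
      ∀ B → (∀ i j → 1ℚ ℚ.≤ P i j) → (∀ i j → P i j ℚ.≤ B) →
      Σ ℝ λ ρ → Σ (Fin m → ℝ) λ v → (∀ i → ℝR.Positive (v i)) ×
        (∀ i → ℝR.∑ (λ j → fromℚ (M i j) D.* v j) (allFin m) D.≈ v i D.* ρ)
    perron o M P 0≤M commute B 1≤P P≤B = eigenvalue , vector , vector-positive , eigenvector
      where open Perron o M P 0≤M commute B 1≤P P≤B


open PerronVectors using (module ℝR; module ℚ≤; module ℝ≤; fromℚ-mono; perron)

-- The first Dirichlet eigenvalue of a tree

module DirichletEigenvalues where

  open ≡ using (refl; sym; trans; cong; cong₂; subst; subst₂)
  open import Data.Rational.Base using (_+_; _*_; -_; _-_; _<_)
  open D using (ℝ; seq; fromℚ; fromℤ; Σℝ; IsEigenvalue)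
  open Star using (Star; ε; _◅_)

  open ℚR using (solve; _:=_; _:+_; _:-_; :-_)

  int : ℤ → ℚ
  int z = z ℚ./ 1

  int-+ : ∀ a b → int (a ℤ.+ b) ≡ int a + int b
  int-+ a b = ℚₚ.toℚᵘ-injective (begin
    ℚ.toℚᵘ (int (a ℤ.+ b))                    ≈⟨ ℚₚ.toℚᵘ-fromℚᵘ (ℚᵘ.mkℚᵘ (a ℤ.+ b) 0) ⟩
    ℚᵘ.mkℚᵘ (a ℤ.+ b) 0                       ≈⟨ ℚᵘ.*≡* (cong (ℤ._* ℤ.+ 1) (sym (cong₂ ℤ._+_ (ℤₚ.*-identityʳ a) (ℤₚ.*-identityʳ b)))) ⟩
    ℚᵘ.mkℚᵘ a 0 ℚᵘ.+ ℚᵘ.mkℚᵘ b 0              ≈⟨ ℚᵘₚ.+-cong (ℚₚ.toℚᵘ-fromℚᵘ (ℚᵘ.mkℚᵘ a 0)) (ℚₚ.toℚᵘ-fromℚᵘ (ℚᵘ.mkℚᵘ b 0)) ⟨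
    ℚ.toℚᵘ (int a) ℚᵘ.+ ℚ.toℚᵘ (int b)        ≈⟨ ℚₚ.toℚᵘ-homo-+ (int a) (int b) ⟨
    ℚ.toℚᵘ (int a + int b)                    ∎)
    where open ℚᵘₚ.≃-Reasoning

  int-- : ∀ a b → int (a ℤ.- b) ≡ int a - int b
  int-- a b = trans (solve 2 (λ x y → x := (x :+ y) :- y) refl (int (a ℤ.- b)) (int b))
    (cong (_- int b) (trans (sym (int-+ (a ℤ.- b) b)) (cong int a-b+b)))
    where
    a-b+b : a ℤ.- b ℤ.+ b ≡ a
    a-b+b = trans (ℤₚ.+-assoc a (ℤ.- b) b) (trans (cong (λ t → a ℤ.+ t) (ℤₚ.+-inverseˡ b)) (ℤₚ.+-identityʳ a))

  int-suc : ∀ d → int (ℤ.+ suc d) ≡ 1ℚ + int (ℤ.+ d)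
  int-suc d = int-+ (ℤ.+ 1) (ℤ.+ d)

  int-mono : ∀ {c d} → c ℕ.≤ d → int (ℤ.+ c) ℚ.≤ int (ℤ.+ d)
  int-mono {d = d} ℕ.z≤n = nonNeg d
    where
    nonNeg : ∀ d → 0ℚ ℚ.≤ int (ℤ.+ d)
    nonNeg zero    = ℚₚ.≤-refl
    nonNeg (suc d) = subst (0ℚ ℚ.≤_) (sym (int-suc d)) (ℚR.+-nonNeg ℚR.0≤1 (nonNeg d))
  int-mono (ℕ.s≤s {m} {n} le) = subst₂ ℚ._≤_ (sym (int-suc m)) (sym (int-suc n)) (ℚₚ.+-monoʳ-≤ 1ℚ (int-mono le))

  module ℝD = DirichletForm ℝ-orderedRing

  fromℤ-0 : fromℤ (ℤ.+ 0) D.≈ D.0ℝ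
  fromℤ-0 = pointwise-≈ {fromℤ (ℤ.+ 0)} {D.0ℝ} λ _ → refl

  fromℤ-suc : ∀ d → fromℤ (ℤ.+ suc d) D.≈ fromℚ 1ℚ D.+ fromℤ (ℤ.+ d)
  fromℤ-suc d = pointwise-≈ {fromℤ (ℤ.+ suc d)} {fromℚ 1ℚ D.+ fromℤ (ℤ.+ d)} λ _ → int-suc d

  fromℤ-- : ∀ a b → fromℤ (a ℤ.- b) D.≈ ℝR._-_ (fromℤ a) (fromℤ b)
  fromℤ-- a b = pointwise-≈ {fromℤ (a ℤ.- b)} {ℝR._-_ (fromℤ a) (fromℤ b)} λ _ → int-- a b

  ∃-uniform : ∀ {m} {P : ℕ → Fin m → Set} → (∀ {K L i} → K ℕ.≤ L → P K i → P L i) → (∀ i → ∃[ K ] P K i) → ∃[ K ] (∀ i → P K i)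
  ∃-uniform {zero}  mono p = 0 , λ ()
  ∃-uniform {suc m} mono p =
    let K , h = p zero
        L , k = ∃-uniform mono (p ∘ suc)
    in K ⊔ L , λ { zero → mono (ℕₚ.m≤m⊔n K L) h ; (suc i) → mono (ℕₚ.m≤n⊔m K L) (k i) }

  module DirichletPerron {n : ℕ} (T : TreeWithBoundary n) where

    open TreeWithBoundary T hiding (IsFirstDirichletEigenvalue)
    open TreePaths T
    open InteriorIndex T
    open Energy ℚ-orderedRing using (∑-member)
    open Matrices ℚ-orderedRing {∣V₀∣} using (pow; _⊗_; I; pow-commutes)

    private
      m = ∣V₀∣
      -- No degree exceeds `n`, so this shift makes all diagonal entries at least 1.
      c = int (ℤ.+ suc n)

    root : Fin m
    root = position (proj₂ someInterior)

    shifted : Fin m → Fin m → ℚ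
    shifted i j = (if ⌊ i ≟ᶠ j ⌋ then c else 0ℚ) - int (dirichlet i j)

    shifted-diagonal : ∀ i → 1ℚ ℚ.≤ shifted i i
    shifted-diagonal i with i ≟ᶠ i | vertex i ≟ᶠ vertex i
    ... | no k  | _     = ⊥-elim (k refl)
    ... | yes _ | no k  = ⊥-elim (k refl)
    ... | yes _ | yes _ rewrite irrefl (vertex i) = subst (λ z → 1ℚ ℚ.≤ c - int z) (sym (ℤₚ.+-identityʳ (ℤ.+ degree (vertex i))))
      (ℚR.≤-by (trans (cong (λ t → (t - int (ℤ.+ d)) - 1ℚ) (int-suc n))
        (solve 3 (λ o a b → ((o :+ a) :- b) :- o := a :- b) refl 1ℚ (int (ℤ.+ n)) (int (ℤ.+ d))))
        (ℚR.diff-nonNeg (int-mono d≤n)))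
      where
      d = degree (vertex i)
      d≤n : d ℕ.≤ n
      d≤n = ℕₚ.≤-trans (length-filter _ (allFin n)) (ℕₚ.≤-reflexive (length-tabulate {n = n} id))

    shifted-off : ∀ {i j} → i ≢ j → shifted i j ≡ int (adjacencyMatrix (vertex i) (vertex j))
    shifted-off {i} {j} i≢j with i ≟ᶠ j | vertex i ≟ᶠ vertex j
    ... | yes e | _     = ⊥-elim (i≢j e)
    ... | no _  | yes e = ⊥-elim (i≢j (vertex-injective e))
    ... | no _  | no _  = trans (cong (λ t → 0ℚ - t) (int-- (ℤ.+ 0) a)) (trans (ℚₚ.+-identityˡ _) (trans (cong -_ (ℚₚ.+-identityˡ (- int a))) (solve 1 (λ p → :- (:- p) := p) refl (int a))))
      where a = adjacencyMatrix (vertex i) (vertex j)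

    shifted-adjacent : ∀ {i j} → Adj (vertex i) (vertex j) → 1ℚ ℚ.≤ shifted i j
    shifted-adjacent {i} {j} a = subst (1ℚ ℚ.≤_) (sym (shifted-off λ { refl → adj-irrefl a refl })) (one a)
      where
      one : Adj (vertex i) (vertex j) → 1ℚ ℚ.≤ int (adjacencyMatrix (vertex i) (vertex j))
      one a with adj (vertex i) (vertex j)
      ... | true  = ℚₚ.≤-refl
      ... | false = ⊥-elim a

    shifted-nonNeg : ∀ i j → 0ℚ ℚ.≤ shifted i j
    shifted-nonNeg i j = decide (i ≟ᶠ j)
      where
      entry : ∀ b → 0ℚ ℚ.≤ int (if b then ℤ.+ 1 else ℤ.+ 0)
      entry true  = ℚR.0≤1
      entry false = ℚₚ.≤-refl
      decide : Dec (i ≡ j) → 0ℚ ℚ.≤ shifted i j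
      decide (yes refl) = ℚₚ.≤-trans ℚR.0≤1 (shifted-diagonal i)
      decide (no i≢j)   = subst (0ℚ ℚ.≤_) (sym (shifted-off i≢j)) (entry (adj (vertex i) (vertex j)))

    pow-nonNeg : ∀ K i j → 0ℚ ℚ.≤ pow shifted K i j
    pow-nonNeg zero    i j = shifted-nonNeg i j
    pow-nonNeg (suc K) i j = ℚR.∑-nonNeg I λ {k} _ → ℚ≤.*-nonNeg (pow-nonNeg K i k) (shifted-nonNeg k j)

    pow-step : ∀ {K i j l} → 1ℚ ℚ.≤ pow shifted K i j → 1ℚ ℚ.≤ shifted j l → 1ℚ ℚ.≤ pow shifted (suc K) i l
    pow-step {K} {i} {j} {l} p q = ℚₚ.≤-trans
      (ℚₚ.≤-trans p (subst (ℚ._≤ pow shifted K i j * shifted j l) (ℚₚ.*-identityʳ _) (ℚR.*-monoˡ-≤ (pow-nonNeg K i j) q)))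
      (∑-member {f = λ k → pow shifted K i k * shifted k l} (λ {k} _ → ℚ≤.*-nonNeg (pow-nonNeg K i k) (shifted-nonNeg k l)) (∈-allFin j))

    -- Diagonal entries of at least 1 let a walk wait at its end, so an entry that has reached 1
    -- remains at least 1 in all higher powers.
    pow-mono : ∀ {K L i j} → K ℕ.≤ L → 1ℚ ℚ.≤ pow shifted K i j → 1ℚ ℚ.≤ pow shifted L i j
    pow-mono {K} {i = i} {j} le p = go (ℕₚ.≤⇒≤′ le)
      where
      go : ∀ {L} → K ℕ.≤′ L → 1ℚ ℚ.≤ pow shifted L i j
      go (ℕ.≤′-reflexive refl) = p
      go (ℕ.≤′-step {L} q) = pow-step {L} (go q) (shifted-diagonal j)

    star-pow : ∀ {i j l} → Star (λ i j → 1ℚ ℚ.≤ shifted i j) j l → ∃[ K ] 1ℚ ℚ.≤ pow shifted K i j → ∃[ K ] 1ℚ ℚ.≤ pow shifted K i l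
    star-pow ε        p       = p
    star-pow (q ◅ qs) (K , p) = star-pow qs (suc K , pow-step {K} p q)

    adjacent-positions : ∀ {u v} (i : IsInterior u) (j : IsInterior v) → Adj u v → 1ℚ ℚ.≤ shifted (position i) (position j)
    adjacent-positions i j a = shifted-adjacent (subst₂ Adj (sym (vertex-position i)) (sym (vertex-position j)) a)

    -- Inner vertices of a path are interior, so deleting the leaves does not disconnect the
    -- interior.
    path-star : ∀ {u ys v} → Path Adj u ys v → (i : IsInterior u) (j : IsInterior v) → Star (λ i j → 1ℚ ℚ.≤ shifted i j) (position i) (position j)
    path-star (edge a _)     i j = adjacent-positions i j a ◅ ε
    path-star q@(link a _ p) i j = adjacent-positions i k a ◅ path-star p k j
      where k = inner-interior q (here refl)

    connected-positions : ∀ i j → Star (λ i j → 1ℚ ℚ.≤ shifted i j) i j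
    connected-positions i j with star⇒path (walk⇒star (connected (vertex i) (vertex j)))
    ... | inj₁ e rewrite vertex-injective e = ε
    ... | inj₂ (_ , p) = subst₂ (Star _) (position-vertex i _) (position-vertex j _) (path-star p (vertex-interior i) (vertex-interior j))

    -- A walk between two interior vertices provides an exponent for that pair, and by `pow-mono`
    -- the largest of these finitely many serves all pairs.
    pow-positive : ∃[ K ] (∀ i j → 1ℚ ℚ.≤ pow shifted K i j)
    pow-positive = ∃-uniform (λ {K} {L} le p j → pow-mono {K} {L} le (p j)) λ i → ∃-uniform (λ {K} {L} → pow-mono {K} {L}) λ j →
      star-pow (connected-positions i j) (0 , shifted-diagonal i)

    private
      K = proj₁ pow-positive
      P = pow shifted K

      B : ℚ
      B = ℚR.∑ (λ i → ℚR.∑ (P i) I) I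

      P≤B : ∀ i j → P i j ℚ.≤ B
      P≤B i j = ℚₚ.≤-trans
        (∑-member {f = P i} (λ {j} _ → pow-nonNeg K i j) (∈-allFin j))
        (∑-member {f = λ i → ℚR.∑ (P i) I} (λ {i} _ → ℚR.∑-nonNeg I λ {j} _ → pow-nonNeg K i j) (∈-allFin i))

      limit = perron root shifted P shifted-nonNeg (pow-commutes shifted shifted (λ _ _ → refl) K) B (proj₂ pow-positive) P≤B
      ρ = proj₁ limit

    eigenvector : Fin m → ℝ
    eigenvector = proj₁ (proj₂ limit)

    eigenvector-positive : ∀ i → ℝR.Positive (eigenvector i)
    eigenvector-positive = proj₁ (proj₂ (proj₂ limit))

    eigenvalue : ℝ
    eigenvalue = ℝR._-_ (fromℚ c) ρ

    eigen-equation : ∀ i → ℝR.∑ (λ j → fromℤ (dirichlet i j) D.* eigenvector j) (allFin m) D.≈ eigenvalue D.* eigenvector i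
    eigen-equation = ℝD.shift-eigenvector {m} {λ i j → fromℤ (dirichlet i j)} {λ i j → fromℚ (shifted i j)} {fromℚ c} {ρ} {eigenvector}
      split (proj₂ (proj₂ (proj₂ limit)))
      where
      split : ∀ i j → fromℚ (shifted i j) D.≈ ℝR._-_ (ℝD.scalar (fromℚ c) i j) (fromℤ (dirichlet i j))
      split i j with i ≟ᶠ j
      ... | yes _ = pointwise-≈ {fromℚ (c - int (dirichlet i j))} {ℝR._-_ (fromℚ c) (fromℤ (dirichlet i j))} λ _ → refl
      ... | no _  = pointwise-≈ {fromℚ (0ℚ - int (dirichlet i j))} {ℝR._-_ D.0ℝ (fromℤ (dirichlet i j))} λ _ → refl

    groundState : Energy.IsGroundState ℝ-orderedRing T eigenvalue (ℝD.extend T eigenvector)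
    groundState = ℝD.extend-ground fromℤ fromℤ-0 fromℤ-suc fromℤ-- T {eigenvalue} {eigenvector} eigenvector-positive eigen-equation

    Σℝ≡∑ : ∀ {k} (f : Fin k → ℝ) → Σℝ f ≡ ℝR.∑ f (allFin k)
    Σℝ≡∑ {zero}  f = refl
    Σℝ≡∑ {suc k} f = cong (f zero D.+_) (trans (Σℝ≡∑ (f ∘ suc)) (sym (ℝD.∑-tabulate f suc)))

    -- If `≤-approx` finds `ev` smaller by a rational δ, then `ground-minimal` makes `x` vanish,
    -- against `x≉0`. That lemma needs a gap with an inverse, which the explicit δ supplies.
    eigenvalue-minimal : ∀ ev → IsEigenvalue (λ i j → fromℤ (dirichlet i j)) ev → eigenvalue D.≤ ev
    eigenvalue-minimal ev (x , x≉0 , eig) e 0<e = decide (≤-approx eigenvalue ev e 0<e)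
      where
      decide : _ ⊎ _ → Eventually (λ n → seq eigenvalue n < seq ev n + e)
      decide (inj₁ h) = h
      decide (inj₂ (δ , 0<δ , h)) = ⊥-elim (x≉0 (ℝD.ground-minimal fromℤ fromℤ-0 fromℤ-suc fromℤ-- T {eigenvalue} groundState {ev} {fromℚ δ} {x}
        (fromℚ-mono (ℚₚ.<⇒≤ 0<δ) , reciprocal (fromℚ δ) δ 0<δ λ _ → ℚₚ.≤-refl)
        (λ η 0<η → eventually₁ (λ k lt → ℚₚ.<-trans lt (subst (_< seq eigenvalue k + η) (ℚₚ.+-identityʳ (seq eigenvalue k)) (ℚₚ.+-monoʳ-< (seq eigenvalue k) 0<η))) h)
        (λ i → subst (D._≈ ev D.* x i) (Σℝ≡∑ (λ j → fromℤ (dirichlet i j) D.* x j)) (eig i))))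

    isFirst : TreeWithBoundary.IsFirstDirichletEigenvalue T eigenvalue
    isFirst = (eigenvector , (λ z → ℝR.positive≰0 {eigenvector root} (eigenvector-positive root) (ℝ≤.≤-reflexive {eigenvector root} {D.0ℝ} (z root)))
      , λ i → subst (D._≈ eigenvalue D.* eigenvector i) (sym (Σℝ≡∑ (λ j → fromℤ (dirichlet i j) D.* eigenvector j))) (eigen-equation i))
      , eigenvalue-minimal


open DirichletEigenvalues

-- Faber-Krahn property and comets

open import Defs
open import Data.Nat using (ℕ; _∸_) renaming (_≤_ to _≤ℕ_)
open import Data.Product using (_×_)
open import Function.Bundles using (_⇔_)
open ≡ using (sym; trans; subst)
open Comparison ℝ-orderedRing using (faber-krahn; faber-krahn-rigid)
open TreeWithBoundary using (∣V₀∣; IsFirstDirichletEigenvalue)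

-- A tree with an interior vertex has two leaves; `standardComet` asks for the resulting bound.
2+∣V₀∣≤n : ∀ {n} (G : TreeWithBoundary n) → suc (suc (∣V₀∣ G)) ≤ℕ n
2+∣V₀∣≤n G = unique-length≤ distinct
  where
  open TreeWithBoundary G hiding (∣V₀∣; IsFirstDirichletEigenvalue)
  open TreePaths G
  b = proj₁ someBoundary
  bd = proj₂ someBoundary
  c = proj₁ (another-boundary b bd)
  cd = proj₁ (proj₂ (another-boundary b bd))
  boundary∉ : ∀ {v} → IsBoundary v → v ∉ interior
  boundary∉ vb v∈ = interior-not-boundary (∈-interior⁻ G v∈) vb
  distinct : Unique (c ∷ b ∷ interior)
  distinct = (proj₂ (proj₂ (another-boundary b bd)) ∷ ∉⇒All≢ (boundary∉ cd)) ∷ ∉⇒All≢ (boundary∉ bd) ∷ interior-unique G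

standardComet : ∀ n k → 1 ≤ℕ k → suc (suc k) ≤ℕ n →
  Σ (TreeWithBoundary n) λ C → ∣V₀∣ C ≡ k × ∃[ b ] ∃[ ys ] ∃[ z ] CometLayout C b ys z
standardComet (suc n₁) (suc k₁) _ (ℕ.s≤s lt) = comet , comet-interior , _ , _ , _ , comet-layout
  where open StandardComet n₁ k₁ lt

eigenvalue-≤ : ∀ {n} (G : TreeWithBoundary n) {ev} → IsFirstDirichletEigenvalue G ev → ev ≤ DirichletPerron.eigenvalue G
eigenvalue-≤ G first = proj₂ first (DirichletPerron.eigenvalue G) (proj₁ (DirichletPerron.isFirst G))

-- The given values are compared through the constructed ones: `evG ≤ μ` because `μ` is an
-- eigenvalue of `G`, and `ν ≤ evH` because `ν` is the least one of `H`.
comet⇒faberKrahn : ∀ {n k} (G : TreeWithBoundary n) → 𝒯 n k G → IsComet G → HasFaberKrahn (𝒯 n k) G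
comet⇒faberKrahn G gk cG = gk , λ H hk {evG} {evH} firstG firstH →
  let _ , _ , _ , C = isComet⇒layout G cG
      open DirichletPerron G renaming (eigenvalue to μ; groundState to φ)
      open DirichletPerron H renaming (eigenvalue to ν; groundState to f; eigenvalue-minimal to ν-minimal)
  in ℝ≤.≤-trans {evG} {μ} {evH} (eigenvalue-≤ G {evG} firstG)
       (ℝ≤.≤-trans {μ} {ν} {evH}
         (faber-krahn C (trans gk (sym hk)) {μ} {_} {ν} φ f)
         (ν-minimal evH (proj₁ firstH)))

-- Tested against the standard comet, the hypothesis gives `ν ≤ μ`, which is the equality case of
-- the comparison.
faberKrahn⇒comet : ∀ {n k} (G : TreeWithBoundary n) → 1 ≤ℕ k → 𝒯 n k G → HasFaberKrahn (𝒯 n k) G → IsComet G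
faberKrahn⇒comet {n} {k} G 1≤k gk (_ , least) =
  let C , ck , _ , _ , _ , L = standardComet n k 1≤k (subst (λ j → suc (suc j) ≤ℕ n) gk (2+∣V₀∣≤n G))
      open DirichletPerron C renaming (eigenvalue to μ; groundState to φ; isFirst to μ-first)
      open DirichletPerron G renaming (eigenvalue to ν; groundState to f; isFirst to ν-first)
  in isComet-stable G (faber-krahn-rigid L (trans ck (sym gk)) {μ} {_} {ν} φ f
       (least C ck {ν} {μ} ν-first μ-first))

theorem1 : (n k : ℕ) → 1 ≤ℕ k → k ≤ℕ n ∸ 1 →
    ((G : TreeWithBoundary n) → 𝒯 n k G → HasFaberKrahn (𝒯 n k) G ⇔ IsComet G) ×
    ((G H : TreeWithBoundary n) → 𝒯 n k G → 𝒯 n k H → IsComet G → IsComet H →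
    TreeWithBoundary.graph G ≅ TreeWithBoundary.graph H)
theorem1 n k 1≤k _ =
  (λ G gk → mk⇔ (faberKrahn⇒comet G 1≤k gk) (comet⇒faberKrahn G gk)) ,
  (λ G H gk hk → comets-isomorphic G H (trans gk (sym hk)))
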